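{- Let $(G,F)$ be a framed graph and $\mathscr L=\mathscr{L}_{G,F}$ its framing lattice. Then the core label order $CL(\mathscr L)$ is isomorphic to the poset of $\mathrm{ccw}$-core label sets $\{\psi^{\mathrm{ccw}}_{\mathscr L}(x): x\in\mathscr L\}$ ordered by inclusion.
   Context: A flow graph $G$ is a finite directed acyclic multigraph with linearly ordered vertices, edges directed from smaller to larger vertices, a unique source $s$ and unique sink $t$; a route is a directed $s$–$t$ path. A framing $F$ gives at each vertex $v$ linear orders $\le_{\mathrm{In}(v)}$, $\le_{\mathrm{Out}(v)}$ on entering and leaving edges. For a path $P$ through $v$, $Pv$ (resp. $vP$) is the maximal subpath of $P$ ending (resp. starting) at $v$. For $Pv,Qv$, let $w$ be the first vertex after which they coincide; if $w$ is the first vertex of one of them they are equal, else $Pv<_{\mathscr I(v)}Qv$ iff $P$'s edge entering $w$ precedes $Q$'s in $\le_{\mathrm{In}(w)}$. Dually for $vP,vQ$ with $w'$ the last vertex before which they coincide, using $\le_{\mathrm{Out}(w')}$, giving $<_{\mathscr O(v)}$. For paths $P,Q$ with common inner vertex $v$ (neither first nor last vertex of either), $P<_v^{cw}Q$ means $Pv<_{\mathscr I(v)}Qv$ and $vQ<_{\mathscr O(v)}vP$; they are incoherent at $v$ if $P<_v^{cw}Q$ or $Q<_v^{cw}P$, coherent if incoherent at no common inner vertex. A clique is a set of pairwise coherent routes. For maximal cliques, $C\lessdot C'$ if $C'=(C\setminus\{R\})\cup\{R'\}$ with $R<_v^{cw}R'$ for some $v$; the framing lattice $\mathscr L_{G,F}$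 is the set of maximal cliques with the reflexive-transitive closure of $\lessdot$ (it is a finite congruence uniform lattice). For a cover $C_1\lessdot C_2$ with $C_2=(C_1\setminus\{R_1\})\cup\{R_2\}$, the routes $R_1,R_2$ are incoherent exactly at the vertices of one maximal path $P\subseteq R_1\cap R_2$; the ccw-extended path label $\widetilde\ell_2(C_1,C_2)$ is the path obtained from $P$ by adding the edge of $R_2$ entering the first vertex of $P$ and the edge of $R_2$ leaving the last vertex of $P$. For an element $x$ of a finite lattice let $x_\downarrow$ be the meet of all elements covered by $x$. Define $\psi^{\mathrm{ccw}}_{\mathscr L}(x)=\{\widetilde\ell_2(u,v): x_\downarrow\le u\lessdot v\le x\}$. For a congruence uniform lattice $\mathscr L$ and a cover $u\lessdot v$, let $cg(u,v)$ be the finest lattice congruence in which $u\equiv v$; there is a unique join-irreducible $\mathfrak j$ (with unique lower cover $\mathfrak j_*$) with $cg(u,v)=cg(\mathfrak j_*,\mathfrak j)$, denoted $\mathfrak j_{cg(u,v)}$. The core label set of $x$ is $\psi_{\mathscr L}(x)=\{\mathfrak j_{cg(u,v)}: x_\downarrow\le u\lessdot v\le x\}$, and the core label order $CL(\mathscr L)$ is the set of elements of $\mathscr L$ with $x\sqsubseteq y$ iff $\psi_{\mathscr L}(x)\subseteq\psi_{\mathscr L}(y)$. -}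

module Defs where

open import Data.Nat as ℕ using (ℕ)
open import Data.Fin as Fin using (Fin; _≟_)
open import Data.List using (List; []; _∷_; _++_; map; reverse)
open import Data.List.Membership.Propositional using (_∈_)
open import Data.List.Relation.Unary.All using (All)
open import Data.Product using (Σ; ∃; ∃₂; _×_; _,_; proj₁; proj₂)
open import Data.Sum using (_⊎_)
open import Data.Unit using (⊤)
open import Data.Empty using (⊥)
open import Relation.Nullary using (¬_; yes; no)
open import Relation.Binary.PropositionalEquality using (_≡_; _≢_)
open import Function.Bundles using (_⇔_)

-- Flow graphs.  Vertices are Fin n (linearly ordered by the order of
-- Fin), edges are Fin m (a multigraph: parallel edges allowed), every
-- edge goes from a smaller to a larger vertex (hence acyclic), with a
-- unique source s and a unique sink t.

record FlowGraph : Set where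
  field
    n m      : ℕ
    src tgt  : Fin m → Fin n
    src<tgt  : ∀ e → src e Fin.< tgt e
    s t      : Fin n
    s-source : ∀ e → tgt e ≢ s
    s-unique : ∀ v → (∀ e → tgt e ≢ v) → v ≡ s
    t-sink   : ∀ e → src e ≢ t
    t-unique : ∀ v → (∀ e → src e ≢ v) → v ≡ t

-- A framing: at each vertex v, a linear order on In(v) and on Out(v).
-- A linear order on a finite set is encoded by an injective ranking:
-- for e, f ∈ In(v), e ≤_In(v) f  iff  inRank e ≤ inRank f
-- (injectivity of the rank on each In(v), resp. Out(v), makes it linear).

record Framing (G : FlowGraph) : Set where
  open FlowGraph G
  field
    inRank outRank : Fin m → ℕ
    inRank-inj  : ∀ e f → tgt e ≡ tgt f → inRank e ≡ inRank f → e ≡ f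
    outRank-inj : ∀ e f → src e ≡ src f → outRank e ≡ outRank f → e ≡ f

module LatticeNotions {A : Set} (_≈_ _≤_ : A → A → Set) where

  _<_ : A → A → Set
  x < y = x ≤ y × ¬ (y ≤ x)

  Cover : A → A → Set
  Cover u v = u < v × (∀ z → ¬ (u < z × z < v))

  IsGLB : (A → Set) → A → Set
  IsGLB S m = (∀ y → S y → m ≤ y) × (∀ z → (∀ y → S y → z ≤ y) → z ≤ m)

  IsLUB : (A → Set) → A → Set
  IsLUB S m = (∀ y → S y → y ≤ m) × (∀ z → (∀ y → S y → y ≤ z) → m ≤ z)

  Pair : A → A → A → Set
  Pair a b y = (y ≈ a) ⊎ (y ≈ b)

  DownBelow : A → A → Set
  DownBelow x u = ∃ λ m → IsGLB (λ y → Cover y x) m × m ≤ u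

  record IsCongruence (θ : A → A → Set) : Set where
    field
      reflθ  : ∀ x y → x ≈ y → θ x y
      symθ   : ∀ x y → θ x y → θ y x
      transθ : ∀ x y z → θ x y → θ y z → θ x z
      meetθ  : ∀ a b c m₁ m₂ → θ a b → IsGLB (Pair a c) m₁ → IsGLB (Pair b c) m₂ → θ m₁ m₂
      joinθ  : ∀ a b c j₁ j₂ → θ a b → IsLUB (Pair a c) j₁ → IsLUB (Pair b c) j₂ → θ j₁ j₂

  -- cg(u,v) = cg(a,b): the finest congruences collapsing u,v resp. a,b
  -- coincide, i.e. exactly the same congruences collapse u,v and a,b.
  SameCg : A → A → A → A → Set₁
  SameCg u v a b = ∀ θ → IsCongruence θ → (θ u v ⇔ θ a b)

  JoinIrr : A → A → Set
  JoinIrr j j* = Cover j* j × (∀ y → Cover y j → y ≈ j*)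

  CoreLabel : A → A → Set₁
  CoreLabel x j = ∃ λ j* → JoinIrr j j* ×
    ∃₂ λ u v → DownBelow x u × Cover u v × v ≤ x × SameCg u v j* j

  _⊑_ : A → A → Set₁
  x ⊑ y = ∀ j → CoreLabel x j → CoreLabel y j

module Framed (G : FlowGraph) (F : Framing G) where
  open FlowGraph G
  open Framing F

  V E : Set
  V = Fin n
  E = Fin m

  Chain : V → List E → Set
  Chain v []       = ⊤
  Chain v (e ∷ es) = src e ≡ v × Chain (tgt e) es

  endV : V → List E → V
  endV v []       = v
  endV v (e ∷ es) = endV (tgt e) es

  IsRoute : List E → Set
  IsRoute R = Chain s R × endV s R ≡ t

  innerVerts : List E → List V
  innerVerts []           = []
  innerVerts (e ∷ [])     = []
  innerVerts (e ∷ f ∷ es) = tgt e ∷ innerVerts (f ∷ es)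

  Inner : V → List E → Set
  Inner v P = v ∈ innerVerts P

  upTo : V → List E → List E
  upTo v [] = []
  upTo v (e ∷ es) with tgt e ≟ v
  ... | yes _ = e ∷ []
  ... | no _  = e ∷ upTo v es

  from : V → List E → List E
  from v [] = []
  from v (e ∷ es) with tgt e ≟ v
  ... | yes _ = es
  ... | no _  = from v es

  -- comparison of Pv, Qv given as reversed edge lists (last edge first):
  -- skip the common part; at the first divergence (entering vertex w)
  -- compare in ≤_In(w); if one runs out, they are equal (not <).
  ltIn : List E → List E → Set
  ltIn [] _ = ⊥
  ltIn (_ ∷ _) [] = ⊥
  ltIn (e ∷ es) (f ∷ fs) with e ≟ f
  ... | yes _ = ltIn es fs
  ... | no _  = inRank e ℕ.< inRank f

  ltOut : List E → List E → Set
  ltOut [] _ = ⊥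
  ltOut (_ ∷ _) [] = ⊥
  ltOut (e ∷ es) (f ∷ fs) with e ≟ f
  ... | yes _ = ltOut es fs
  ... | no _  = outRank e ℕ.< outRank f

  CW : List E → List E → V → Set
  CW P Q v = Inner v P × Inner v Q ×
             ltIn (reverse (upTo v P)) (reverse (upTo v Q)) ×
             ltOut (from v Q) (from v P)

  Incoh : List E → List E → V → Set
  Incoh P Q v = CW P Q v ⊎ CW Q P v

  Coherent : List E → List E → Set
  Coherent P Q = ∀ v → ¬ Incoh P Q v

  IsMaxClique : List (List E) → Set
  IsMaxClique C =
    (∀ R → R ∈ C → IsRoute R) ×
    (∀ P Q → P ∈ C → Q ∈ C → Coherent P Q) ×
    (∀ R → IsRoute R → (∀ P → P ∈ C → Coherent R P) → R ∈ C)

  MC : Set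
  MC = Σ (List (List E)) IsMaxClique

  _≈_ : MC → MC → Set
  x ≈ y = ∀ R → (R ∈ proj₁ x → R ∈ proj₁ y) × (R ∈ proj₁ y → R ∈ proj₁ x)

  Flip : MC → MC → List E → List E → Set
  Flip x y R₁ R₂ = R₁ ∈ proj₁ x ×
    (∀ Q → Q ∈ proj₁ y ⇔ ((Q ∈ proj₁ x × Q ≢ R₁) ⊎ Q ≡ R₂)) ×
    ∃ λ v → CW R₁ R₂ v

  _⋖_ : MC → MC → Set
  x ⋖ y = ∃₂ λ R₁ R₂ → Flip x y R₁ R₂

  data _≤_ : MC → MC → Set where
    ≤-≈    : ∀ {x y} → x ≈ y → x ≤ y
    ≤-step : ∀ {x y z} → x ⋖ y → y ≤ z → x ≤ z

  open LatticeNotions _≈_ _≤_ public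

  verts : V → List E → List V
  verts a es = a ∷ map tgt es

  -- ccw-extended path label of the flip R1 ↦ R2: P is the path
  -- (start a, edges Pes) contained in R1 ∩ R2 whose vertices are exactly
  -- the vertices where R1, R2 are incoherent; L = e · P · f with e, f the
  -- edges of R2 entering the first / leaving the last vertex of P.
  LabelOf : List E → List E → List E → Set
  LabelOf R₁ R₂ L = ∃ λ a → ∃ λ Pes → ∃₂ λ e f →
    Chain a Pes ×
    (∀ w → (w ∈ verts a Pes) ⇔ Incoh R₁ R₂ w) ×
    All (_∈ R₁) Pes × All (_∈ R₂) Pes ×
    e ∈ R₂ × tgt e ≡ a × f ∈ R₂ × src f ≡ endV a Pes ×
    L ≡ e ∷ (Pes ++ f ∷ [])

  CcwLabel : MC → MC → List E → Set
  CcwLabel x y L = ∃₂ λ R₁ R₂ → Flip x y R₁ R₂ × LabelOf R₁ R₂ L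

  PsiCCW : MC → List E → Set
  PsiCCW x L = ∃₂ λ u v → DownBelow x u × CcwLabel u v L × v ≤ x

  _≐_ : (List E → Set) → (List E → Set) → Set
  S ≐ T = ∀ L → (S L → T L) × (T L → S L)

  _⊆ₚ_ : (List E → Set) → (List E → Set) → Set
  S ⊆ₚ T = ∀ L → S L → T L

  CCWSet : Set₁
  CCWSet = Σ (List E → Set) λ S → ∃ λ x → S ≐ PsiCCW x

{-# OPTIONS --safe #-}
module Submission where

-- A route with a marked vertex is a pair (p , q) of a path read backwards and a path read
-- forwards, and R <ᶜʷ R′ at that vertex means p ≺ p′ and q′ ≺ q lexicographically.  Write R ◁ R′
-- if this happens at some vertex.  Maximal cliques are the concepts of the relation "not R ◁ R′"
-- between routes, because a path can be extended greedily without creating incoherences; hence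
-- they form a lattice, and its order turns out to be generated by the flips.  A flip u ⋖ v with
-- label L = e·P·f is governed by L alone: an element below v is below u unless no route of it is
-- ◁ L.  So the least element none of whose routes is ◁ L is join-irreducible, and it is
-- perspective to every flip labelled L, which makes equally labelled flips generate the same
-- congruence.  Conversely, "the same paths not crossing P between e and f have no route of the
-- clique below them" is a congruence that collapses exactly the flips whose labels cross L in
-- this way, and crossing is antisymmetric, so the congruence determines the label.

open import Defs
open import Data.Nat as ℕ using (ℕ; zero; suc; _+_; _∸_; z≤n; s≤s)
import Data.Nat.Properties as ℕₚ
open import Data.Nat.ListAction using (sum)
open import Data.Fin using (toℕ; _≟_)
import Data.Fin.Properties as Finₚ
open import Data.List using (List; []; _∷_; _++_; reverse; _ʳ++_; initLast; _∷ʳ′_; length; map; concatMap; filter; allFin)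
open import Data.List.Properties using (∷-injective; ++-ʳ++; ʳ++-ʳ++; ʳ++-defn; ++-assoc; ++-identityʳ; ++-cancelˡ; ∷ʳ-injective; reverse-++; reverse-involutive; length-++; length-ʳ++; ≡-dec)
open import Data.List.Membership.Propositional using (_∈_; _∉_; find; lose)
open import Data.List.Membership.Propositional.Properties using (∈-concatMap⁺; ∈-map⁺; ∈-filter⁺; ∈-filter⁻; ∈-allFin; ∈-++⁺ˡ; ∈-++⁺ʳ; ∈-++⁻)
import Data.List.Membership.DecPropositional as DecMembership
open import Data.List.Relation.Unary.Any using (Any; here; there; any?)
import Data.List.Relation.Unary.Any as Any
open import Data.List.Relation.Unary.All using (All; []; _∷_; all?; lookup; tabulate)
open import Data.Product using (Σ; ∃; ∃₂; _×_; _,_; proj₁; proj₂)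
open import Data.Sum using (_⊎_; inj₁; inj₂; [_,_]′)
open import Data.Unit using (tt)
open import Data.Empty using (⊥; ⊥-elim)
open import Function using (flip; _∘_; case_of_; _⇔_; mk⇔; Equivalence)
open import Relation.Nullary using (¬_; yes; no; Dec; _×-dec_; _→-dec_; ¬?)
open import Relation.Nullary.Decidable using (map′; decidable-stable)
open import Relation.Binary using (tri<; tri≈; tri>)
open import Relation.Binary.PropositionalEquality hiding (J)

-- The generated order `_≤_` gives no direct access to meets, joins or covers. The proof therefore
-- works with `_≼_`, which compares routes only, and pays by showing that the two agree: an interval
-- either has an explicit element strictly inside or is a single flip. Three devices recur. A path
-- with a marked vertex is `p ʳ++ q`, so both sides are words read outwards from the mark. A
-- comparison is decided at one edge, so an incoherence lives on the stretch between its two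
-- deciding edges, and changing these end edges acts monotonically. Reversing every order of the
-- framing turns `◁` around, so all of `Oriented` also holds upside down. That the label set
-- determines `x` is independent of congruences. If `x` is not below `y`, some flip `u ⋖ x` lies
-- over their meet. Its label `L` satisfies `above x L`. Were `L` a label of `y`, then `above y L`
-- too, hence the same for the meet and for `u`; but this fails for a flip labelled `L`.

module _ {A : Set} where

  -- Words read outwards from a mark, and their lexicographic order.

  ʳ++-assoc : (a b c : List A) → (a ʳ++ b) ++ c ≡ a ʳ++ (b ++ c)
  ʳ++-assoc [] b c = refl
  ʳ++-assoc (x ∷ a) b c = ʳ++-assoc a (x ∷ b) c

  ++-compare : (xs ys us vs : List A) → xs ++ ys ≡ us ++ vs →
    (∃ λ c → xs ≡ us ++ c × vs ≡ c ++ ys) ⊎ (∃ λ c → us ≡ xs ++ c × ys ≡ c ++ vs)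
  ++-compare xs ys [] vs eq = inj₁ (xs , refl , sym eq)
  ++-compare [] ys (u ∷ us) vs eq = inj₂ (u ∷ us , refl , eq)
  ++-compare (x ∷ xs) ys (u ∷ us) vs eq with ∷-injective eq
  ... | refl , eq′ with ++-compare xs ys us vs eq′
  ... | inj₁ (c , refl , q) = inj₁ (c , refl , q)
  ... | inj₂ (c , refl , q) = inj₂ (c , refl , q)

  reverse-ʳ++-cancel : (a p c : List A) → reverse a ≡ reverse p ++ c → a ≡ reverse c ++ p
  reverse-ʳ++-cancel a p c eq = begin
    a                              ≡⟨ reverse-involutive a ⟨
    reverse (reverse a)            ≡⟨ cong reverse eq ⟩
    reverse (reverse p ++ c)       ≡⟨ reverse-++ (reverse p) c ⟩
    reverse c ++ reverse (reverse p) ≡⟨ cong (reverse c ++_) (reverse-involutive p) ⟩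
    reverse c ++ p                 ∎
    where open ≡-Reasoning

  reverse-ʳ++-reverse : (c b : List A) → reverse c ʳ++ b ≡ c ++ b
  reverse-ʳ++-reverse c b = trans (ʳ++-defn (reverse c)) (cong (_++ b) (reverse-involutive c))

  -- Two cuts of one word; `c` is the stretch between them, read backwards from the later cut.
  ʳ++-compare : (a b p q : List A) → a ʳ++ b ≡ p ʳ++ q →
    (∃ λ c → a ≡ c ++ p × q ≡ c ʳ++ b) ⊎ (∃ λ c → p ≡ c ++ a × b ≡ c ʳ++ q)
  ʳ++-compare a b p q eq
    with ++-compare (reverse a) b (reverse p) q (trans (sym (ʳ++-defn a)) (trans eq (ʳ++-defn p)))
  ... | inj₁ (c , e₁ , e₂) =
        inj₁ (reverse c , reverse-ʳ++-cancel a p c e₁ , trans e₂ (sym (reverse-ʳ++-reverse c b)))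
  ... | inj₂ (c , e₁ , e₂) =
        inj₂ (reverse c , reverse-ʳ++-cancel p a c e₁ , trans e₂ (sym (reverse-ʳ++-reverse c q)))

  ∷ʳ-view : (q : List A) → q ≡ [] ⊎ ∃₂ λ q₁ y → q ≡ q₁ ++ y ∷ []
  ∷ʳ-view q with initLast q
  ... | [] = inj₁ refl
  ... | q₁ ∷ʳ′ y = inj₂ (q₁ , y , refl)

  ʳ++-split-last : ∀ (a b : List A) {b₀ b′} K g → b ≡ b₀ ∷ b′ → K ++ g ∷ [] ≡ a ʳ++ b →
    ∃ λ b₁ → b ≡ b₁ ++ g ∷ [] × K ≡ a ʳ++ b₁
  ʳ++-split-last a b K g ne eq with ∷ʳ-view b
  ʳ++-split-last a .[] K g () eq | inj₁ refl
  ... | inj₂ (b₁ , y , refl)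
        with ∷ʳ-injective K (a ʳ++ b₁) (trans eq (sym (ʳ++-assoc a b₁ (y ∷ []))))
  ... | refl , refl = b₁ , refl , refl

  ʳ++-split-first : ∀ (a b : List A) {a₀ a′} K g → a ≡ a₀ ∷ a′ → g ∷ K ≡ a ʳ++ b →
    ∃ λ a₁ → a ≡ a₁ ++ g ∷ [] × K ≡ a₁ ʳ++ b
  ʳ++-split-first a b K g ne eq with ∷ʳ-view a
  ʳ++-split-first .[] b K g () eq | inj₁ refl
  ... | inj₂ (a₁ , y , refl) with ∷-injective (trans eq (++-ʳ++ a₁))
  ... | refl , refl = a₁ , refl , refl

  prefix-of-init : ∀ (d : List A) {f b₀} b₁ {y} → d ++ f ∷ b₀ ≡ b₁ ++ y ∷ [] → ∃ λ t → b₁ ≡ d ++ t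
  prefix-of-init d {f} {b₀} b₁ {y} eq with ++-compare d (f ∷ b₀) b₁ (y ∷ []) eq
  ... | inj₂ (c , e , _) = c , e
  ... | inj₁ ([] , refl , _) = [] , sym (trans (++-identityʳ _) (++-identityʳ _))
  ... | inj₁ (_ ∷ [] , refl , ())
  ... | inj₁ (_ ∷ _ ∷ _ , refl , ())

  zipper-form : ∀ (c : List A) x p₀ Y → (c ++ x ∷ p₀) ʳ++ Y ≡ p₀ ʳ++ (x ∷ (c ʳ++ Y))
  zipper-form c x p₀ Y = ++-ʳ++ c

  -- No clause for an exhausted word: a word and its prefixes are incomparable, as in `ltIn` and
  -- `ltOut`. Every comparison is thus decided at one letter and survives appending anything to
  -- either side.
  data Lex (_<_ : A → A → Set) : List A → List A → Set where
    here  : ∀ {x y p q} → x < y → Lex _<_ (x ∷ p) (y ∷ q)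
    there : ∀ {x p q} → Lex _<_ p q → Lex _<_ (x ∷ p) (x ∷ q)

  module _ {_<_ : A → A → Set} where

    lex-flip : ∀ {p q} → Lex _<_ p q → Lex (flip _<_) q p
    lex-flip (here l) = here l
    lex-flip (there l) = there (lex-flip l)

    lex-unflip : ∀ {p q} → Lex (flip _<_) p q → Lex _<_ q p
    lex-unflip (here l) = here l
    lex-unflip (there l) = there (lex-unflip l)

    lex-nonemptyˡ : ∀ {p q} → Lex _<_ p q → ∃₂ λ e p′ → p ≡ e ∷ p′
    lex-nonemptyˡ (here _) = _ , _ , refl
    lex-nonemptyˡ (there _) = _ , _ , refl

    lex-nonemptyʳ : ∀ {p q} → Lex _<_ p q → ∃₂ λ e q′ → q ≡ e ∷ q′
    lex-nonemptyʳ (here _) = _ , _ , refl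
    lex-nonemptyʳ (there _) = _ , _ , refl

    lex-++ : ∀ {p q} u v → Lex _<_ p q → Lex _<_ (p ++ u) (q ++ v)
    lex-++ u v (here l) = here l
    lex-++ u v (there l) = there (lex-++ u v l)

    lex-prepend : ∀ c {p q} → Lex _<_ p q → Lex _<_ (c ++ p) (c ++ q)
    lex-prepend [] l = l
    lex-prepend (x ∷ c) l = there (lex-prepend c l)

    lex-ʳprepend : ∀ c {p q} → Lex _<_ p q → Lex _<_ (c ʳ++ p) (c ʳ++ q)
    lex-ʳprepend [] l = l
    lex-ʳprepend (x ∷ c) l = lex-ʳprepend c (there l)

    -- Either the deciding letter lies within `c`, and the continuation of `c` may be exchanged
    -- freely, or `s` follows `c` to its end and the decision comes later.
    lex-splitˡ : ∀ c {p s} → Lex _<_ (c ++ p) s →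
      (∀ p₂ → Lex _<_ (c ++ p₂) s) ⊎ ∃ λ s₀ → s ≡ c ++ s₀ × Lex _<_ p s₀
    lex-splitˡ [] l = inj₂ (_ , refl , l)
    lex-splitˡ (x ∷ c) (here l) = inj₁ λ _ → here l
    lex-splitˡ (x ∷ c) (there l) with lex-splitˡ c l
    ... | inj₁ f = inj₁ λ p₂ → there (f p₂)
    ... | inj₂ (s₀ , refl , m) = inj₂ (s₀ , refl , m)

    lex-splitʳ : ∀ c {p s} → Lex _<_ s (c ++ p) →
      (∀ p₂ → Lex _<_ s (c ++ p₂)) ⊎ ∃ λ s₀ → s ≡ c ++ s₀ × Lex _<_ s₀ p
    lex-splitʳ [] l = inj₂ (_ , refl , l)
    lex-splitʳ (x ∷ c) (here l) = inj₁ λ _ → here l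
    lex-splitʳ (x ∷ c) (there l) with lex-splitʳ c l
    ... | inj₁ f = inj₁ λ p₂ → there (f p₂)
    ... | inj₂ (s₀ , refl , m) = inj₂ (s₀ , refl , m)

    lex-ʳsplitˡ : ∀ c {p s} → Lex _<_ (c ʳ++ p) s →
      (∀ p₂ → Lex _<_ (c ʳ++ p₂) s) ⊎ ∃ λ s₀ → s ≡ c ʳ++ s₀ × Lex _<_ p s₀
    lex-ʳsplitˡ c {p} {s} l with lex-splitˡ (reverse c) (subst (λ z → Lex _<_ z s) (ʳ++-defn c) l)
    ... | inj₁ f = inj₁ λ p₂ → subst (λ z → Lex _<_ z s) (sym (ʳ++-defn c)) (f p₂)
    ... | inj₂ (s₀ , e , m) = inj₂ (s₀ , trans e (sym (ʳ++-defn c)) , m)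

    lex-ʳsplitʳ : ∀ c {p s} → Lex _<_ s (c ʳ++ p) →
      (∀ p₂ → Lex _<_ s (c ʳ++ p₂)) ⊎ ∃ λ s₀ → s ≡ c ʳ++ s₀ × Lex _<_ s₀ p
    lex-ʳsplitʳ c {p} {s} l with lex-splitʳ (reverse c) (subst (Lex _<_ s) (ʳ++-defn c) l)
    ... | inj₁ f = inj₁ λ p₂ → subst (Lex _<_ s) (sym (ʳ++-defn c)) (f p₂)
    ... | inj₂ (s₀ , e , m) = inj₂ (s₀ , trans e (sym (ʳ++-defn c)) , m)

    lex-view : ∀ {p q} → Lex _<_ p q →
      ∃ λ c → ∃₂ λ x y → ∃₂ λ p₀ q₀ → p ≡ c ++ x ∷ p₀ × q ≡ c ++ y ∷ q₀ × x < y
    lex-view (here l) = [] , _ , _ , _ , _ , refl , refl , l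
    lex-view (there {x} l) with lex-view l
    ... | c , x′ , y , p₀ , q₀ , refl , refl , m = x ∷ c , x′ , y , p₀ , q₀ , refl , refl , m

    lex-at : ∀ c {x y p₀ q₀} → x < y → Lex _<_ (c ++ x ∷ p₀) (c ++ y ∷ q₀)
    lex-at c l = lex-prepend c (here l)

    module _ (<-irr : ∀ {x} → ¬ (x < x)) where
      lex-irrefl : ∀ {p} → ¬ Lex _<_ p p
      lex-irrefl (here l) = <-irr l
      lex-irrefl (there l) = lex-irrefl l

      lex-no-prefixˡ : ∀ p {r} → ¬ Lex _<_ p (p ++ r)
      lex-no-prefixˡ (x ∷ p) (here l) = <-irr l
      lex-no-prefixˡ (x ∷ p) (there l) = lex-no-prefixˡ p l

      lex-no-prefixʳ : ∀ p {r} → ¬ Lex _<_ (p ++ r) p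
      lex-no-prefixʳ (x ∷ p) (here l) = <-irr l
      lex-no-prefixʳ (x ∷ p) (there l) = lex-no-prefixʳ p l

    module _ (<-trans : ∀ {x y z} → x < y → y < z → x < z) where
      lex-trans : ∀ {p q r} → Lex _<_ p q → Lex _<_ q r → Lex _<_ p r
      lex-trans (here l) (here m) = here (<-trans l m)
      lex-trans (here l) (there m) = here l
      lex-trans (there l) (here m) = here m
      lex-trans (there l) (there m) = there (lex-trans l m)

      -- The decision falls within `c` or at the last letter; in the second case raising that letter
      -- only helps, and nothing behind it is reached.
      lex-raise : ∀ c {s x x′ r} → x ≡ x′ ⊎ x < x′ → Lex _<_ s (c ++ x ∷ []) → Lex _<_ s (c ++ x′ ∷ r)
      lex-raise [] (inj₁ refl) (here l) = here l
      lex-raise [] (inj₂ m) (here l) = here (<-trans l m)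
      lex-raise [] _ (there ())
      lex-raise (_ ∷ c) m (here l) = here l
      lex-raise (_ ∷ c) m (there l) = there (lex-raise c m l)

      lex-lower : ∀ c {s x x′ r} → x′ ≡ x ⊎ x′ < x → Lex _<_ (c ++ x ∷ []) s → Lex _<_ (c ++ x′ ∷ r) s
      lex-lower [] (inj₁ refl) (here l) = here l
      lex-lower [] (inj₂ m) (here l) = here (<-trans m l)
      lex-lower [] _ (there ())
      lex-lower (_ ∷ c) m (here l) = here l
      lex-lower (_ ∷ c) m (there l) = there (lex-lower c m l)

    lex-dec : (∀ x y → Dec (x ≡ y)) → (∀ x y → Dec (x < y)) → ∀ p q → Dec (Lex _<_ p q)
    lex-dec _≟_ _<?_ [] q = no λ ()
    lex-dec _≟_ _<?_ (x ∷ p) [] = no λ ()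
    lex-dec _≟_ _<?_ (x ∷ p) (y ∷ q) with x <? y
    ... | yes l = yes (here l)
    ... | no ¬l with x ≟ y
    ...   | no x≢y = no λ { (here l) → ¬l l ; (there _) → x≢y refl }
    ...   | yes refl with lex-dec _≟_ _<?_ p q
    ...     | yes l = yes (there l)
    ...     | no ¬m = no λ { (here l) → ¬l l ; (there m) → ¬m m }

    -- Two words s and p′ above a common word p are compared by which of them leaves p first.
    lex-fork : ∀ c₀ c {x x₃ e e₃ p₀ p₃ p′ s} → c₀ ++ x ∷ p₀ ≡ c ++ x₃ ∷ p₃ → x < e → x₃ < e₃ →
      (x ≡ x₃ → e < e₃ ⊎ e ≡ e₃ ⊎ e₃ < e) →
      Lex _<_ (c₀ ++ e ∷ p′) (c ++ e₃ ∷ s) ⊎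
      (∀ k → Lex _<_ (c ++ e₃ ∷ k) (c₀ ++ e ∷ p′)) ⊎
      (c₀ ≡ c × x ≡ x₃ × e ≡ e₃)
    lex-fork [] [] eq l l₃ tri with ∷-injective eq
    ... | refl , _ with tri refl
    ...   | inj₁ m = inj₁ (here m)
    ...   | inj₂ (inj₁ refl) = inj₂ (inj₂ (refl , refl , refl))
    ...   | inj₂ (inj₂ m) = inj₂ (inj₁ λ k → here m)
    lex-fork [] (h ∷ c) eq l l₃ tri with ∷-injective eq
    ... | refl , _ = inj₂ (inj₁ λ k → here l)
    lex-fork (h ∷ c₀) [] eq l l₃ tri with ∷-injective eq
    ... | refl , _ = inj₁ (here l₃)
    lex-fork (h ∷ c₀) (h′ ∷ c) eq l l₃ tri with ∷-injective eq
    ... | refl , eq′ with lex-fork c₀ c eq′ l l₃ tri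
    ...   | inj₁ m = inj₁ (there m)
    ...   | inj₂ (inj₁ f) = inj₂ (inj₁ λ k → there (f k))
    ...   | inj₂ (inj₂ (refl , e₁ , e₂)) = inj₂ (inj₂ (refl , e₁ , e₂))

    -- Two words drop below a common one. If the first drops no later than the second, it is below
    -- whatever agrees with the common word through `y₃`; otherwise the second word is the lower
    -- one.
    lex-fork-below : ∀ d₀ d {y y₃ f f₃ q₀ q₃ q′ r} → d₀ ++ y ∷ q₀ ≡ d ++ y₃ ∷ q₃ → f < y → f₃ < y₃ →
      (∀ l → Lex _<_ (d₀ ++ f ∷ q′) (d ++ y₃ ∷ l)) ⊎ Lex _<_ (d ++ f₃ ∷ r) (d₀ ++ f ∷ q′)
    lex-fork-below [] [] eq m m₃ with ∷-injective eq
    ... | refl , _ = inj₁ λ l → here m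
    lex-fork-below [] (h ∷ d) eq m m₃ with ∷-injective eq
    ... | refl , _ = inj₁ λ l → here m
    lex-fork-below (h ∷ d₀) [] eq m m₃ with ∷-injective eq
    ... | refl , _ = inj₂ (here m₃)
    lex-fork-below (h ∷ d₀) (h′ ∷ d) eq m m₃ with ∷-injective eq
    ... | refl , eq′ with lex-fork-below d₀ d eq′ m m₃
    ...   | inj₁ f = inj₁ λ l → there (f l)
    ...   | inj₂ k = inj₂ (there k)

module FramingLattice (G : FlowGraph) (F : Framing G) where
  open FlowGraph G
  open Framing F
  open Framed G F hiding (_<_)

  -- Paths, marked routes and the enumeration of routes.

  Path : Set
  Path = List E

  -- A path from a to v, listed backwards from v.
  BackPath : V → V → Path → Set
  BackPath a v []      = v ≡ a
  BackPath a v (e ∷ p) = tgt e ≡ v × BackPath a (src e) p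

  back-height : ∀ {a v} p → BackPath a v p → toℕ a + length p ℕ.≤ toℕ v
  back-height [] refl = ℕₚ.≤-reflexive (ℕₚ.+-identityʳ _)
  back-height {a} (e ∷ p) (refl , bp) = begin
    toℕ a + suc (length p)   ≡⟨ ℕₚ.+-suc (toℕ a) (length p) ⟩
    suc (toℕ a + length p)   ≤⟨ s≤s (back-height p bp) ⟩
    suc (toℕ (src e))        ≤⟨ src<tgt e ⟩
    toℕ (tgt e)              ∎
    where open ℕₚ.≤-Reasoning

  chain-height : ∀ {v} q → Chain v q → toℕ v + length q ℕ.≤ toℕ (endV v q)
  chain-height [] _ = ℕₚ.≤-reflexive (ℕₚ.+-identityʳ _)
  chain-height {v} (e ∷ q) (refl , ch) = begin
    toℕ v + suc (length q)     ≡⟨ ℕₚ.+-suc (toℕ v) (length q) ⟩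
    suc (toℕ v) + length q     ≤⟨ ℕₚ.+-monoˡ-≤ (length q) (src<tgt e) ⟩
    toℕ (tgt e) + length q     ≤⟨ chain-height q ch ⟩
    toℕ (endV (tgt e) q)       ∎
    where open ℕₚ.≤-Reasoning

  back-≤ : ∀ {a v} p → BackPath a v p → toℕ a ℕ.≤ toℕ v
  back-≤ p bp = ℕₚ.≤-trans (ℕₚ.m≤m+n _ (length p)) (back-height p bp)

  back-loop : ∀ {a v} p → BackPath a v p → toℕ v ℕ.≤ toℕ a → p ≡ []
  back-loop [] bp le = refl
  back-loop {a} {v} (e ∷ p) bp le = ⊥-elim (ℕₚ.<-irrefl refl (begin-strict
    toℕ a                        <⟨ ℕₚ.m<m+n (toℕ a) (s≤s z≤n) ⟩
    toℕ a + suc (length p)       ≤⟨ back-height (e ∷ p) bp ⟩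
    toℕ v                        ≤⟨ le ⟩
    toℕ a                        ∎))
    where open ℕₚ.≤-Reasoning

  back-end : ∀ {a v w} p → BackPath a v p → BackPath a w p → v ≡ w
  back-end [] refl refl = refl
  back-end (e ∷ p) (refl , _) (refl , _) = refl

  back-split : ∀ {a v} c {p} → BackPath a v (c ++ p) → ∃ λ u → BackPath u v c × BackPath a u p
  back-split {v = v} [] bp = v , refl , bp
  back-split (e ∷ c) (eq , bp) with back-split c bp
  ... | u , bc , bp′ = u , (eq , bc) , bp′

  back-glue : ∀ {a u v} c {p} → BackPath u v c → BackPath a u p → BackPath a v (c ++ p)
  back-glue [] refl bp = bp
  back-glue (e ∷ c) (eq , bc) bp = eq , back-glue c bc bp

  chain-split : ∀ {a} p {q} → Chain a (p ʳ++ q) →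
    ∃ λ v → BackPath a v p × Chain v q × endV v q ≡ endV a (p ʳ++ q)
  chain-split {a} [] ch = a , refl , ch , refl
  chain-split (e ∷ p) ch with chain-split p ch
  ... | v , bp , (refl , ch′) , en = tgt e , (refl , bp) , ch′ , en

  chain-join : ∀ {a v} p {q} → BackPath a v p → Chain v q →
    Chain a (p ʳ++ q) × endV a (p ʳ++ q) ≡ endV v q
  chain-join [] refl ch = ch , refl
  chain-join (e ∷ p) (refl , bp) ch = chain-join p bp (refl , ch)

  back-between : ∀ {a u v} c p → BackPath a v (c ++ p) → BackPath a u p → BackPath u v c
  back-between c p bcp bp with back-split c bcp
  ... | u′ , bc , bp′ with back-end p bp bp′
  ... | refl = bc

  -- The stretch between two cuts at `v` would be a closed path, and edges strictly increase
  -- vertices.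
  split-unique : ∀ {a v} p q p′ q′ → BackPath a v p → BackPath a v p′ → p ʳ++ q ≡ p′ ʳ++ q′ →
    p ≡ p′ × q ≡ q′
  split-unique p q p′ q′ bp bp′ eq with ʳ++-compare p q p′ q′ eq
  ... | inj₁ (c , refl , refl) with back-loop c (back-between c p′ bp bp′) ℕₚ.≤-refl
  ...   | refl = refl , refl
  split-unique p q p′ q′ bp bp′ eq | inj₂ (c , refl , refl)
        with back-loop c (back-between c p bp′ bp) ℕₚ.≤-refl
  ...   | refl = refl , refl

  -- Cuts along one path come in the order of their vertices, because a nonempty stretch strictly
  -- increases the vertex.
  split-locate : ∀ {s v w} p q a b → BackPath s v p → BackPath s w a → p ʳ++ q ≡ a ʳ++ b →
    (toℕ w ℕ.≤ toℕ v × ∃ λ c → p ≡ c ++ a × b ≡ c ʳ++ q × BackPath w v c) ⊎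
    (toℕ v ℕ.< toℕ w × ∃ λ c → a ≡ c ++ p × q ≡ c ʳ++ b × BackPath v w c)
  split-locate p q a b bp ba eq with ʳ++-compare p q a b eq
  ... | inj₁ (c , refl , refl) = inj₁ (back-≤ c bc , c , refl , refl , bc)
    where bc = back-between c a bp ba
  ... | inj₂ ([] , refl , refl) with back-end p bp ba
  ...   | refl = inj₁ (ℕₚ.≤-refl , [] , refl , refl , refl)
  split-locate p q a b bp ba eq | inj₂ (c@(_ ∷ c′) , refl , refl) =
    inj₂ (ℕₚ.<-≤-trans (ℕₚ.m<m+n _ (s≤s z≤n)) (back-height c bc) , c , refl , refl , bc)
    where bc = back-between c p ba bp

  _≟ₚ_ : (K L : Path) → Dec (K ≡ L)
  _≟ₚ_ = ≡-dec _≟_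

  infix 4 _≟ₚ_

  Infix : Path → Path → Set
  Infix K R = ∃₂ λ pre post → R ≡ pre ʳ++ (K ++ post)

  infix-split : ∀ {p q R} → Infix (p ʳ++ q) R → ∃₂ λ pre post → R ≡ (p ++ pre) ʳ++ (q ++ post)
  infix-split {p} {q} (pre , post , eq) =
    pre , post , trans eq (trans (cong (pre ʳ++_) (ʳ++-assoc p q post)) (sym (++-ʳ++ p)))

  infix-refl : ∀ {K} → Infix K K
  infix-refl = [] , [] , sym (++-identityʳ _)

  -- `c` and `d` are read outwards from the mark, so the infix is the stretch from the edge `x`
  -- through the mark to the edge `y`.
  infix-zipper : ∀ c x p₀ d y q₀ → Infix ((c ++ x ∷ []) ʳ++ (d ++ y ∷ [])) ((c ++ x ∷ p₀) ʳ++ (d ++ y ∷ q₀))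
  infix-zipper c x p₀ d y q₀ = p₀ , q₀ , (begin
    (c ++ x ∷ p₀) ʳ++ (d ++ y ∷ q₀)                     ≡⟨ zipper-form c x p₀ _ ⟩
    p₀ ʳ++ (x ∷ (c ʳ++ (d ++ y ∷ q₀)))                  ≡⟨ cong (λ z → p₀ ʳ++ (x ∷ (c ʳ++ z))) (++-assoc d (y ∷ []) q₀) ⟨
    p₀ ʳ++ (x ∷ (c ʳ++ ((d ++ y ∷ []) ++ q₀)))          ≡⟨ cong (λ z → p₀ ʳ++ (x ∷ z)) (ʳ++-assoc c (d ++ y ∷ []) q₀) ⟨
    p₀ ʳ++ ((x ∷ (c ʳ++ (d ++ y ∷ []))) ++ q₀)          ≡⟨ cong (λ z → p₀ ʳ++ (z ++ q₀)) (zipper-form c x [] _) ⟨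
    p₀ ʳ++ (((c ++ x ∷ []) ʳ++ (d ++ y ∷ [])) ++ q₀)    ∎)
    where open ≡-Reasoning

  chain-infix : ∀ {a K R} → Infix K R → Chain a R → ∃ λ v → Chain v K
  chain-infix {K = K} (pre , post , refl) ch with chain-split pre ch
  ... | v , _ , ch′ , _ = v , prefix v K ch′
    where
    prefix : ∀ v K → Chain v (K ++ post) → Chain v K
    prefix v [] _ = tt
    prefix v (e ∷ K) (eq , ch) = eq , prefix (tgt e) K ch

  record Zipper (R : Path) (v : V) (p q : Path) : Set where
    constructor zipper
    field
      eq : R ≡ p ʳ++ q
      bp : BackPath s v p
      ch : Chain v q
      en : endV v q ≡ t

  route-zipper : ∀ {R} p {q} → IsRoute R → R ≡ p ʳ++ q → ∃ λ v → Zipper R v p q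
  route-zipper p (ch , en) refl with chain-split p ch
  ... | v , bp , ch′ , en′ = v , zipper refl bp ch′ (trans en′ en)

  zipper-route : ∀ {R v p q} → Zipper R v p q → IsRoute R
  zipper-route {p = p} (zipper refl bp ch en) with chain-join p bp ch
  ... | ch′ , en′ = ch′ , trans en′ en

  zipper-mix : ∀ {R R′ v p q p′ q′} → Zipper R v p q → Zipper R′ v p′ q′ → Zipper (p ʳ++ q′) v p q′
  zipper-mix z z′ = zipper refl (Zipper.bp z) (Zipper.ch z′) (Zipper.en z′)

  paths : ℕ → V → List Path
  paths zero    v = [] ∷ []
  paths (suc k) v = [] ∷ concatMap (λ e → map (e ∷_) (paths k (tgt e))) (filter (λ e → src e ≟ v) (allFin m))

  paths-complete : ∀ k {v} K → Chain v K → length K ℕ.≤ k → K ∈ paths k v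
  paths-complete zero [] _ _ = here refl
  paths-complete (suc k) [] _ _ = here refl
  paths-complete (suc k) {v} (e ∷ K) (refl , ch) (s≤s le) = there
    (∈-concatMap⁺ (λ e → map (e ∷_) (paths k (tgt e)))
      (Any.map (λ { refl → ∈-map⁺ (e ∷_) (paths-complete k K ch le) })
        (∈-filter⁺ (λ e → src e ≟ v) (∈-allFin e) refl)))

  chain? : ∀ v K → Dec (Chain v K)
  chain? v [] = yes tt
  chain? v (e ∷ K) = (src e ≟ v) ×-dec chain? (tgt e) K

  route? : ∀ R → Dec (IsRoute R)
  route? R = chain? s R ×-dec (endV s R ≟ t)

  routes : List Path
  routes = filter route? (paths n s)

  -- A route climbs strictly through `Fin n`, so fuel `n` suffices for its length.
  routes-complete : ∀ {R} → IsRoute R → R ∈ routes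
  routes-complete {R} r@(ch , en) = ∈-filter⁺ route? (paths-complete n R ch (begin
    length R                ≤⟨ ℕₚ.m≤n+m (length R) (toℕ s) ⟩
    toℕ s + length R        ≤⟨ chain-height R ch ⟩
    toℕ (endV s R)          ≤⟨ ℕₚ.<⇒≤ (Finₚ.toℕ<n (endV s R)) ⟩
    n                       ∎)) r
    where open ℕₚ.≤-Reasoning

  routes-sound : ∀ {R} → R ∈ routes → IsRoute R
  routes-sound R∈ = proj₂ (∈-filter⁻ route? {xs = paths n s} R∈)

  open DecMembership _≟ₚ_ using (_∈?_)

  -- The framing up to simultaneous reversal of all its orders (`dual`).  The potentials are what
  -- makes recursions along the orders terminate, in either direction.
  record Orders : Set₁ where
    field
      _<I_ _<O_ : E → E → Set
      tgt-I     : ∀ {x y} → x <I y → tgt x ≡ tgt y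
      src-O     : ∀ {x y} → x <O y → src x ≡ src y
      I-trans   : ∀ {x y z} → x <I y → y <I z → x <I z
      O-trans   : ∀ {x y z} → x <O y → y <O z → x <O z
      I-irr     : ∀ {x} → ¬ (x <I x)
      O-irr     : ∀ {x} → ¬ (x <O x)
      I-tri     : ∀ {x y} → tgt x ≡ tgt y → x <I y ⊎ x ≡ y ⊎ y <I x
      O-tri     : ∀ {x y} → src x ≡ src y → x <O y ⊎ x ≡ y ⊎ y <O x
      ρ ρ′      : E → ℕ
      ρ-mono    : ∀ {x y} → x <I y → ρ x ℕ.< ρ y
      ρ′-anti   : ∀ {x y} → x <I y → ρ′ y ℕ.< ρ′ x

  swap₃ : {A B C : Set} → A ⊎ B ⊎ C → C ⊎ B ⊎ A
  swap₃ (inj₁ a) = inj₂ (inj₂ a)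
  swap₃ (inj₂ (inj₁ b)) = inj₂ (inj₁ b)
  swap₃ (inj₂ (inj₂ c)) = inj₁ c

  dual : Orders → Orders
  dual o = record
    { _<I_ = flip _<I_ ; _<O_ = flip _<O_
    ; tgt-I = λ l → sym (tgt-I l) ; src-O = λ l → sym (src-O l)
    ; I-trans = λ l m → I-trans m l ; O-trans = λ l m → O-trans m l
    ; I-irr = I-irr ; O-irr = O-irr
    ; I-tri = λ eq → swap₃ (I-tri eq) ; O-tri = λ eq → swap₃ (O-tri eq)
    ; ρ = ρ′ ; ρ′ = ρ ; ρ-mono = ρ′-anti ; ρ′-anti = ρ-mono }
    where open Orders o

  element-≤-sum : ∀ {x} {xs : List ℕ} → x ∈ xs → x ℕ.≤ sum xs
  element-≤-sum (here refl) = ℕₚ.m≤m+n _ _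
  element-≤-sum {xs = y ∷ ys} (there x∈) = ℕₚ.≤-trans (element-≤-sum x∈) (ℕₚ.m≤n+m _ y)

  framing-orders : Orders
  framing-orders = record
    { _<I_ = λ x y → tgt x ≡ tgt y × inRank x ℕ.< inRank y
    ; _<O_ = λ x y → src x ≡ src y × outRank x ℕ.< outRank y
    ; tgt-I = λ { (e , _) → e } ; src-O = λ { (e , _) → e }
    ; I-trans = λ { (e , l) (f , m) → trans e f , ℕₚ.<-trans l m }
    ; O-trans = λ { (e , l) (f , m) → trans e f , ℕₚ.<-trans l m }
    ; I-irr = λ { (_ , l) → ℕₚ.<-irrefl refl l }
    ; O-irr = λ { (_ , l) → ℕₚ.<-irrefl refl l }
    ; I-tri = I-tri ; O-tri = O-tri
    -- The sum of all ranks bounds each of them, so the truncated subtraction is strictly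
    -- decreasing.
    ; ρ = inRank ; ρ′ = λ e → sum (map inRank (allFin m)) ∸ inRank e
    ; ρ-mono = λ { (_ , l) → l }
    ; ρ′-anti = λ {x} {y} → λ { (_ , l) →
        ℕₚ.∸-monoʳ-< l (element-≤-sum (∈-map⁺ inRank (∈-allFin y))) } }
    where
    I-tri : ∀ {x y} → tgt x ≡ tgt y →
      (tgt x ≡ tgt y × inRank x ℕ.< inRank y) ⊎ x ≡ y ⊎ (tgt y ≡ tgt x × inRank y ℕ.< inRank x)
    I-tri {x} {y} eq with ℕₚ.<-cmp (inRank x) (inRank y)
    ... | tri< l _ _ = inj₁ (eq , l)
    ... | tri≈ _ r _ = inj₂ (inj₁ (inRank-inj x y eq r))
    ... | tri> _ _ g = inj₂ (inj₂ (sym eq , g))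
    O-tri : ∀ {x y} → src x ≡ src y →
      (src x ≡ src y × outRank x ℕ.< outRank y) ⊎ x ≡ y ⊎ (src y ≡ src x × outRank y ℕ.< outRank x)
    O-tri {x} {y} eq with ℕₚ.<-cmp (outRank x) (outRank y)
    ... | tri< l _ _ = inj₁ (eq , l)
    ... | tri≈ _ r _ = inj₂ (inj₁ (outRank-inj x y eq r))
    ... | tri> _ _ g = inj₂ (inj₂ (sym eq , g))

  -- Incoherence, for the framing or its dual

  module Oriented (o : Orders) where
    open Orders o

    _≺I_ _≺O_ : Path → Path → Set
    _≺I_ = Lex _<I_
    _≺O_ = Lex _<O_

    ≺I-trans : ∀ {p q r} → p ≺I q → q ≺I r → p ≺I r
    ≺I-trans = lex-trans I-trans
    ≺O-trans : ∀ {p q r} → p ≺O q → q ≺O r → p ≺O r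
    ≺O-trans = lex-trans O-trans
    ≺I-irr : ∀ {p} → ¬ (p ≺I p)
    ≺I-irr = lex-irrefl I-irr
    ≺O-irr : ∀ {p} → ¬ (p ≺O p)
    ≺O-irr = lex-irrefl O-irr
    ≺I-asym : ∀ {p q} → p ≺I q → ¬ (q ≺I p)
    ≺I-asym l m = ≺I-irr (≺I-trans l m)
    ≺O-asym : ∀ {p q} → p ≺O q → ¬ (q ≺O p)
    ≺O-asym l m = ≺O-irr (≺O-trans l m)

    _<I?_ : ∀ x y → Dec (x <I y)
    x <I? y with tgt x ≟ tgt y
    ... | no ne = no (ne ∘ tgt-I)
    ... | yes eq with I-tri eq
    ...   | inj₁ l = yes l
    ...   | inj₂ (inj₁ refl) = no I-irr
    ...   | inj₂ (inj₂ g) = no λ l → I-irr (I-trans l g)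

    _<O?_ : ∀ x y → Dec (x <O y)
    x <O? y with src x ≟ src y
    ... | no ne = no (ne ∘ src-O)
    ... | yes eq with O-tri eq
    ...   | inj₁ l = yes l
    ...   | inj₂ (inj₁ refl) = no O-irr
    ...   | inj₂ (inj₂ g) = no λ l → O-irr (O-trans l g)

    -- `Lex` leaves prefixes incomparable, but here one word cannot properly extend the other: the
    -- excess would be a closed path at `a`.
    ≺I-tri : ∀ {a v} p p′ → BackPath a v p → BackPath a v p′ → p ≺I p′ ⊎ p ≡ p′ ⊎ p′ ≺I p
    ≺I-tri [] [] bp bp′ = inj₂ (inj₁ refl)
    ≺I-tri [] (e ∷ p′) refl bp′ = case back-loop (e ∷ p′) bp′ ℕₚ.≤-refl of λ ()
    ≺I-tri (e ∷ p) [] bp refl = case back-loop (e ∷ p) bp ℕₚ.≤-refl of λ ()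
    ≺I-tri (e ∷ p) (e′ ∷ p′) (eq , bp) (eq′ , bp′) with I-tri (trans eq (sym eq′))
    ... | inj₁ l = inj₁ (here l)
    ... | inj₂ (inj₂ g) = inj₂ (inj₂ (here g))
    ... | inj₂ (inj₁ refl) with ≺I-tri p p′ bp bp′
    ...   | inj₁ l = inj₁ (there l)
    ...   | inj₂ (inj₁ refl) = inj₂ (inj₁ refl)
    ...   | inj₂ (inj₂ g) = inj₂ (inj₂ (there g))

    chain-loop : ∀ {v} e q → Chain v (e ∷ q) → endV v (e ∷ q) ≢ v
    chain-loop {v} e q ch eq = ℕₚ.<-irrefl (cong toℕ (sym eq))
      (ℕₚ.<-≤-trans (ℕₚ.m<m+n (toℕ v) (s≤s z≤n)) (chain-height (e ∷ q) ch))

    ≺O-tri : ∀ {v b} q q′ → Chain v q → endV v q ≡ b → Chain v q′ → endV v q′ ≡ b →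
      q ≺O q′ ⊎ q ≡ q′ ⊎ q′ ≺O q
    ≺O-tri [] [] _ _ _ _ = inj₂ (inj₁ refl)
    ≺O-tri [] (e ∷ q′) ch en ch′ en′ = ⊥-elim (chain-loop e q′ ch′ (trans en′ (sym en)))
    ≺O-tri (e ∷ q) [] ch en ch′ en′ = ⊥-elim (chain-loop e q ch (trans en (sym en′)))
    ≺O-tri (e ∷ q) (e′ ∷ q′) (eq , ch) en (eq′ , ch′) en′ with O-tri (trans eq (sym eq′))
    ... | inj₁ l = inj₁ (here l)
    ... | inj₂ (inj₂ g) = inj₂ (inj₂ (here g))
    ... | inj₂ (inj₁ refl) with ≺O-tri q q′ ch en ch′ en′
    ...   | inj₁ l = inj₁ (there l)
    ...   | inj₂ (inj₁ refl) = inj₂ (inj₁ refl)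
    ...   | inj₂ (inj₂ g) = inj₂ (inj₂ (there g))

    -- The leading edges are equal or compared at a common target. This recovers the common vertex,
    -- which `◁` does not record.
    ≺I-same-end : ∀ {a a′ v w p q} → p ≺I q → BackPath a v p → BackPath a′ w q → v ≡ w
    ≺I-same-end (here l) (e , _) (e′ , _) = trans (sym e) (trans (tgt-I l) e′)
    ≺I-same-end (there l) (e , _) (e′ , _) = trans (sym e) e′

    -- K ◁ K′ is the clockwise relation P <ᶜʷ Q at some common inner vertex; a path with a marked
    -- vertex is a pair (p , q) of the part before it, listed backwards, and the part after it.
    record _◁_ (K K′ : Path) : Set where
      constructor place
      field
        p q p′ q′ : Path
        eq  : K ≡ p ʳ++ q
        eq′ : K′ ≡ p′ ʳ++ q′
        inL : p ≺I p′
        outL : q′ ≺O q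

    infix 4 _◁_

    -- Each path has finitely many cuts: `search` moves the cut of `K`, and `inner` that of `K′`.
    _◁?_ : ∀ K K′ → Dec (K ◁ K′)
    K ◁? K′ with search [] K
      where
      inner : ∀ (p q a b : Path) → Dec (∃₂ λ c q′ → b ≡ c ++ q′ × (p ≺I (c ʳ++ a) × q′ ≺O q))
      inner p q a b with lex-dec _≟_ _<I?_ p a | lex-dec _≟_ _<O?_ b q
      inner p q a b | yes l | yes m = yes ([] , b , refl , l , m)
      inner p q a [] | no ¬l | _ = no λ { ([] , _ , refl , l , m) → ¬l l }
      inner p q a [] | yes _ | no ¬m = no λ { ([] , _ , refl , l , m) → ¬m m }
      inner p q a (x ∷ b) | no ¬l | _ with inner p q (x ∷ a) b
      ... | yes (c , q′ , refl , r) = yes (x ∷ c , q′ , refl , r)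
      ... | no ¬r = no λ { ([] , _ , refl , l , m) → ¬l l ; (_ ∷ c , q′ , refl , r) → ¬r (c , q′ , refl , r) }
      inner p q a (x ∷ b) | yes _ | no ¬m with inner p q (x ∷ a) b
      ... | yes (c , q′ , refl , r) = yes (x ∷ c , q′ , refl , r)
      ... | no ¬r = no λ { ([] , _ , refl , l , m) → ¬m m ; (_ ∷ c , q′ , refl , r) → ¬r (c , q′ , refl , r) }
      P : Path → Path → Set
      P p q = ∃₂ λ c q′ → K′ ≡ c ++ q′ × (p ≺I (c ʳ++ []) × q′ ≺O q)
      search : ∀ a b → Dec (∃₂ λ c q → b ≡ c ++ q × P (c ʳ++ a) q)
      search a b with inner a b [] K′
      search a b | yes r = yes ([] , b , refl , r)
      search a [] | no ¬r = no λ { ([] , _ , refl , r) → ¬r r }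
      search a (x ∷ b) | no ¬r with search (x ∷ a) b
      ... | yes (c , q , refl , r) = yes (x ∷ c , q , refl , r)
      ... | no ¬r′ = no λ { ([] , _ , refl , r) → ¬r r ; (_ ∷ c , q , refl , r) → ¬r′ (c , q , refl , r) }
    ... | yes (c , q , refl , c′ , q′ , refl , l , m) =
          yes (place (reverse c) q (reverse c′) q′
            (sym (reverse-ʳ++-reverse c q)) (sym (reverse-ʳ++-reverse c′ q′)) l m)
    ... | no ¬r = no λ { (place p q p′ q′ refl refl l m) → ¬r
          ( reverse p , q , ʳ++-defn p , reverse p′ , q′ , ʳ++-defn p′
          , subst₂ _≺I_ (rr p) (rr p′) l , m) }
      where
      rr : ∀ p → p ≡ reverse p ʳ++ []
      rr p = sym (reverse-involutive p)

    ◁-infix : ∀ {K K′ L L′} → Infix K L → Infix K′ L′ → K ◁ K′ → L ◁ L′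
    ◁-infix i i′ (place p q p′ q′ refl refl l m)
      with infix-split {p} {q} i | infix-split {p′} {q′} i′
    ... | pre , post , e | pre′ , post′ , e′ =
          place _ _ _ _ e e′ (lex-++ pre pre′ l) (lex-++ post′ post m)

    ◁-infixˡ : ∀ {K K′ L} → Infix K L → K ◁ K′ → L ◁ K′
    ◁-infixˡ i = ◁-infix i infix-refl
    ◁-infixʳ : ∀ {K K′ L′} → Infix K′ L′ → K ◁ K′ → K ◁ L′
    ◁-infixʳ i = ◁-infix infix-refl i

    -- The place of incoherence lies on one side of the cut. If the comparison pointing back towards
    -- the cut is decided before reaching it, the far half can be exchanged; otherwise `Z` itself
    -- runs through the cut and is incoherent with the path there.
    localizeˡ : ∀ p q p′ q′ {Z} → (p ʳ++ q) ◁ Z → (p′ ʳ++ q) ◁ Z ⊎ (p ʳ++ q′) ◁ Z ⊎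
      (∃₂ λ z r → Z ≡ z ʳ++ r × p ≺I z × r ≺O q)
    localizeˡ p q p′ q′ (place a b a′ b′ eq refl l m) with ʳ++-compare a b p q (sym eq)
    ... | inj₁ (c , refl , refl) with lex-splitˡ c l
    ...   | inj₁ f = inj₁ (place (c ++ p′) b a′ b′ (sym (++-ʳ++ c)) refl (f p′) m)
    ...   | inj₂ (z , refl , l′) = inj₂ (inj₂ (z , c ʳ++ b′ , ++-ʳ++ c , l′ , lex-ʳprepend c m))
    localizeˡ p q p′ q′ (place a b a′ b′ eq refl l m) | inj₂ (c , refl , refl) with lex-ʳsplitʳ c m
    ...   | inj₁ f = inj₂ (inj₁ (place a (c ʳ++ q′) a′ b′ (++-ʳ++ c) refl l (f q′)))
    ...   | inj₂ (r , refl , m′) = inj₂ (inj₂ (c ++ a′ , r , sym (++-ʳ++ c) , lex-prepend c l , m′))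

    localizeʳ : ∀ p q p′ q′ {Z} → Z ◁ (p ʳ++ q) → Z ◁ (p′ ʳ++ q) ⊎ Z ◁ (p ʳ++ q′) ⊎
      (∃₂ λ z r → Z ≡ z ʳ++ r × z ≺I p × q ≺O r)
    localizeʳ p q p′ q′ (place a′ b′ a b refl eq l m) with ʳ++-compare a b p q (sym eq)
    ... | inj₁ (c , refl , refl) with lex-splitʳ c l
    ...   | inj₁ f = inj₁ (place a′ b′ (c ++ p′) b refl (sym (++-ʳ++ c)) (f p′) m)
    ...   | inj₂ (z , refl , l′) = inj₂ (inj₂ (z , c ʳ++ b′ , ++-ʳ++ c , l′ , lex-ʳprepend c m))
    localizeʳ p q p′ q′ (place a′ b′ a b refl eq l m) | inj₂ (c , refl , refl) with lex-ʳsplitˡ c m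
    ...   | inj₁ f = inj₂ (inj₁ (place a′ b′ a (c ʳ++ q′) refl (++-ʳ++ c) l (f q′)))
    ...   | inj₂ (r , refl , m′) = inj₂ (inj₂ (c ++ a′ , r , sym (++-ʳ++ c) , lex-prepend c l , m′))

    -- Exchanging the two halves of R = (p , q) and R′ = (p′ , q′) at a place where R ◁ R′ creates
    -- no new incoherence.
    module Exchange {p p′ q q′ : Path} (l : p ≺I p′) (m : q′ ≺O q) where
      ◁-left : ∀ {S} → S ◁ (p ʳ++ q′) → S ◁ (p ʳ++ q) ⊎ S ◁ (p′ ʳ++ q′)
      ◁-left sw with localizeʳ p q′ p′ q sw
      ... | inj₁ h = inj₂ h
      ... | inj₂ (inj₁ h) = inj₁ h
      ... | inj₂ (inj₂ (z , r , refl , l′ , m′)) = inj₂ (place z r p′ q′ refl refl (≺I-trans l′ l) m′)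

      left-◁ : ∀ {S} → (p ʳ++ q′) ◁ S → (p ʳ++ q) ◁ S ⊎ (p′ ʳ++ q′) ◁ S
      left-◁ sw with localizeˡ p q′ p′ q sw
      ... | inj₁ h = inj₂ h
      ... | inj₂ (inj₁ h) = inj₁ h
      ... | inj₂ (inj₂ (z , r , refl , l′ , m′)) = inj₁ (place p q z r refl refl l′ (≺O-trans m′ m))

      ◁-right : ∀ {S} → S ◁ (p′ ʳ++ q) → S ◁ (p ʳ++ q) ⊎ S ◁ (p′ ʳ++ q′)
      ◁-right sw with localizeʳ p′ q p q′ sw
      ... | inj₁ h = inj₁ h
      ... | inj₂ (inj₁ h) = inj₂ h
      ... | inj₂ (inj₂ (z , r , refl , l′ , m′)) = inj₂ (place z r p′ q′ refl refl l′ (≺O-trans m m′))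

      right-◁ : ∀ {S} → (p′ ʳ++ q) ◁ S → (p ʳ++ q) ◁ S ⊎ (p′ ʳ++ q′) ◁ S
      right-◁ sw with localizeˡ p′ q p q′ sw
      ... | inj₁ h = inj₁ h
      ... | inj₂ (inj₁ h) = inj₂ h
      ... | inj₂ (inj₂ (z , r , refl , l′ , m′)) = inj₁ (place p q z r refl refl (≺I-trans l l′) m′)

    -- The place lies between the end edges `x` and `y`. A comparison that reaches an end edge stays
    -- true when `x` is raised or `y` lowered, and nothing beyond these edges is consulted.
    mono-right : ∀ c x d y {x′ y′ p₀ q₀ S} → x ≡ x′ ⊎ x <I x′ → y′ ≡ y ⊎ y′ <O y →
      S ◁ ((c ++ x ∷ []) ʳ++ (d ++ y ∷ [])) → S ◁ ((c ++ x′ ∷ p₀) ʳ++ (d ++ y′ ∷ q₀))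
    mono-right c x d y {x′} {y′} {p₀} {q₀} lx ly (place z r a b refl eq l m)
      with lex-nonemptyʳ l | lex-nonemptyˡ m
    ... | _ , _ , na | _ , _ , nb
      with ʳ++-split-first a b (c ʳ++ (d ++ y ∷ [])) x na (trans (sym (zipper-form c x [] _)) eq)
    ... | a₁ , refl , eq₁ with ʳ++-split-last a₁ b (c ʳ++ d) y nb (trans (ʳ++-assoc c d _) eq₁)
    ... | b₁ , refl , eq₂ = place z r (a₁ ++ x′ ∷ p₀) (b₁ ++ y′ ∷ q₀) refl (begin
      (c ++ x′ ∷ p₀) ʳ++ (d ++ y′ ∷ q₀)         ≡⟨ zipper-form c x′ p₀ _ ⟩
      p₀ ʳ++ (x′ ∷ (c ʳ++ (d ++ y′ ∷ q₀)))      ≡⟨ cong (λ h → p₀ ʳ++ (x′ ∷ h)) (ʳ++-assoc c d _) ⟨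
      p₀ ʳ++ (x′ ∷ ((c ʳ++ d) ++ y′ ∷ q₀))      ≡⟨ cong (λ h → p₀ ʳ++ (x′ ∷ (h ++ y′ ∷ q₀))) eq₂ ⟩
      p₀ ʳ++ (x′ ∷ ((a₁ ʳ++ b₁) ++ y′ ∷ q₀))    ≡⟨ cong (λ h → p₀ ʳ++ (x′ ∷ h)) (ʳ++-assoc a₁ b₁ _) ⟩
      p₀ ʳ++ (x′ ∷ (a₁ ʳ++ (b₁ ++ y′ ∷ q₀)))    ≡⟨ zipper-form a₁ x′ p₀ _ ⟨
      (a₁ ++ x′ ∷ p₀) ʳ++ (b₁ ++ y′ ∷ q₀)       ∎)
      (lex-raise I-trans a₁ lx l) (lex-lower O-trans b₁ ly m)
      where open ≡-Reasoning

    mono-left : ∀ c x d y {x′ y′ p₀ q₀ S} → x′ ≡ x ⊎ x′ <I x → y ≡ y′ ⊎ y <O y′ →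
      ((c ++ x ∷ []) ʳ++ (d ++ y ∷ [])) ◁ S → ((c ++ x′ ∷ p₀) ʳ++ (d ++ y′ ∷ q₀)) ◁ S
    mono-left c x d y {x′} {y′} {p₀} {q₀} lx ly (place a b z r eq refl l m)
      with lex-nonemptyˡ l | lex-nonemptyʳ m
    ... | _ , _ , na | _ , _ , nb
      with ʳ++-split-first a b (c ʳ++ (d ++ y ∷ [])) x na (trans (sym (zipper-form c x [] _)) eq)
    ... | a₁ , refl , eq₁ with ʳ++-split-last a₁ b (c ʳ++ d) y nb (trans (ʳ++-assoc c d _) eq₁)
    ... | b₁ , refl , eq₂ = place (a₁ ++ x′ ∷ p₀) (b₁ ++ y′ ∷ q₀) z r (begin
      (c ++ x′ ∷ p₀) ʳ++ (d ++ y′ ∷ q₀)         ≡⟨ zipper-form c x′ p₀ _ ⟩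
      p₀ ʳ++ (x′ ∷ (c ʳ++ (d ++ y′ ∷ q₀)))      ≡⟨ cong (λ h → p₀ ʳ++ (x′ ∷ h)) (ʳ++-assoc c d _) ⟨
      p₀ ʳ++ (x′ ∷ ((c ʳ++ d) ++ y′ ∷ q₀))      ≡⟨ cong (λ h → p₀ ʳ++ (x′ ∷ (h ++ y′ ∷ q₀))) eq₂ ⟩
      p₀ ʳ++ (x′ ∷ ((a₁ ʳ++ b₁) ++ y′ ∷ q₀))    ≡⟨ cong (λ h → p₀ ʳ++ (x′ ∷ h)) (ʳ++-assoc a₁ b₁ _) ⟩
      p₀ ʳ++ (x′ ∷ (a₁ ʳ++ (b₁ ++ y′ ∷ q₀)))    ≡⟨ zipper-form a₁ x′ p₀ _ ⟨
      (a₁ ++ x′ ∷ p₀) ʳ++ (b₁ ++ y′ ∷ q₀)       ∎) refl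
      (lex-lower I-trans a₁ lx l) (lex-raise O-trans b₁ ly m)
      where open ≡-Reasoning

    -- Up to `v` the backward words coincide, so the place comes strictly after `v`, and the
    -- incoming comparison is already decided between `v` and the place.
    share-left : ∀ {v} p q q′ → BackPath s v p → Chain v q → Chain v q′ → (p ʳ++ q) ◁ (p ʳ++ q′) →
      ∃ λ w → ∃₂ λ c z → ∃₂ λ c′ z′ → q ≡ c ʳ++ z × q′ ≡ c′ ʳ++ z′ ×
        BackPath v w c × BackPath v w c′ × c ≺I c′ × z′ ≺O z × toℕ v ℕ.< toℕ w
    share-left {v} p q q′ bp ch ch′ (place a b a′ b′ eq eq′ l m)
      with chain-split a (subst (Chain s) eq (proj₁ (chain-join p bp ch)))
         | chain-split a′ (subst (Chain s) eq′ (proj₁ (chain-join p bp ch′)))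
    ... | w , ba , _ | w′ , ba′ , _ with ≺I-same-end l ba ba′
    ... | refl with split-locate p q a b bp ba eq | split-locate p q′ a′ b′ bp ba′ eq′
    ... | inj₁ (le , _) | inj₂ (lt , _) = ⊥-elim (ℕₚ.<⇒≱ lt le)
    ... | inj₂ (lt , _) | inj₁ (le , _) = ⊥-elim (ℕₚ.<⇒≱ lt le)
    ... | inj₁ (_ , c , e , _ , _) | inj₁ (_ , c′ , e′ , _ , _)
          with split-unique a (c ʳ++ []) a′ (c′ ʳ++ []) ba ba′
                 (trans (sym (++-ʳ++ c)) (trans (cong (_ʳ++ []) (trans (sym e) e′)) (++-ʳ++ c′)))
    ...   | refl , _ = ⊥-elim (≺I-irr l)
    share-left p q q′ bp ch ch′ (place a b a′ b′ eq eq′ l m) | w , ba , _ | w′ , ba′ , _ | refl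
          | inj₂ (lt , c , refl , e , bc) | inj₂ (_ , c′ , refl , e′ , bc′)
          with ≺I-tri c c′ bc bc′
    ...   | inj₁ l′ = w , c , b , c′ , b′ , e , e′ , bc , bc′ , l′ , m , lt
    ...   | inj₂ (inj₁ refl) = ⊥-elim (≺I-irr l)
    ...   | inj₂ (inj₂ g) = ⊥-elim (≺I-asym l (lex-++ p p g))

    -- Mirror image of `share-left`: the outgoing comparison is decided before `v`, so it holds with
    -- any tails. The last component identifies the place found with that of `h`, which is needed
    -- when the place serves as a measure.
    share-right : ∀ {v} p p′ q → BackPath s v p → BackPath s v p′ → Chain v q → (h : (p ʳ++ q) ◁ (p′ ʳ++ q)) →
      ∃ λ w → ∃₂ λ c a → ∃₂ λ c′ a′ → p ≡ c ++ a × p′ ≡ c′ ++ a′ ×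
        BackPath s w a × BackPath s w a′ × a ≺I a′ × (∀ q₁ q₂ → (c′ ʳ++ q₂) ≺O (c ʳ++ q₁)) × toℕ w ℕ.< toℕ v × a ≡ _◁_.p h
    share-right {v} p p′ q bp bp′ ch (place a b a′ b′ eq eq′ l m)
      with chain-split a (subst (Chain s) eq (proj₁ (chain-join p bp ch)))
         | chain-split a′ (subst (Chain s) eq′ (proj₁ (chain-join p′ bp′ ch)))
    ... | w , ba , _ | w′ , ba′ , _ with ≺I-same-end l ba ba′
    ... | refl with split-locate p q a b bp ba eq | split-locate p′ q a′ b′ bp′ ba′ eq′
    ... | inj₁ (le , _) | inj₂ (lt , _) = ⊥-elim (ℕₚ.<⇒≱ lt le)
    ... | inj₂ (lt , _) | inj₁ (le , _) = ⊥-elim (ℕₚ.<⇒≱ lt le)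
    ... | inj₂ (_ , c , _ , e , bc) | inj₂ (_ , c′ , _ , e′ , bc′)
          with split-unique c b c′ b′ bc bc′ (trans (sym e) e′)
    ...   | _ , refl = ⊥-elim (≺O-irr m)
    share-right {v} p p′ q bp bp′ ch (place a b a′ b′ eq eq′ l m) | w , ba , _ | w′ , ba′ , _ | refl
          | inj₁ (le , c , refl , refl , bc) | inj₁ (_ , c′ , refl , refl , bc′) =
          w , c , a , c′ , a′ , refl , refl , ba , ba′ , l , below , ℕₚ.≤∧≢⇒< le strict , refl
      where
      strict : toℕ w ≢ toℕ v
      strict weq with back-loop c bc (ℕₚ.≤-reflexive (sym weq)) | back-loop c′ bc′ (ℕₚ.≤-reflexive (sym weq))
      ... | refl | refl = ≺O-irr m
      same : ∀ {r r′} → c ʳ++ r ≡ c′ ʳ++ r′ → c ≡ c′ × r ≡ r′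
      same {r} {r′} = split-unique c r c′ r′ bc bc′
      below : ∀ q₁ q₂ → (c′ ʳ++ q₂) ≺O (c ʳ++ q₁)
      below q₁ q₂ with lex-ʳsplitˡ c′ m
      ... | inj₂ (r , er , m′) with same er
      ...   | refl , refl = ⊥-elim (≺O-irr m′)
      below q₁ q₂ | inj₁ f with lex-ʳsplitʳ c (f q₂)
      ... | inj₁ g = g q₁
      ... | inj₂ (r , er , m′) with same (sym er)
      ...   | refl , _ = ⊥-elim (≺O-irr m)

    -- Greedy extension of a path between two separated families.

    Separated : List Path → List Path → Set
    Separated 𝒟 𝒰 = ∀ {D U} → D ∈ 𝒟 → U ∈ 𝒰 → ¬ D ◁ U

    Between : List Path → List Path → Path → Set
    Between 𝒟 𝒰 K = (∀ {D} → D ∈ 𝒟 → ¬ D ◁ K) × (∀ {U} → U ∈ 𝒰 → ¬ K ◁ U)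

    rev-split : ∀ (a b : Path) → b ʳ++ a ≡ reverse (a ʳ++ b)
    rev-split a b = trans (cong (b ʳ++_) (sym (++-identityʳ a))) (sym (ʳ++-ʳ++ a))

    -- The new edge matters only if the outgoing comparison is decided at it. Then `S` has followed
    -- `K` to its end, is below `K` on the incoming side there, and leaves by a larger edge.
    ◁-snoc : ∀ {S} K g → S ◁ (K ++ g ∷ []) →
      S ◁ K ⊎ ∃ λ z → ∃₂ λ h r → S ≡ z ʳ++ (h ∷ r) × z ≺I reverse K × g <O h
    ◁-snoc K g (place a b a′ b′ refl eq l m) with lex-nonemptyˡ m
    ... | _ , _ , nb with ʳ++-split-last a′ b′ K g nb eq
    ... | b₁ , refl , refl with lex-splitˡ b₁ m
    ...   | inj₁ f = inj₁ (place a b a′ b₁ refl refl l (subst (_≺O b) (++-identityʳ b₁) (f [])))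
    ...   | inj₂ (_ ∷ r , refl , here g<h) = inj₂ (b₁ ʳ++ a , _ , r , sym (ʳ++-ʳ++ b₁) ,
            subst ((b₁ ʳ++ a) ≺I_) (rev-split a′ b₁) (lex-ʳprepend b₁ l) , g<h)

    snoc-◁ : ∀ {S} K g → (K ++ g ∷ []) ◁ S →
      K ◁ S ⊎ ∃ λ z → ∃₂ λ h r → S ≡ z ʳ++ (h ∷ r) × reverse K ≺I z × h <O g
    snoc-◁ K g (place a b a′ b′ eq refl l m) with lex-nonemptyʳ m
    ... | _ , _ , nb with ʳ++-split-last a b K g nb eq
    ... | b₁ , refl , refl with lex-splitʳ b₁ m
    ...   | inj₁ f = inj₁ (place a b₁ a′ b′ refl refl l (subst (b′ ≺O_) (++-identityʳ b₁) (f [])))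
    ...   | inj₂ (_ ∷ r , refl , here h<g) = inj₂ (b₁ ʳ++ a′ , _ , r , sym (ʳ++-ʳ++ b₁) ,
            subst (_≺I (b₁ ʳ++ a′)) (rev-split a b₁)
              (lex-ʳprepend b₁ l) , h<g)

    ◁-cons : ∀ {S} g K → S ◁ (g ∷ K) →
      S ◁ K ⊎ ∃ λ h → ∃₂ λ z r → S ≡ (h ∷ z) ʳ++ r × h <I g × K ≺O r
    ◁-cons g K (place a b a′ b′ refl eq l m) with lex-nonemptyʳ l
    ... | _ , _ , na with ʳ++-split-first a′ b′ K g na eq
    ... | a₁ , refl , refl with lex-splitʳ a₁ l
    ...   | inj₁ f = inj₁ (place a b a₁ b′ refl refl (subst (a ≺I_) (++-identityʳ a₁) (f [])) m)
    ...   | inj₂ (_ ∷ z , refl , here h<g) =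
            inj₂ (_ , z , a₁ ʳ++ b , ++-ʳ++ a₁ , h<g , lex-ʳprepend a₁ m)

    cons-◁ : ∀ {S} g K → (g ∷ K) ◁ S →
      K ◁ S ⊎ ∃ λ h → ∃₂ λ z r → S ≡ (h ∷ z) ʳ++ r × g <I h × r ≺O K
    cons-◁ g K (place a b a′ b′ eq refl l m) with lex-nonemptyˡ l
    ... | _ , _ , na with ʳ++-split-first a b K g na eq
    ... | a₁ , refl , refl with lex-splitˡ a₁ l
    ...   | inj₁ f = inj₁ (place a₁ b a′ b′ refl refl (subst (_≺I a′) (++-identityʳ a₁) (f [])) m)
    ...   | inj₂ (_ ∷ z , refl , here g<h) =
            inj₂ (_ , z , a₁ ʳ++ b′ , ++-ʳ++ a₁ , g<h , lex-ʳprepend a₁ m)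

    minimal : {_<_ : E → E → Set} → (∀ {x y z} → x < y → y < z → x < z) → (∀ {x} → ¬ (x < x)) →
      (∀ x y → Dec (x < y)) → {P : E → Set} → (∀ e → Dec (P e)) → ∃ P → ∃ λ g → P g × (∀ h → P h → ¬ (h < g))
    minimal {_<_} tr irr _<?_ {P} P? (e , pe) with go (allFin m)
      where
      go : ∀ xs → (∀ {h} → h ∈ xs → ¬ P h) ⊎ ∃ λ g → P g × (∀ {h} → h ∈ xs → P h → ¬ (h < g))
      go [] = inj₁ λ ()
      go (x ∷ xs) with P? x | go xs
      ... | no ¬p | inj₁ none = inj₁ λ { (here refl) → ¬p ; (there i) → none i }
      ... | no ¬p | inj₂ (g , pg , min) =
            inj₂ (g , pg , λ { (here refl) p → ⊥-elim (¬p p) ; (there i) → min i })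
      ... | yes p | inj₁ none =
            inj₂ (x , p , λ { (here refl) _ → irr ; (there i) q → ⊥-elim (none i q) })
      ... | yes p | inj₂ (g , pg , min) with x <? g
      ...   | yes l = inj₂ (x , p , λ { (here refl) _ → irr ; (there i) q m → min i q (tr m l) })
      ...   | no ¬l = inj₂ (g , pg , λ { (here refl) _ → ¬l ; (there i) → min i })
    ... | inj₁ none = ⊥-elim (none (∈-allFin e) pe)
    ... | inj₂ (g , pg , min) = g , pg , λ h → min (∈-allFin h)

    chain-snoc : ∀ {a} K {g} → Chain a K → src g ≡ endV a K →
      Chain a (K ++ g ∷ []) × endV a (K ++ g ∷ []) ≡ tgt g
    chain-snoc [] ch eq = (eq , tt) , refl
    chain-snoc (e ∷ K) (eq′ , ch) eq with chain-snoc K ch eq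
    ... | ch′ , en = (eq′ , ch′) , en

    out-edge : ∀ {v} → v ≢ t → ∃ λ g → src g ≡ v
    out-edge {v} v≢t with Finₚ.any? (λ g → src g ≟ v)
    ... | yes r = r
    ... | no ¬r = ⊥-elim (v≢t (t-unique v λ e eq → ¬r (e , eq)))

    in-edge : ∀ {v} → v ≢ s → ∃ λ g → tgt g ≡ v
    in-edge {v} v≢s with Finₚ.any? (λ g → tgt g ≟ v)
    ... | yes r = r
    ... | no ¬r = ⊥-elim (v≢s (s-unique v λ e eq → ¬r (e , eq)))

    module Greedy (𝒟 𝒰 : List Path) (sep : Separated 𝒟 𝒰) where

      -- Among the outgoing edges that keep everything in 𝒟 from passing below K, the smallest one
      -- also keeps everything in 𝒰 from passing above.
      step-right : ∀ {a} K → Between 𝒟 𝒰 K → endV a K ≢ t →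
        ∃ λ g → src g ≡ endV a K × Between 𝒟 𝒰 (K ++ g ∷ [])
      step-right {a} K (noD , noU) ne
        -- The largest outgoing edge `gm` is always admissible, since no member of `𝒟` can leave by
        -- a larger one; so the set to be minimised over is nonempty.
        with minimal (λ l m → O-trans m l) O-irr (λ x y → y <O? x) (λ g → src g ≟ endV a K) (out-edge ne)
      ... | gm , gm-src , gm-max
        with minimal O-trans O-irr _<O?_ (λ g → (src g ≟ endV a K) ×-dec ¬? (any? (_◁? (K ++ g ∷ [])) 𝒟))
               (gm , gm-src , λ any → case find any of λ { (D , D∈ , d) → good D∈ d })
        where
        good : ∀ {D} → D ∈ 𝒟 → ¬ D ◁ (K ++ gm ∷ [])
        good D∈ d with ◁-snoc K gm d
        ... | inj₁ d′ = noD D∈ d′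
        ... | inj₂ (_ , h , _ , _ , _ , l) = gm-max h (trans (sym (src-O l)) gm-src) l
      ... | g , (g-src , g-good) , g-min = g , g-src , (λ D∈ d → g-good (lose D∈ d)) , above
        where
        above : ∀ {U} → U ∈ 𝒰 → ¬ (K ++ g ∷ []) ◁ U
        above U∈ u with snoc-◁ K g u
        ... | inj₁ u′ = noU U∈ u′
        ... | inj₂ (z , h , r , refl , l , h<g) with any? (_◁? (K ++ h ∷ [])) 𝒟
        ...   | no ok = g-min h (trans (src-O h<g) g-src , ok) h<g
        -- A smaller edge `h` was excluded by some `D` leaving the end of `K` above `h`; as `U`
        -- leaves by `h` and enters above `K`, this gives `D ◁ U`.
        ...   | yes bad with find bad
        ...     | D , D∈ , d with ◁-snoc K h d
        ...       | inj₁ d′ = noD D∈ d′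
        ...       | inj₂ (z′ , h′ , r′ , refl , l′ , h<h′) =
                      sep D∈ U∈ (place z′ (h′ ∷ r′) z (h ∷ r) refl refl (≺I-trans l′ l) (here h<h′))

      -- At the initial end the roles of small and large are exchanged: the largest admissible
      -- incoming edge is taken, and the smallest one shows that there is one.
      step-left : ∀ {a} K → Between 𝒟 𝒰 K → a ≢ s → ∃ λ g → tgt g ≡ a × Between 𝒟 𝒰 (g ∷ K)
      step-left {a} K (noD , noU) ne
        with minimal I-trans I-irr _<I?_ (λ g → tgt g ≟ a) (in-edge ne)
      ... | gm , gm-tgt , gm-min
        with minimal (λ l m → I-trans m l) I-irr (λ x y → y <I? x) (λ g → (tgt g ≟ a) ×-dec ¬? (any? (_◁? (g ∷ K)) 𝒟))
               (gm , gm-tgt , λ any → case find any of λ { (D , D∈ , d) → good D∈ d })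
        where
        good : ∀ {D} → D ∈ 𝒟 → ¬ D ◁ (gm ∷ K)
        good D∈ d with ◁-cons gm K d
        ... | inj₁ d′ = noD D∈ d′
        ... | inj₂ (h , _ , _ , _ , l , _) = gm-min h (trans (tgt-I l) gm-tgt) l
      ... | g , (g-tgt , g-good) , g-max = g , g-tgt , (λ D∈ d → g-good (lose D∈ d)) , above
        where
        above : ∀ {U} → U ∈ 𝒰 → ¬ (g ∷ K) ◁ U
        above U∈ u with cons-◁ g K u
        ... | inj₁ u′ = noU U∈ u′
        ... | inj₂ (h , z , r , refl , g<h , m) with any? (_◁? (h ∷ K)) 𝒟
        ...   | no ok = g-max h (trans (sym (tgt-I g<h)) g-tgt , ok) g<h
        ...   | yes bad with find bad
        ...     | D , D∈ , d with ◁-cons h K d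
        ...       | inj₁ d′ = noD D∈ d′
        ...       | inj₂ (h′ , z′ , r′ , refl , h′<h , m′) =
                      sep D∈ U∈ (place (h′ ∷ z′) r′ (h ∷ z) r refl refl (here h′<h) (≺O-trans m m′))

      extend-right : ∀ k {a} K → n ℕ.≤ toℕ (endV a K) + k → Chain a K → Between 𝒟 𝒰 K →
        ∃ λ post → Chain a (K ++ post) × endV a (K ++ post) ≡ t × Between 𝒟 𝒰 (K ++ post)
      extend-right k {a} K le ch bet with endV a K ≟ t
      ... | yes eq = [] , subst (λ L → Chain a L × endV a L ≡ t × Between 𝒟 𝒰 L) (sym (++-identityʳ K)) (ch , eq , bet)
      extend-right zero {a} K le ch bet | no ne = ⊥-elim (ℕₚ.<⇒≱ (Finₚ.toℕ<n (endV a K))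
        (subst (n ℕ.≤_) (ℕₚ.+-identityʳ _) le))
      extend-right (suc k) {a} K le ch bet | no ne with step-right {a} K bet ne
      ... | g , eq , bet′ with chain-snoc K {g} ch eq
      ... | ch′ , en with extend-right k (K ++ g ∷ []) (begin
                n                                       ≤⟨ le ⟩
                toℕ (endV a K) + suc k                  ≡⟨ ℕₚ.+-suc _ k ⟩
                suc (toℕ (endV a K)) + k                ≡⟨ cong (λ v → suc (toℕ v) + k) eq ⟨
                suc (toℕ (src g)) + k                   ≤⟨ ℕₚ.+-monoˡ-≤ k (src<tgt g) ⟩
                toℕ (tgt g) + k                         ≡⟨ cong (λ v → toℕ v + k) en ⟨
                toℕ (endV a (K ++ g ∷ [])) + k          ∎) ch′ bet′
        where open ℕₚ.≤-Reasoning
      ... | post , r = g ∷ post , subst (λ L → Chain a L × endV a L ≡ t × Between 𝒟 𝒰 L) (++-assoc K (g ∷ []) post) r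

      extend-left : ∀ k {a} K → toℕ a ℕ.≤ k → Chain a K → Between 𝒟 𝒰 K →
        ∃ λ pre → Chain s (pre ʳ++ K) × endV s (pre ʳ++ K) ≡ endV a K × Between 𝒟 𝒰 (pre ʳ++ K)
      extend-left k {a} K le ch bet with a ≟ s
      ... | yes refl = [] , ch , refl , bet
      ... | no ne with step-left K bet ne
      extend-left zero K le ch bet | no ne | g , refl , bet′ =
        ⊥-elim (ℕₚ.n≮0 (ℕₚ.<-≤-trans (src<tgt g) le))
      extend-left (suc k) K le ch bet | no ne | g , refl , bet′
        with extend-left k (g ∷ K) (ℕₚ.≤-pred (ℕₚ.<-≤-trans (src<tgt g) le)) (refl , ch) bet′
      ... | pre , r = g ∷ pre , r

      greedy : ∀ {a} K → Chain a K → Between 𝒟 𝒰 K → ∃ λ R → IsRoute R × Infix K R × Between 𝒟 𝒰 R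
      greedy {a} K ch bet with extend-right n K (ℕₚ.m≤n+m n _) ch bet
      ... | post , ch₁ , en₁ , bet₁ with extend-left (toℕ a) (K ++ post) ℕₚ.≤-refl ch₁ bet₁
      ... | pre , ch₂ , en₂ , bet₂ = _ , (ch₂ , trans en₂ en₁) , (pre , post , refl) , bet₂

    -- The measure behind `Climb`, applied to a path without its last edge: truncation lowers the
    -- first edge in the In order and keeps or drops the middle ones, but its new last edge is
    -- larger in the Out order, where `ρ` gives no control.
    weight : Path → ℕ
    weight [] = 0
    weight (e ∷ p) = ρ e + weight p

    weight-++ : ∀ p q → weight (p ++ q) ≡ weight p + weight q
    weight-++ [] q = refl
    weight-++ (e ∷ p) q = trans (cong (ρ e +_) (weight-++ p q)) (sym (ℕₚ.+-assoc (ρ e) (weight p) (weight q)))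

    weight-ʳ++ : ∀ p q → weight (p ʳ++ q) ≡ weight p + weight q
    weight-ʳ++ [] q = refl
    weight-ʳ++ (e ∷ p) q = begin
      weight (p ʳ++ (e ∷ q))           ≡⟨ weight-ʳ++ p (e ∷ q) ⟩
      weight p + (ρ e + weight q)      ≡⟨ ℕₚ.+-assoc (weight p) (ρ e) (weight q) ⟨
      weight p + ρ e + weight q        ≡⟨ cong (_+ weight q) (ℕₚ.+-comm (weight p) (ρ e)) ⟩
      ρ e + weight p + weight q        ∎
      where open ≡-Reasoning

    -- The part of D along which D and K are incoherent, with the two edges of D at its ends.
    record Truncation (D K M : Path) : Set where
      field
        K′ M′    : Path
        y′       : E
        eq       : K′ ≡ M′ ++ y′ ∷ []
        part     : Infix K′ D
        below    : K′ ◁ K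
        inherit  : ∀ {S} → S ◁ K′ → S ◁ K
        lighter  : weight M′ ℕ.< weight M

    -- Cutting `D` at the two deciding edges keeps the incoherence. Between these edges `D` agrees
    -- with `K`, and it enters lower and leaves higher, so `mono-right` yields `inherit`.
    truncate : ∀ {D K M y} → K ≡ M ++ y ∷ [] → D ◁ K → Truncation D K M
    truncate {M = M} {y} eq (place z r a b refl eqK l m) with lex-nonemptyˡ m
    ... | _ , _ , nb with ʳ++-split-last a b M y nb (trans (sym eq) eqK)
    ... | b₁ , b≡ , M≡ with lex-view l | lex-view m
    ... | c , x , e , z₀ , a₀ , refl , refl , x<e | d , f , y₂ , b₀ , r₀ , refl , refl , f<y₂
      with prefix-of-init d b₁ b≡
    ... | u , refl = record
      { K′ = (c ++ x ∷ []) ʳ++ (d ++ y₂ ∷ []) ; M′ = (c ++ x ∷ []) ʳ++ d ; y′ = y₂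
      ; eq = sym (ʳ++-assoc (c ++ x ∷ []) d (y₂ ∷ []))
      ; part = infix-zipper c x z₀ d y₂ r₀
      ; below = place _ _ _ _ refl eqK (lex-at c x<e) (lex-at d f<y₂)
      ; inherit = λ h → subst (_ ◁_) (sym eqK) (mono-right c x d y₂ (inj₂ x<e) (inj₂ f<y₂) h)
      ; lighter = begin-strict
          weight ((c ++ x ∷ []) ʳ++ d)                    ≡⟨ weight-ʳ++ (c ++ x ∷ []) d ⟩
          weight (c ++ x ∷ []) + weight d                 ≡⟨ cong (_+ weight d) (weight-++ c (x ∷ [])) ⟩
          weight c + (ρ x + 0) + weight d                 <⟨ ℕₚ.+-monoˡ-< (weight d)
            (ℕₚ.+-monoʳ-< (weight c) (ℕₚ.+-mono-<-≤ (ρ-mono x<e) z≤n)) ⟩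
          weight c + (ρ e + weight a₀) + weight d         ≤⟨ ℕₚ.+-monoʳ-≤ _ (ℕₚ.m≤m+n (weight d) (weight u)) ⟩
          weight c + (ρ e + weight a₀) + (weight d + weight u) ≡⟨ cong₂ _+_ (weight-++ c (e ∷ a₀)) (weight-++ d u) ⟨
          weight (c ++ e ∷ a₀) + weight (d ++ u)          ≡⟨ weight-ʳ++ (c ++ e ∷ a₀) (d ++ u) ⟨
          weight ((c ++ e ∷ a₀) ʳ++ (d ++ u))             ≡⟨ cong weight M≡ ⟨
          weight M                                        ∎ }
      where open ℕₚ.≤-Reasoning

    ◁-last : ∀ {D K} → D ◁ K → ∃₂ λ M y → K ≡ M ++ y ∷ []
    ◁-last (place z r a b refl refl l m) with ∷ʳ-view b
    ... | inj₁ refl = case lex-nonemptyˡ m of λ ()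
    ... | inj₂ (b₁ , y , refl) = a ʳ++ b₁ , y , sym (ʳ++-assoc a b₁ (y ∷ []))

    module Climb (𝒟 𝒰 : List Path) (sep : Separated 𝒟 𝒰) (𝒟-routes : ∀ {D} → D ∈ 𝒟 → IsRoute D) where
      open Greedy 𝒟 𝒰 sep

      -- Truncate `D` against `R`. If no member of `𝒟` is below the piece, it extends greedily to
      -- `Q`; otherwise truncate that member against the piece and repeat. All pieces stay below `R`
      -- by `inherit`, are below nothing in `𝒰` as parts of members of `𝒟`, and lose weight.
      climb : ∀ {D R} → D ∈ 𝒟 → D ◁ R → ∃ λ Q → IsRoute Q × Between 𝒟 𝒰 Q × Q ◁ R
      climb {D₀} {R} D₀∈ d₀ with ◁-last d₀
      ... | _ , _ , eqR = start (truncate eqR d₀)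
        where
        loop : ∀ k K M {y a} → weight M ℕ.< k → K ≡ M ++ y ∷ [] → Chain a K → K ◁ R →
          (∀ {S} → S ◁ K → S ◁ R) → (∀ {U} → U ∈ 𝒰 → ¬ K ◁ U) → ∃ λ Q → IsRoute Q × Between 𝒟 𝒰 Q × Q ◁ R
        loop (suc k) K M lt eq ch K◁R inh noU with any? (_◁? K) 𝒟
        ... | no none with greedy K ch ((λ D∈ d → none (lose D∈ d)) , noU)
        ...   | Q , rt , inf , bet = Q , rt , bet , ◁-infixˡ inf K◁R
        loop (suc k) K M lt eq ch K◁R inh noU | yes some with find some
        ... | D , D∈ , d with truncate eq d
        ...   | record { K′ = K′ ; M′ = M′ ; eq = eq′ ; part = part ; below = below ; inherit = inherit ; lighter = lighter } =
          loop k K′ M′ (ℕₚ.<-≤-trans lighter (ℕₚ.≤-pred lt)) eq′ (proj₂ (chain-infix part (proj₁ (𝒟-routes D∈))))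
            (inh below) (λ h → inh (inherit h)) (λ U∈ h → sep D∈ U∈ (◁-infixˡ part h))
        start : ∀ {M} → Truncation D₀ R M → ∃ λ Q → IsRoute Q × Between 𝒟 𝒰 Q × Q ◁ R
        start record { K′ = K′ ; M′ = M′ ; eq = eq′ ; part = part ; below = below ; inherit = inherit } =
          loop (suc (weight M′)) K′ M′ ℕₚ.≤-refl eq′ (proj₂ (chain-infix part (proj₁ (𝒟-routes D₀∈))))
            below inherit (λ U∈ h → sep D₀∈ U∈ (◁-infixˡ part h))

    record MaxClique (C : List Path) : Set where
      field
        route : ∀ {R} → R ∈ C → IsRoute R
        coh   : Separated C C
        max   : ∀ {R} → IsRoute R → Between C C R → R ∈ C

    module _ {C} (mc : MaxClique C) where
      open MaxClique mc
      open Greedy C C coh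

      clique-extend : ∀ {a} K → Chain a K → Between C C K → ∃ λ R → R ∈ C × Infix K R
      clique-extend K ch bet with greedy K ch bet
      ... | R , rt , inf , bet′ = R , max rt bet′ , inf

      -- Everything below the truncation of A is below B, so a route of C through it would separate
      -- A from B.
      below-not-◁-above : ∀ {a A B} → Chain a A → (∀ {R} → R ∈ C → ¬ A ◁ R) → (∀ {R} → R ∈ C → ¬ R ◁ B) → ¬ A ◁ B
      below-not-◁-above ch noA noB A◁B with ◁-last A◁B
      ... | _ , _ , eqB = contra (truncate eqB A◁B)
        where
        contra : ∀ {M} → ¬ Truncation _ _ M
        contra record { K′ = K′ ; part = part ; below = below ; inherit = inherit }
          with clique-extend K′ (proj₂ (chain-infix part ch))
                 ((λ R∈ h → noB R∈ (inherit h)) , (λ R∈ h → noA R∈ (◁-infixˡ part h)))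
        ... | R , R∈ , inf = noB R∈ (◁-infixˡ inf below)

    -- How a flip forces its label on other paths.

    -- The place sits at a vertex of `R`, which `R` visits only once; so the outgoing word of the
    -- altered piece is a prefix of that of `R`, and prefixes are incomparable.
    no-selfˡ : ∀ {R} c x p₀ d y q₀ e → IsRoute R → R ≡ (c ++ x ∷ p₀) ʳ++ (d ++ y ∷ q₀) → tgt e ≡ tgt x →
      ¬ R ◁ ((c ++ e ∷ []) ʳ++ (d ++ y ∷ []))
    no-selfˡ c x p₀ d y q₀ e rt eqR te (place a b a′ b′ eq eq′ l m)
      with lex-nonemptyʳ l
    ... | _ , _ , na with ʳ++-split-first a′ b′ (c ʳ++ (d ++ y ∷ [])) e na (trans (sym (zipper-form c e [] _)) eq′)
    ... | a₁ , refl , e₁ with route-zipper a rt eq | route-zipper (a₁ ++ x ∷ p₀) {b′ ++ q₀} rt (begin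
        _                                                 ≡⟨ eqR ⟩
        (c ++ x ∷ p₀) ʳ++ (d ++ y ∷ q₀)                   ≡⟨ zipper-form c x p₀ _ ⟩
        p₀ ʳ++ (x ∷ (c ʳ++ (d ++ y ∷ q₀)))                ≡⟨ cong (λ z → p₀ ʳ++ (x ∷ (c ʳ++ z))) (++-assoc d (y ∷ []) q₀) ⟨
        p₀ ʳ++ (x ∷ (c ʳ++ ((d ++ y ∷ []) ++ q₀)))        ≡⟨ cong (λ z → p₀ ʳ++ (x ∷ z)) (ʳ++-assoc c (d ++ y ∷ []) q₀) ⟨
        p₀ ʳ++ (x ∷ ((c ʳ++ (d ++ y ∷ [])) ++ q₀))        ≡⟨ cong (λ z → p₀ ʳ++ (x ∷ (z ++ q₀))) e₁ ⟩
        p₀ ʳ++ (x ∷ ((a₁ ʳ++ b′) ++ q₀))                  ≡⟨ cong (λ z → p₀ ʳ++ (x ∷ z)) (ʳ++-assoc a₁ b′ q₀) ⟩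
        p₀ ʳ++ (x ∷ (a₁ ʳ++ (b′ ++ q₀)))                  ≡⟨ zipper-form a₁ x p₀ _ ⟨
        (a₁ ++ x ∷ p₀) ʳ++ (b′ ++ q₀)                     ∎)
      where open ≡-Reasoning
    ... | w , z | w₂ , z₂ with same-end a₁ l (Zipper.bp z) (Zipper.bp z₂)
      where
      same-end : ∀ a₁ {a w w₂} → a ≺I (a₁ ++ e ∷ []) → BackPath s w a → BackPath s w₂ (a₁ ++ x ∷ p₀) → w ≡ w₂
      same-end [] (here l) (f , _) (g , _) = trans (sym f) (trans (trans (tgt-I l) te) g)
      same-end (_ ∷ _) (here l) (f , _) (g , _) = trans (sym f) (trans (tgt-I l) g)
      same-end (_ ∷ _) (there l) (f , _) (g , _) = trans (sym f) g
    ... | refl with split-unique a b (a₁ ++ x ∷ p₀) (b′ ++ q₀) (Zipper.bp z) (Zipper.bp z₂)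
                     (trans (sym (Zipper.eq z)) (Zipper.eq z₂))
    ... | _ , refl = lex-no-prefixˡ O-irr b′ m

    no-selfʳ : ∀ {R} c x p₀ d y q₀ f → IsRoute R → R ≡ (c ++ x ∷ p₀) ʳ++ (d ++ y ∷ q₀) →
      ¬ R ◁ ((c ++ x ∷ []) ʳ++ (d ++ f ∷ []))
    no-selfʳ c x p₀ d y q₀ f rt eqR (place a b a′ b′ eq eq′ l m)
      with lex-nonemptyˡ m
    ... | _ , _ , nb with ʳ++-split-last a′ b′ ((c ++ x ∷ []) ʳ++ d) f nb (trans (ʳ++-assoc (c ++ x ∷ []) d _) eq′)
    ... | b₁ , refl , e₁ with route-zipper a rt eq | route-zipper (a′ ++ p₀) {b₁ ++ y ∷ q₀} rt (begin
        _                                                 ≡⟨ eqR ⟩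
        (c ++ x ∷ p₀) ʳ++ (d ++ y ∷ q₀)                   ≡⟨ cong (_ʳ++ (d ++ y ∷ q₀)) (++-assoc c (x ∷ []) p₀) ⟨
        ((c ++ x ∷ []) ++ p₀) ʳ++ (d ++ y ∷ q₀)           ≡⟨ ++-ʳ++ (c ++ x ∷ []) ⟩
        p₀ ʳ++ ((c ++ x ∷ []) ʳ++ (d ++ y ∷ q₀))          ≡⟨ cong (p₀ ʳ++_) (ʳ++-assoc (c ++ x ∷ []) d _) ⟨
        p₀ ʳ++ (((c ++ x ∷ []) ʳ++ d) ++ y ∷ q₀)          ≡⟨ cong (λ z → p₀ ʳ++ (z ++ y ∷ q₀)) e₁ ⟩
        p₀ ʳ++ ((a′ ʳ++ b₁) ++ y ∷ q₀)                    ≡⟨ cong (p₀ ʳ++_) (ʳ++-assoc a′ b₁ _) ⟩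
        p₀ ʳ++ (a′ ʳ++ (b₁ ++ y ∷ q₀))                    ≡⟨ ++-ʳ++ a′ ⟨
        (a′ ++ p₀) ʳ++ (b₁ ++ y ∷ q₀)                     ∎)
      where open ≡-Reasoning
    ... | w , z | w₂ , z₂ with same-end l (Zipper.bp z) (Zipper.bp z₂)
      where
      same-end : ∀ {a a′ w w₂} → a ≺I a′ → BackPath s w a → BackPath s w₂ (a′ ++ p₀) → w ≡ w₂
      same-end (here l) (f , _) (g , _) = trans (sym f) (trans (tgt-I l) g)
      same-end (there l) (f , _) (g , _) = trans (sym f) g
    ... | refl with split-unique a b (a′ ++ p₀) (b₁ ++ y ∷ q₀) (Zipper.bp z) (Zipper.bp z₂)
                     (trans (sym (Zipper.eq z)) (Zipper.eq z₂))
    ... | refl , _ = lex-no-prefixʳ I-irr a′ l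

    -- The routes R₁ = (p , q) and R₂ = (p′ , q′) of a flip, split at a place where R₁ ◁ R₂.
    record Corner (R₁ R₂ : Path) : Set where
      field
        c d p₀ p₀′ q₀ q₀′ : Path
        x e y f : E
        x<e : x <I e
        f<y : f <O y
        eq₁ : R₁ ≡ (c ++ x ∷ p₀) ʳ++ (d ++ y ∷ q₀)
        eq₂ : R₂ ≡ (c ++ e ∷ p₀′) ʳ++ (d ++ f ∷ q₀′)
      p q p′ q′ upper : Path
      p = c ++ x ∷ p₀
      p′ = c ++ e ∷ p₀′
      q = d ++ y ∷ q₀
      q′ = d ++ f ∷ q₀′
      upper = (c ++ e ∷ []) ʳ++ (d ++ f ∷ [])

    -- The mixed routes of a corner lie in the upper clique of the flip; then the label of the flip
    -- is forced on every path Z that enters the order ideal of v but not that of u.  The routes of u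
    -- through the two hybrids of Z and R₁ confine the ends of the place where R₁ ◁ Z.
    module FlipLabel {u v R₁ R₂} (mu : MaxClique u) (v-coh : Separated v v)
        (u⊆ : ∀ {S} → S ∈ u → S ≡ R₁ ⊎ S ∈ v) (R₁∈ : R₁ ∈ u) (R₂∈ : R₂ ∈ v) (κ : Corner R₁ R₂)
        (W∈ : (Corner.p κ ʳ++ Corner.q′ κ) ∈ v) (W′∈ : (Corner.p′ κ ʳ++ Corner.q κ) ∈ v) where
      open Corner κ
      private module Mu = MaxClique mu

      label-forced : ∀ {a Z} → Chain a Z → (∀ {S} → S ∈ v → ¬ S ◁ Z) → R₁ ◁ Z → Infix upper Z
      -- Were the incoherence also visible from a mixed route, that member of `v` would be below
      -- `Z`. So `Z` passes through the marked vertex and is incoherent with `R₁` there.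
      label-forced {a} {Z} chZ noZ h with localizeˡ p q p′ q′ (subst (_◁ Z) eq₁ h)
      ... | inj₁ h′ = ⊥-elim (noZ W′∈ h′)
      ... | inj₂ (inj₁ h′) = ⊥-elim (noZ W∈ h′)
      ... | inj₂ (inj₂ (z , r , refl , l , m)) = at-views (lex-view l) (lex-view m)
        where
        Z₀ = z ʳ++ r
        zipR₁ = route-zipper p (Mu.route R₁∈) eq₁
        splitZ = chain-split z chZ
        v₁ = proj₁ zipR₁
        bpR₁ = Zipper.bp (proj₂ zipR₁)
        v≡ : v₁ ≡ proj₁ splitZ
        v≡ = ≺I-same-end l bpR₁ (proj₁ (proj₂ splitZ))
        bpz : BackPath a v₁ z
        bpz = subst (λ w → BackPath a w z) (sym v≡) (proj₁ (proj₂ splitZ))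
        chr : Chain v₁ r
        chr = subst (λ w → Chain w r) (sym v≡) (proj₁ (proj₂ (proj₂ splitZ)))
        at-views : (∃ λ c₃ → ∃₂ λ x₃ e₃ → ∃₂ λ p₃ s₃ → p ≡ c₃ ++ x₃ ∷ p₃ × z ≡ c₃ ++ e₃ ∷ s₃ × x₃ <I e₃) →
          (∃ λ d₃ → ∃₂ λ f₃ y₃ → ∃₂ λ r₃ q₃ → r ≡ d₃ ++ f₃ ∷ r₃ × q ≡ d₃ ++ y₃ ∷ q₃ × f₃ <O y₃) →
          Infix upper Z₀
        at-views (c₃ , x₃ , e₃ , p₃ , s₃ , p≡ , z≡ , x₃<e₃) (d₃ , f₃ , y₃ , r₃ , q₃ , r≡ , q≡ , f₃<y₃) =
          finish left-end
          where
          R₁≡ : R₁ ≡ (c₃ ++ x₃ ∷ p₃) ʳ++ (d₃ ++ y₃ ∷ q₃)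
          R₁≡ = trans eq₁ (cong₂ _ʳ++_ p≡ q≡)
          Z≡ : (c₃ ++ e₃ ∷ s₃) ʳ++ (d₃ ++ f₃ ∷ r₃) ≡ Z₀
          Z≡ = sym (cong₂ _ʳ++_ z≡ r≡)

          -- `K₁` enters like `Z` and leaves like `R₁`; `K₂` does the opposite. Each is coherent
          -- with all of `u`, so a route of `u` runs through it.
          K₁ = (c₃ ++ e₃ ∷ []) ʳ++ (d₃ ++ y₃ ∷ [])
          K₂ = (c₃ ++ x₃ ∷ []) ʳ++ (d₃ ++ f₃ ∷ [])

          ext₁ : ∃ λ R → R ∈ u × Infix K₁ R
          ext₁ = clique-extend mu K₁ (proj₂ (chain-infix (infix-zipper c₃ e₃ s₃ d₃ y₃ q₃)
                   (subst (Chain a) (cong₂ _ʳ++_ z≡ q≡)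
                     (proj₁ (chain-join z bpz (Zipper.ch (proj₂ zipR₁)))))))
                 (below , λ S∈ k → Mu.coh R₁∈ S∈ (subst (_◁ _) (sym R₁≡)
                   (mono-left c₃ e₃ d₃ y₃ (inj₂ x₃<e₃) (inj₁ refl) k)))
            where
            below : ∀ {S} → S ∈ u → ¬ S ◁ K₁
            below S∈ k with u⊆ S∈
            ... | inj₁ refl = no-selfˡ c₃ x₃ p₃ d₃ y₃ q₃ e₃ (Mu.route R₁∈) R₁≡ (sym (tgt-I x₃<e₃)) k
            ... | inj₂ S∈v = noZ S∈v (subst (_ ◁_) Z≡ (mono-right c₃ e₃ d₃ y₃ (inj₁ refl) (inj₂ f₃<y₃) k))

          ext₂ : ∃ λ R → R ∈ u × Infix K₂ R
          ext₂ = clique-extend mu K₂ (proj₂ (chain-infix (infix-zipper c₃ x₃ p₃ d₃ f₃ r₃)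
                   (subst (Chain s) (cong₂ _ʳ++_ p≡ r≡) (proj₁ (chain-join p bpR₁ chr)))))
                 (below , λ S∈ k → Mu.coh R₁∈ S∈ (subst (_◁ _) (sym R₁≡)
                   (mono-left c₃ x₃ d₃ f₃ (inj₁ refl) (inj₂ f₃<y₃) k)))
            where
            below : ∀ {S} → S ∈ u → ¬ S ◁ K₂
            below S∈ k with u⊆ S∈
            ... | inj₁ refl = no-selfʳ c₃ x₃ p₃ d₃ y₃ q₃ f₃ (Mu.route R₁∈) R₁≡ k
            ... | inj₂ S∈v = noZ S∈v (subst (_ ◁_) Z≡ (mono-right c₃ x₃ d₃ f₃ (inj₂ x₃<e₃) (inj₁ refl) k))

          unsnoc : ∀ (k : Path) g pre → (k ++ g ∷ []) ++ pre ≡ k ++ g ∷ pre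
          unsnoc k g pre = ++-assoc k (g ∷ []) pre

          left-end : c ≡ c₃ × x ≡ x₃ × e ≡ e₃
          left-end with ext₁
          ... | R , R∈ , inf with infix-split {c₃ ++ e₃ ∷ []} {d₃ ++ y₃ ∷ []} inf
          ... | pre , post , eqR with u⊆ R∈
          ...   | inj₁ refl = ⊥-elim (≺I-irr (subst ((c₃ ++ x₃ ∷ p₃) ≺I_) (sym same) (lex-at c₃ x₃<e₃)))
            where
            zip = route-zipper (c₃ ++ x₃ ∷ p₃) (Mu.route R₁∈) R₁≡
            zip′ = route-zipper (c₃ ++ e₃ ∷ pre) (Mu.route R₁∈)
                     (trans eqR (cong (_ʳ++ ((d₃ ++ y₃ ∷ []) ++ post)) (unsnoc c₃ e₃ pre)))
            same : c₃ ++ x₃ ∷ p₃ ≡ c₃ ++ e₃ ∷ pre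
            same with ≺I-same-end (lex-at c₃ x₃<e₃) (Zipper.bp (proj₂ zip)) (Zipper.bp (proj₂ zip′))
            ... | w≡ = proj₁ (split-unique _ _ _ _ (subst (λ w → BackPath s w _) w≡ (Zipper.bp (proj₂ zip)))
                         (Zipper.bp (proj₂ zip′)) (trans (sym (Zipper.eq (proj₂ zip))) (Zipper.eq (proj₂ zip′))))
          -- `R₂` and `Z` both branch off `R₁`. Every outcome in which they enter differently puts a
          -- mixed route below `Z`, or the route through `K₁` below `R₂` inside `v`.
          ...   | inj₂ R∈v with lex-fork-below d d₃ {q′ = q₀′} {r = r₃} q≡ f<y f₃<y₃
          ...     | inj₂ r≺q′ = ⊥-elim (noZ W∈ (place p q′ z r refl refl l (subst (_≺O q′) (sym r≡) r≺q′)))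
          ...     | inj₁ q′≺ with lex-fork c c₃ {p′ = p₀′} {s = s₃} p≡ x<e x₃<e₃
                                    (λ { refl → I-tri (trans (sym (tgt-I x<e)) (tgt-I x₃<e₃)) })
          ...       | inj₁ p′≺z = ⊥-elim (noZ W′∈ (place p′ q z r refl refl (subst (p′ ≺I_) (sym z≡) p′≺z) m))
          ...       | inj₂ (inj₁ ≺p′) = ⊥-elim (v-coh R∈v R₂∈ (place (c₃ ++ e₃ ∷ pre) (d₃ ++ y₃ ∷ post) p′ q′
                        (trans eqR (cong₂ _ʳ++_ (unsnoc c₃ e₃ pre) (unsnoc d₃ y₃ post))) eq₂ (≺p′ pre) (q′≺ post)))
          ...       | inj₂ (inj₂ same) = same

          finish : c ≡ c₃ × x ≡ x₃ × e ≡ e₃ → Infix upper Z₀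
          finish (refl , refl , refl) with ext₂
          ... | R , R∈ , inf with infix-split {c₃ ++ x₃ ∷ []} {d₃ ++ f₃ ∷ []} inf
          ... | pre , post , eqR with u⊆ R∈
          ...   | inj₁ refl = ⊥-elim (≺O-irr (subst ((d₃ ++ f₃ ∷ post) ≺O_) same (lex-at d₃ f₃<y₃)))
            where
            zip = route-zipper (c₃ ++ x₃ ∷ p₃) (Mu.route R₁∈) R₁≡
            zip′ = route-zipper (c₃ ++ x₃ ∷ pre) (Mu.route R₁∈)
                     (trans eqR (cong₂ _ʳ++_ (unsnoc c₃ x₃ pre) (unsnoc d₃ f₃ post)))
            zend = subst (BackPath a v₁) z≡ bpz
            same : d₃ ++ y₃ ∷ q₃ ≡ d₃ ++ f₃ ∷ post
            same with trans (≺I-same-end (lex-at c₃ x₃<e₃) (Zipper.bp (proj₂ zip)) zend)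
                            (sym (≺I-same-end (lex-at c₃ x₃<e₃) (Zipper.bp (proj₂ zip′)) zend))
            ... | w≡ = proj₂ (split-unique _ _ _ _ (subst (λ w → BackPath s w _) w≡ (Zipper.bp (proj₂ zip)))
                         (Zipper.bp (proj₂ zip′)) (trans (sym (Zipper.eq (proj₂ zip))) (Zipper.eq (proj₂ zip′))))
          ...   | inj₂ R∈v with lex-fork {_<_ = flip _<O_} d d₃ {p′ = q₀′} {s = r₃} q≡ f<y f₃<y₃
                                  (λ { refl → swap₃ (O-tri (trans (src-O f<y) (sym (src-O f₃<y₃)))) })
          ...     | inj₁ r≺q′ = ⊥-elim (noZ W∈ (place p q′ z r refl refl l
                      (subst (_≺O q′) (sym r≡) (lex-unflip r≺q′))))
          ...     | inj₂ (inj₁ q′≺) = ⊥-elim (v-coh R∈v R₂∈ (place (c₃ ++ x₃ ∷ pre) (d₃ ++ f₃ ∷ post) p′ q′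
                      (trans eqR (cong₂ _ʳ++_ (unsnoc c₃ x₃ pre) (unsnoc d₃ f₃ post))) eq₂
                      (lex-at c₃ x<e) (lex-unflip (q′≺ post))))
          ...     | inj₂ (inj₂ (refl , refl , refl)) = subst (Infix upper) Z≡ (infix-zipper c₃ e₃ s₃ d₃ f₃ r₃)

    -- Places of incoherence of two routes, and the routes with exchanged halves.

    record Place (R R′ : Path) : Set where
      constructor place-at
      field
        {v} : V
        {p q p′ q′} : Path
        zip  : Zipper R v p q
        zip′ : Zipper R′ v p′ q′
        inL  : p ≺I p′
        outL : q′ ≺O q
      W W′ : Path
      W = p ʳ++ q′
      W′ = p′ ʳ++ q

    place-zip : ∀ {R R′} → IsRoute R → IsRoute R′ → R ◁ R′ → Place R R′
    place-zip rt rt′ (place p q p′ q′ eq eq′ l m) with route-zipper p rt eq | route-zipper p′ rt′ eq′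
    ... | v , z | v′ , z′ with ≺I-same-end l (Zipper.bp z) (Zipper.bp z′)
    ... | refl = place-at z z′ l m

    place-◁ : ∀ {R R′} → Place R R′ → R ◁ R′
    place-◁ (place-at z z′ l m) = place _ _ _ _ (Zipper.eq z) (Zipper.eq z′) l m

    zipper-shift : ∀ {R v w p q z} c → Zipper R v p q → q ≡ c ʳ++ z → BackPath v w c → Zipper R w (c ++ p) z
    zipper-shift {w = w} {p} {z = z} c (zipper refl bp ch en) refl bc with chain-split c ch
    ... | w′ , bc′ , ch′ , en′ with back-end c bc bc′
    ... | refl = zipper (sym (++-ʳ++ c)) (back-glue c bc bp) ch′ (trans en′ en)

    -- By `share-left` everything is decided after `v`, so the common beginning can be replaced.
    share-left-transfer : ∀ {v} p p₂ q q′ → BackPath s v p → Chain v q → Chain v q′ →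
      (p ʳ++ q) ◁ (p ʳ++ q′) → (p₂ ʳ++ q) ◁ (p₂ ʳ++ q′)
    share-left-transfer p p₂ q q′ bp ch ch′ h with share-left p q q′ bp ch ch′ h
    ... | w , c , z , c′ , z′ , refl , refl , _ , _ , l , m , _ =
          place (c ++ p₂) z (c′ ++ p₂) z′ (sym (++-ʳ++ c)) (sym (++-ʳ++ c′)) (lex-++ p₂ p₂ l) m

    share-right-transfer : ∀ {v} p p′ q q₂ → BackPath s v p → BackPath s v p′ → Chain v q →
      (p ʳ++ q) ◁ (p′ ʳ++ q) → (p ʳ++ q₂) ◁ (p′ ʳ++ q₂)
    share-right-transfer p p′ q q₂ bp bp′ ch h with share-right p p′ q bp bp′ ch h
    ... | w , c , a , c′ , a′ , refl , refl , _ , _ , l , m , _ =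
          place a (c ʳ++ q₂) a′ (c′ ʳ++ q₂) (++-ʳ++ c) (++-ʳ++ c′) l (m q₂ q₂)

    -- A place after which R and R′ have no incoherence in either direction.
    record LastPlace (R R′ : Path) : Set where
      field
        pl : Place R R′
      open Place pl public
      field
        R-W : ¬ (p ʳ++ q) ◁ (p ʳ++ q′)
        W-R : ¬ (p ʳ++ q′) ◁ (p ʳ++ q)

    -- If `R` and `W` are incoherent, they share `p`, so this happens strictly to the right of `v`;
    -- there `R` and `R′` are incoherent as well, possibly with roles exchanged. The vertex
    -- increases, which bounds the search.
    last-place : ∀ k {R R′} (π : Place R R′) → n ℕ.≤ toℕ (Place.v π) + k → LastPlace R R′ ⊎ LastPlace R′ R
    last-place k π@(place-at {v} {p} {q} {p′} {q′} z z′ l m) le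
      with (p ʳ++ q) ◁? (p ʳ++ q′) | (p ʳ++ q′) ◁? (p ʳ++ q)
    ... | no ¬a | no ¬b = inj₁ record { pl = π ; R-W = ¬a ; W-R = ¬b }
    last-place zero (place-at {v} z z′ l m) le | yes h | _ =
      ⊥-elim (ℕₚ.<⇒≱ (Finₚ.toℕ<n v) (subst (n ℕ.≤_) (ℕₚ.+-identityʳ _) le))
    last-place zero (place-at {v} z z′ l m) le | no _ | yes h =
      ⊥-elim (ℕₚ.<⇒≱ (Finₚ.toℕ<n v) (subst (n ℕ.≤_) (ℕₚ.+-identityʳ _) le))
    last-place (suc k) (place-at {v} {p} {q} {p′} {q′} z z′ l m) le | yes h | _
      with share-left p q q′ (Zipper.bp z) (Zipper.ch z) (Zipper.ch z′) h
    ... | w , c , y , c′ , y′ , e , e′ , bc , bc′ , l′ , m′ , lt =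
          last-place k (place-at (zipper-shift c z e bc) (zipper-shift c′ z′ e′ bc′) (lex-++ p p′ l′) m′)
            (ℕₚ.≤-trans le (ℕₚ.≤-trans (ℕₚ.≤-reflexive (ℕₚ.+-suc _ k)) (ℕₚ.+-monoˡ-≤ k lt)))
    last-place (suc k) (place-at {v} {p} {q} {p′} {q′} z z′ l m) le | no _ | yes h
      with share-left p q′ q (Zipper.bp z) (Zipper.ch z′) (Zipper.ch z) h
    ... | w , c , y , c′ , y′ , e , e′ , bc , bc′ , l′ , m′ , lt
          with last-place k (place-at (zipper-shift c z′ e bc) (zipper-shift c′ z e′ bc′) (lex-++ p′ p l′) m′)
                 (ℕₚ.≤-trans le (ℕₚ.≤-trans (ℕₚ.≤-reflexive (ℕₚ.+-suc _ k)) (ℕₚ.+-monoˡ-≤ k lt)))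
    ...   | inj₁ r = inj₂ r
    ...   | inj₂ r = inj₁ r

    find-last : ∀ {R R′} → Place R R′ → LastPlace R R′ ⊎ LastPlace R′ R
    find-last π = last-place n π (ℕₚ.m≤n+m n _)

    -- Carries no direction on purpose: the search for a last place may exchange the two routes, and
    -- the reversed direction is excluded only afterwards.
    record Swap (C C′ : List Path) (R₁ R₂ : Path) : Set where
      field
        C-max : MaxClique C
        C′-max : MaxClique C′
        R₁∈ : R₁ ∈ C
        R₂∈ : R₂ ∈ C′
        C⊆ : ∀ {S} → S ∈ C → S ≡ R₁ ⊎ S ∈ C′
        C′⊆ : ∀ {S} → S ∈ C′ → S ≡ R₂ ⊎ S ∈ C

    swap-sym : ∀ {C C′ R₁ R₂} → Swap C C′ R₁ R₂ → Swap C′ C R₂ R₁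
    swap-sym σ = record { C-max = C′-max ; C′-max = C-max ; R₁∈ = R₂∈ ; R₂∈ = R₁∈ ; C⊆ = C′⊆ ; C′⊆ = C⊆ }
      where open Swap σ

    record Hybrids {R₁ R₂} (C C′ : List Path) (π : Place R₁ R₂) : Set where
      open Place π
      field
        W∈C   : W ∈ C
        W∈C′  : W ∈ C′
        W′∈C  : W′ ∈ C
        W′∈C′ : W′ ∈ C′

    -- `W` is coherent with `R₁` because the place is last, and with every common route by
    -- `Exchange`; maximality puts it into `C`, and it differs from `R₁`, so into `C′`. For `W′`
    -- start from `C′`; its coherence with `R₂` is the same statement with the shared beginning
    -- replaced.
    hybrids : ∀ {C C′ R₁ R₂} → Swap C C′ R₁ R₂ → (λ′ : LastPlace R₁ R₂) → Hybrids C C′ (LastPlace.pl λ′)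
    hybrids {C} {C′} {R₁} {R₂} σ λ′ = record { W∈C = W∈C ; W∈C′ = W∈C′ ; W′∈C = W′∈C ; W′∈C′ = W′∈C′ }
      where
      open Swap σ
      open LastPlace λ′
      module M = MaxClique C-max
      module M′ = MaxClique C′-max
      module X = Exchange inL outL
      eq₁ = Zipper.eq zip
      eq₂ = Zipper.eq zip′
      not-◁ : ∀ {S} → S ∈ C → S ∈ C′ → S ◁ (p ʳ++ q) ⊎ S ◁ (p′ ʳ++ q′) → ⊥
      not-◁ S∈ S∈′ (inj₁ h) = M.coh S∈ R₁∈ (subst (_ ◁_) (sym eq₁) h)
      not-◁ S∈ S∈′ (inj₂ h) = M′.coh S∈′ R₂∈ (subst (_ ◁_) (sym eq₂) h)
      not-▷ : ∀ {S} → S ∈ C → S ∈ C′ → (p ʳ++ q) ◁ S ⊎ (p′ ʳ++ q′) ◁ S → ⊥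
      not-▷ S∈ S∈′ (inj₁ h) = M.coh R₁∈ S∈ (subst (_◁ _) (sym eq₁) h)
      not-▷ S∈ S∈′ (inj₂ h) = M′.coh R₂∈ S∈′ (subst (_◁ _) (sym eq₂) h)
      q≢q′ : q ≢ q′
      q≢q′ refl = ≺O-irr outL
      cancel : ∀ r {a b : Path} → r ʳ++ a ≡ r ʳ++ b → a ≡ b
      cancel r {a} {b} e = ++-cancelˡ (reverse r) a b (trans (sym (ʳ++-defn r)) (trans e (ʳ++-defn r)))
      W∈C : W ∈ C
      W∈C = M.max (zipper-route (zipper-mix zip zip′)) (below , above)
        where
        below : ∀ {S} → S ∈ C → ¬ S ◁ W
        below S∈ h with C⊆ S∈
        ... | inj₁ refl = R-W (subst (_◁ W) eq₁ h)
        ... | inj₂ S∈′ = not-◁ S∈ S∈′ (X.◁-left h)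
        above : ∀ {S} → S ∈ C → ¬ W ◁ S
        above S∈ h with C⊆ S∈
        ... | inj₁ refl = W-R (subst (W ◁_) eq₁ h)
        ... | inj₂ S∈′ = not-▷ S∈ S∈′ (X.left-◁ h)
      W∈C′ : W ∈ C′
      W∈C′ with C⊆ W∈C
      ... | inj₁ W≡R₁ = ⊥-elim (q≢q′ (sym (cancel p (trans W≡R₁ eq₁))))
      ... | inj₂ h = h
      W′∈C′ : W′ ∈ C′
      W′∈C′ = M′.max (zipper-route (zipper-mix zip′ zip)) (below , above)
        where
        below : ∀ {S} → S ∈ C′ → ¬ S ◁ W′
        below S∈ h with C′⊆ S∈
        ... | inj₁ refl = W-R (share-left-transfer p′ p q′ q (Zipper.bp zip′) (Zipper.ch zip′) (Zipper.ch zip)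
                            (subst (_◁ W′) eq₂ h))
        ... | inj₂ S∈C = not-◁ S∈C S∈ (X.◁-right h)
        above : ∀ {S} → S ∈ C′ → ¬ W′ ◁ S
        above S∈ h with C′⊆ S∈
        ... | inj₁ refl = R-W (share-left-transfer p′ p q q′ (Zipper.bp zip′) (Zipper.ch zip) (Zipper.ch zip′)
                            (subst (W′ ◁_) eq₂ h))
        ... | inj₂ S∈C = not-▷ S∈C S∈ (X.right-◁ h)
      W′∈C : W′ ∈ C
      W′∈C with C′⊆ W′∈C′
      ... | inj₁ W′≡R₂ = ⊥-elim (q≢q′ (cancel p′ (trans W′≡R₂ eq₂)))
      ... | inj₂ h = h

    -- If W is coherent with both routes, all their incoherences sit on the common part through v.
    module SinglePlace {R₁ R₂} (π : Place R₁ R₂)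
        (W-R₁ : ¬ Place.W π ◁ R₁) (R₁-W : ¬ R₁ ◁ Place.W π) (W-R₂ : ¬ Place.W π ◁ R₂) (R₂-W : ¬ R₂ ◁ Place.W π) where
      open Place π

      not-reversed : ¬ Place R₂ R₁
      not-reversed (place-at {w} {a′} {b′} {a} {b} z₂ z₁ l m)
        with split-locate p q a b (Zipper.bp zip) (Zipper.bp z₁) (trans (sym (Zipper.eq zip)) (Zipper.eq z₁))
           | split-locate p′ q′ a′ b′ (Zipper.bp zip′) (Zipper.bp z₂) (trans (sym (Zipper.eq zip′)) (Zipper.eq z₂))
      ... | inj₁ (le , _) | inj₂ (lt , _) = ℕₚ.<⇒≱ lt le
      ... | inj₂ (lt , _) | inj₁ (le , _) = ℕₚ.<⇒≱ lt le
      ... | inj₂ (_ , c , refl , refl , bc) | inj₂ (_ , c′ , refl , refl , bc′) with ≺I-tri c c′ bc bc′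
      ...   | inj₁ g = ≺I-asym l (lex-++ p p′ g)
      ...   | inj₂ (inj₁ refl) = ≺I-asym l (lex-prepend c inL)
      ...   | inj₂ (inj₂ g) = W-R₁ (place (c′ ++ p) b′ (c ++ p) b (sym (++-ʳ++ c′)) (Zipper.eq z₁) (lex-++ p p g) m)
      not-reversed (place-at {w} {a′} {b′} {a} {b} z₂ z₁ l m)
        | inj₁ (_ , c , refl , refl , bc) | inj₁ (_ , c′ , refl , refl , bc′) with lex-ʳsplitˡ c m
      ...   | inj₁ g = R₂-W (place a′ b′ a (c ʳ++ q′) (Zipper.eq z₂) (++-ʳ++ c) l (g q′))
      ...   | inj₂ (r , e , _) with split-unique c′ q′ c r bc′ bc e
      ...     | refl , _ = ≺O-asym m (lex-ʳprepend c outL)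

      common : (π′ : Place R₁ R₂) →
        (∃ λ c → Place.p π′ ≡ c ++ p × Place.p′ π′ ≡ c ++ p′ × q ≡ c ʳ++ Place.q π′ × q′ ≡ c ʳ++ Place.q′ π′) ⊎
        (∃ λ c → p ≡ c ++ Place.p π′ × p′ ≡ c ++ Place.p′ π′ × Place.q π′ ≡ c ʳ++ q × Place.q′ π′ ≡ c ʳ++ q′)
      common (place-at {w} {a} {b} {a′} {b′} z₁ z₂ l m)
        with split-locate p q a b (Zipper.bp zip) (Zipper.bp z₁) (trans (sym (Zipper.eq zip)) (Zipper.eq z₁))
           | split-locate p′ q′ a′ b′ (Zipper.bp zip′) (Zipper.bp z₂) (trans (sym (Zipper.eq zip′)) (Zipper.eq z₂))
      ... | inj₁ (le , _) | inj₂ (lt , _) = ⊥-elim (ℕₚ.<⇒≱ lt le)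
      ... | inj₂ (lt , _) | inj₁ (le , _) = ⊥-elim (ℕₚ.<⇒≱ lt le)
      ... | inj₂ (_ , c , refl , refl , bc) | inj₂ (_ , c′ , refl , refl , bc′) with ≺I-tri c c′ bc bc′
      ...   | inj₁ g = ⊥-elim (R₁-W (place (c ++ p) b (c′ ++ p) b′ (Zipper.eq z₁) (sym (++-ʳ++ c′)) (lex-++ p p g) m))
      ...   | inj₂ (inj₁ refl) = inj₁ (c , refl , refl , refl , refl)
      ...   | inj₂ (inj₂ g) = ⊥-elim (≺I-asym l (lex-++ p′ p g))
      common (place-at {w} {a} {b} {a′} {b′} z₁ z₂ l m)
        | inj₁ (_ , c , refl , refl , bc) | inj₁ (_ , c′ , refl , refl , bc′) with lex-ʳsplitʳ c m
      ...   | inj₁ g = ⊥-elim (W-R₂ (place a (c ʳ++ q′) a′ b′ (++-ʳ++ c) (Zipper.eq z₂) l (g q′)))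
      ...   | inj₂ (r , e , _) with split-unique c′ q′ c r bc′ bc e
      ...     | refl , _ = inj₂ (c , refl , refl , refl , refl)

    -- In a cover C ≺ C′ only R₁ leaves C: another S leaving C with R₁ would, together with R₂,
    -- produce a route strictly between.
    module OnlyRoute {C C′ R₁ R₂} (mC : MaxClique C) (mC′ : MaxClique C′)
        (C≼C′ : ∀ {R R′} → R ∈ C → R′ ∈ C′ → ¬ R′ ◁ R)
        (gap : ∀ {S E} → S ∈ C → S ∉ C′ → IsRoute E → (∀ {R′} → R′ ∈ C′ → ¬ R′ ◁ E) → ¬ S ◁ E →
               ∀ {R} → R ∈ C → ¬ R ◁ E)
        (R₁∈ : R₁ ∈ C) (R₂∈ : R₂ ∈ C′) (π : Place R₁ R₂) (hy : Hybrids C C′ π) where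
      open Place π
      open Hybrids hy
      private
        module M = MaxClique mC
        module M′ = MaxClique mC′
        eq₁ = Zipper.eq zip
        eq₂ = Zipper.eq zip′

      only : ∀ {S} → S ∈ C → S ∉ C′ → S ◁ R₂ → S ≡ R₁
      only {S} S∈ S∉ h with localizeʳ p′ q′ p q (subst (S ◁_) eq₂ h)
      ... | inj₁ h′ = ⊥-elim (M.coh S∈ W∈C h′)
      ... | inj₂ (inj₁ h′) = ⊥-elim (M.coh S∈ W′∈C h′)
      ... | inj₂ (inj₂ (z , r , refl , l , m)) with route-zipper z (M.route S∈) refl
      ... | v′ , zS with ≺I-same-end l (Zipper.bp zS) (Zipper.bp zip′)
      ... | refl with ≺I-tri z p (Zipper.bp zS) (Zipper.bp zip)
                    | ≺O-tri r q (Zipper.ch zS) (Zipper.en zS) (Zipper.ch zip) (Zipper.en zip)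
      ... | inj₁ z≺p | _ = ⊥-elim (M.coh S∈ W∈C (place z r p q′ refl refl z≺p m))
      ... | inj₂ _ | inj₂ (inj₂ q≺r) = ⊥-elim (M.coh S∈ W′∈C (place z r p′ q refl refl l q≺r))
      ... | inj₂ (inj₁ refl) | inj₂ (inj₁ refl) = sym eq₁
      ... | inj₂ (inj₂ p≺z) | inj₁ r≺q = ⊥-elim (M.coh R₁∈ S∈ (place p q z r eq₁ refl p≺z r≺q))
      -- The route strictly between is `p′ ʳ++ r`: nothing of `C′` is below it, nor is `S`, but `R₁`
      -- is, which `gap` forbids.
      ... | inj₂ (inj₁ refl) | inj₁ r≺q = ⊥-elim
            (gap S∈ S∉ (zipper-route (zipper-mix zip′ zS)) noC′
              (λ k → M.coh R₁∈ W′∈C (subst (_◁ W′) (sym eq₁)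
                (share-right-transfer p p′ r q (Zipper.bp zip) (Zipper.bp zip′) (Zipper.ch zS) k)))
              R₁∈ (place p q p′ r eq₁ refl l r≺q))
            where
            noC′ : ∀ {R′} → R′ ∈ C′ → ¬ R′ ◁ (p′ ʳ++ r)
            noC′ R′∈ k with Exchange.◁-right l m k
            ... | inj₁ k′ = C≼C′ S∈ R′∈ k′
            ... | inj₂ k′ = M′.coh R′∈ R₂∈ (subst (_ ◁_) (sym eq₂) k′)
      ... | inj₂ (inj₂ p≺z) | inj₂ (inj₁ refl) = ⊥-elim
            (gap S∈ S∉ (zipper-route (zipper-mix zS zip′)) noC′
              (λ k → M.coh R₁∈ W∈C (subst (_◁ W) (sym eq₁)
                (share-left-transfer z p q q′ (Zipper.bp zS) (Zipper.ch zip) (Zipper.ch zip′) k)))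
              R₁∈ (place p q z q′ eq₁ refl p≺z m))
            where
            noC′ : ∀ {R′} → R′ ∈ C′ → ¬ R′ ◁ (z ʳ++ q′)
            noC′ R′∈ k with Exchange.◁-left l m k
            ... | inj₁ k′ = C≼C′ S∈ R′∈ k′
            ... | inj₂ k′ = M′.coh R′∈ R₂∈ (subst (_ ◁_) (sym eq₂) k′)

  open Orders framing-orders
  open Oriented framing-orders
  module Dual = Oriented (dual framing-orders)

  -- Comparison with the definitions by prefixes and suffixes

  upTo-skip : ∀ {a u v} p X → BackPath a u p → toℕ u ℕ.< toℕ v → upTo v (p ʳ++ X) ≡ p ʳ++ upTo v X
  upTo-skip [] X bp lt = refl
  upTo-skip {v = v} (e ∷ p) X (refl , bp) lt
    with upTo-skip p (e ∷ X) bp (ℕₚ.<-trans (src<tgt e) lt)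
  ... | ih with tgt e ≟ v
  ...   | yes refl = ⊥-elim (ℕₚ.<-irrefl refl lt)
  ...   | no _ = ih

  from-skip : ∀ {a u v} p X → BackPath a u p → toℕ u ℕ.< toℕ v → from v (p ʳ++ X) ≡ from v X
  from-skip [] X bp lt = refl
  from-skip {v = v} (e ∷ p) X (refl , bp) lt
    with from-skip p (e ∷ X) bp (ℕₚ.<-trans (src<tgt e) lt)
  ... | ih with tgt e ≟ v
  ...   | yes refl = ⊥-elim (ℕₚ.<-irrefl refl lt)
  ...   | no _ = ih

  upTo-zipper : ∀ {a v} e p q → BackPath a v (e ∷ p) → upTo v ((e ∷ p) ʳ++ q) ≡ reverse (e ∷ p)
  upTo-zipper {v = v} e p q (refl , bp) with upTo-skip {v = v} p (e ∷ q) bp (src<tgt e)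
  ... | ih with tgt e ≟ tgt e
  ...   | yes _ = ih
  ...   | no ne = ⊥-elim (ne refl)

  from-zipper : ∀ {a v} e p q → BackPath a v (e ∷ p) → from v ((e ∷ p) ʳ++ q) ≡ q
  from-zipper {v = v} e p q (refl , bp) with from-skip {v = v} p (e ∷ q) bp (src<tgt e)
  ... | ih with tgt e ≟ tgt e
  ...   | yes _ = ih
  ...   | no ne = ⊥-elim (ne refl)

  ltIn⇒≺I : ∀ {a v} p p′ → BackPath a v p → BackPath a v p′ → ltIn p p′ → p ≺I p′
  ltIn⇒≺I (e ∷ p) (f ∷ p′) (eq , bp) (eq′ , bp′) l with e ≟ f
  ... | yes refl = there (ltIn⇒≺I p p′ bp bp′ l)
  ... | no _ = here (trans eq (sym eq′) , l)

  ≺I⇒ltIn : ∀ {p p′} → p ≺I p′ → ltIn p p′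
  ≺I⇒ltIn (here {x} {y} l) with x ≟ y
  ... | yes refl = ⊥-elim (ℕₚ.<-irrefl refl (proj₂ l))
  ... | no _ = proj₂ l
  ≺I⇒ltIn (there {x} l) with x ≟ x
  ... | yes _ = ≺I⇒ltIn l
  ... | no ne = ⊥-elim (ne refl)

  ltOut⇒≺O : ∀ {v} q q′ → Chain v q → Chain v q′ → ltOut q q′ → q ≺O q′
  ltOut⇒≺O (e ∷ q) (f ∷ q′) (eq , ch) (eq′ , ch′) l with e ≟ f
  ... | yes refl = there (ltOut⇒≺O q q′ ch ch′ l)
  ... | no _ = here (trans eq (sym eq′) , l)

  ≺O⇒ltOut : ∀ {q q′} → q ≺O q′ → ltOut q q′
  ≺O⇒ltOut (here {x} {y} l) with x ≟ y
  ... | yes refl = ⊥-elim (ℕₚ.<-irrefl refl (proj₂ l))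
  ... | no _ = proj₂ l
  ≺O⇒ltOut (there {x} l) with x ≟ x
  ... | yes _ = ≺O⇒ltOut l
  ... | no ne = ⊥-elim (ne refl)

  inner-split : ∀ {v u acc} K → BackPath s u acc → Chain u K → v ∈ innerVerts K →
    ∃₂ λ c q → ∃₂ λ e p → c ʳ++ acc ≡ e ∷ p × K ≡ c ++ q × BackPath s v (e ∷ p)
  inner-split (e ∷ f ∷ K) bp (refl , ch) (here refl) = e ∷ [] , f ∷ K , e , _ , refl , refl , (refl , bp)
  inner-split (e ∷ f ∷ K) bp (refl , ch) (there v∈) with inner-split (f ∷ K) (refl , bp) ch v∈
  ... | c , q , e′ , p , eq , eq′ , bp′ = e ∷ c , q , e′ , p , eq , cong (e ∷_) eq′ , bp′

  inner-zipper : ∀ {R v} → IsRoute R → Inner v R → ∃₂ λ e p → ∃ λ q → Zipper R v (e ∷ p) q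
  inner-zipper {R} rt v∈ with inner-split R refl (proj₁ rt) v∈
  ... | c , q , e , p , eq , eq′ , bp
      with route-zipper (e ∷ p) {q} rt (trans eq′ (trans (sym (reverse-ʳ++-reverse c q)) (cong (_ʳ++ q) eq)))
  ... | v′ , z with back-end (e ∷ p) bp (Zipper.bp z)
  ... | refl = e , p , q , z

  zipper-inner : ∀ {R v e p f q} → Zipper R v (e ∷ p) (f ∷ q) → Inner v R
  zipper-inner {e = e} {p} (zipper refl (refl , _) _ _) = skip p (here refl)
    where
    cons : ∀ {v : V} a X → v ∈ innerVerts X → v ∈ innerVerts (a ∷ X)
    cons a (x ∷ y ∷ X) v∈ = there v∈
    skip : ∀ {v : V} p {X} → v ∈ innerVerts X → v ∈ innerVerts (p ʳ++ X)
    skip [] v∈ = v∈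
    skip (a ∷ p) {X} v∈ = skip p (cons a X v∈)

  zipper-upTo : ∀ {R v e p q} → Zipper R v (e ∷ p) q → reverse (upTo v R) ≡ e ∷ p
  zipper-upTo {e = e} {p} {q} (zipper refl bp _ _) =
    trans (cong reverse (upTo-zipper e p q bp)) (reverse-involutive (e ∷ p))

  zipper-from : ∀ {R v e p q} → Zipper R v (e ∷ p) q → from v R ≡ q
  zipper-from {e = e} {p} {q} (zipper refl bp _ _) = from-zipper e p q bp

  CW⇒Place : ∀ {P Q v} → IsRoute P → IsRoute Q → CW P Q v → ∃ λ (π : Place P Q) → Place.v π ≡ v
  CW⇒Place rP rQ (inP , inQ , l , m) with inner-zipper rP inP | inner-zipper rQ inQ
  ... | e , p , q , z | e′ , p′ , q′ , z′ = place-at z z′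
        (ltIn⇒≺I (e ∷ p) (e′ ∷ p′) (Zipper.bp z) (Zipper.bp z′) (subst₂ ltIn (zipper-upTo z) (zipper-upTo z′) l))
        (ltOut⇒≺O q′ q (Zipper.ch z′) (Zipper.ch z) (subst₂ ltOut (zipper-from z′) (zipper-from z) m)) , refl

  -- A comparison in `Lex` needs a letter on either side, so the marked vertex has edges before and
  -- after it on both routes; this makes it inner.
  Place⇒CW : ∀ {P Q} (π : Place P Q) → CW P Q (Place.v π)
  Place⇒CW (place-at {v} {p} {q} {p′} {q′} z z′ l m)
    with lex-nonemptyˡ l | lex-nonemptyʳ l | lex-nonemptyˡ m | lex-nonemptyʳ m
  ... | _ , _ , refl | _ , _ , refl | _ , _ , refl | _ , _ , refl =
        zipper-inner z , zipper-inner z′ ,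
        subst₂ ltIn (sym (zipper-upTo z)) (sym (zipper-upTo z′)) (≺I⇒ltIn l) ,
        subst₂ ltOut (sym (zipper-from z′)) (sym (zipper-from z)) (≺O⇒ltOut m)

  coherent⇒ : ∀ {P Q} → IsRoute P → IsRoute Q → Coherent P Q → ¬ P ◁ Q × ¬ Q ◁ P
  coherent⇒ rP rQ co =
    (λ h → co _ (inj₁ (Place⇒CW (place-zip rP rQ h)))) , (λ h → co _ (inj₂ (Place⇒CW (place-zip rQ rP h))))

  coherent⇐ : ∀ {P Q} → IsRoute P → IsRoute Q → ¬ P ◁ Q → ¬ Q ◁ P → Coherent P Q
  coherent⇐ rP rQ ¬h ¬k v (inj₁ cw) = ¬h (place-◁ (proj₁ (CW⇒Place rP rQ cw)))
  coherent⇐ rP rQ ¬h ¬k v (inj₂ cw) = ¬k (place-◁ (proj₁ (CW⇒Place rQ rP cw)))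

  maxClique : (x : MC) → MaxClique (proj₁ x)
  maxClique (C , rt , co , mx) = record
    { route = rt _
    ; coh = λ D∈ U∈ → proj₁ (coherent⇒ (rt _ D∈) (rt _ U∈) (co _ _ D∈ U∈))
    ; max = λ {R} r bet → mx R r λ P P∈ → coherent⇐ r (rt P P∈) (proj₂ bet P∈) (proj₁ bet P∈) }

  toMC : ∀ {C} → MaxClique C → MC
  toMC {C} mc = C , (λ R → route) , (λ P Q P∈ Q∈ → coherent⇐ (route P∈) (route Q∈) (coh P∈ Q∈) (coh Q∈ P∈)) ,
    λ R r co → max r ((λ P∈ → proj₂ (coherent⇒ r (route P∈) (co _ P∈))) , (λ P∈ → proj₁ (coherent⇒ r (route P∈) (co _ P∈))))
    where open MaxClique mc

  -- The lattice of maximal cliques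

  to-dual : ∀ {K L} → K ◁ L → L Dual.◁ K
  to-dual (place p q p′ q′ e e′ l m) = Dual.place p′ q′ p q e′ e (lex-flip l) (lex-flip m)

  from-dual : ∀ {K L} → K Dual.◁ L → L ◁ K
  from-dual (Dual.place p q p′ q′ e e′ l m) = place p′ q′ p q e′ e (lex-unflip l) (lex-unflip m)

  dual-clique : ∀ {C} → MaxClique C → Dual.MaxClique C
  dual-clique mc = record
    { route = route
    ; coh = λ D∈ U∈ h → coh U∈ D∈ (from-dual h)
    ; max = λ r bet → max r ((λ P∈ h → proj₂ bet P∈ (to-dual h)) , (λ P∈ h → proj₁ bet P∈ (to-dual h))) }
    where open MaxClique mc

  infix 4 _≼_ _≈?_

  -- The lattice of maximal cliques as a concept lattice: for any set 𝒟 of routes, the routes with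
  -- nothing of 𝒟 below them, and below nothing of that kind, form a maximal clique.
  module Concept (𝒟 : List Path) (𝒟-routes : ∀ {D} → D ∈ 𝒟 → IsRoute D) where
    abstract
      𝒰 M : List Path
      𝒰 = filter (λ U → ¬? (any? (_◁? U) 𝒟)) routes
      M = filter (λ R → ¬? (any? (R ◁?_) 𝒰)) 𝒰

      ∈𝒰 : ∀ {E} → IsRoute E → (∀ {D} → D ∈ 𝒟 → ¬ D ◁ E) → E ∈ 𝒰
      ∈𝒰 r none = ∈-filter⁺ _ (routes-complete r) (λ any → case find any of λ { (D , D∈ , h) → none D∈ h })

      𝒰-route : ∀ {U} → U ∈ 𝒰 → IsRoute U
      𝒰-route U∈ = routes-sound (proj₁ (∈-filter⁻ _ {xs = routes} U∈))

      separated : Separated 𝒟 𝒰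
      separated D∈ U∈ h = proj₂ (∈-filter⁻ (λ U → ¬? (any? (_◁? U) 𝒟)) {xs = routes} U∈) (lose D∈ h)

      M⊆𝒰 : ∀ {R} → R ∈ M → R ∈ 𝒰
      M⊆𝒰 R∈ = proj₁ (∈-filter⁻ _ {xs = 𝒰} R∈)

      M-below-𝒰 : ∀ {R U} → R ∈ M → U ∈ 𝒰 → ¬ R ◁ U
      M-below-𝒰 R∈ U∈ h = proj₂ (∈-filter⁻ (λ R → ¬? (any? (R ◁?_) 𝒰)) {xs = 𝒰} R∈) (lose U∈ h)

      ∈M : ∀ {R} → R ∈ 𝒰 → (∀ {U} → U ∈ 𝒰 → ¬ R ◁ U) → R ∈ M
      ∈M R∈ none = ∈-filter⁺ _ R∈ (λ any → case find any of λ { (U , U∈ , h) → none U∈ h })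

      M-between : ∀ {R} → IsRoute R → Between 𝒟 𝒰 R → R ∈ M
      M-between r (noD , noU) = ∈M (∈𝒰 r noD) noU

      -- `M` determines `𝒰`: a member of `𝒟` below `E` climbs to a member of `M` below `E`.
      above-M⇒𝒰 : ∀ {E} → IsRoute E → (∀ {R} → R ∈ M → ¬ R ◁ E) → E ∈ 𝒰
      above-M⇒𝒰 r none = ∈𝒰 r λ D∈ h → case Climb.climb 𝒟 𝒰 separated 𝒟-routes D∈ h of λ
        { (Q , rQ , bet , Q◁E) → none (M-between rQ bet) Q◁E }

      M-max : MaxClique M
      M-max = record
        { route = λ R∈ → 𝒰-route (M⊆𝒰 R∈)
        ; coh = λ R∈ R′∈ → M-below-𝒰 R∈ (M⊆𝒰 R′∈)
        -- The remaining condition is reached by climbing in the dual framing, from a member of `𝒰`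
        -- above `R` to a member of `M` above `R`.
        ; max = λ r (noL , noR) → ∈M (above-M⇒𝒰 r noL) λ U∈ h →
            case Dual.Climb.climb 𝒰 𝒟 (λ U∈′ D∈ k → separated D∈ U∈′ (from-dual k)) 𝒰-route U∈ (to-dual h) of λ
              { (Q , rQ , (noU , noD) , Q▷R) →
                  noR (M-between rQ ((λ D∈ k → noD D∈ (to-dual k)) , (λ U∈′ k → noU U∈′ (to-dual k)))) (from-dual Q▷R) } }

      -- When `𝒟` collects the routes of some cliques, this is their greatest lower bound, by
      -- `≼-meet` and `meet-≼-⊆`.
      meet : MC
      meet = toMC M-max

      meet⊆𝒰 : ∀ {R} → R ∈ proj₁ meet → R ∈ 𝒰
      meet⊆𝒰 = M⊆𝒰

      meet-below-𝒰 : ∀ {R U} → R ∈ proj₁ meet → U ∈ 𝒰 → ¬ R ◁ U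
      meet-below-𝒰 = M-below-𝒰

      above-meet⇒𝒰 : ∀ {E} → IsRoute E → (∀ {R} → R ∈ proj₁ meet → ¬ R ◁ E) → E ∈ 𝒰
      above-meet⇒𝒰 = above-M⇒𝒰

  module _ (x : MC) where
    ⟦_⟧ : List Path
    ⟦_⟧ = proj₁ x

    clique : MaxClique ⟦_⟧
    clique = maxClique x

    -- The two halves of the concept `x`, taken over all paths and not only routes; `above` grows
    -- with `x` and `below` shrinks.
    above below : Path → Set
    above K = ∀ {R} → R ∈ ⟦_⟧ → ¬ R ◁ K
    below K = ∀ {R} → R ∈ ⟦_⟧ → ¬ K ◁ R

    ∈-clique : ∀ {R} → IsRoute R → above R → below R → R ∈ ⟦_⟧
    ∈-clique r a b = MaxClique.max clique r (a , b)

    clique-above : ∀ {R} → R ∈ ⟦_⟧ → above R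
    clique-above R∈ S∈ = MaxClique.coh clique S∈ R∈

    clique-below : ∀ {R} → R ∈ ⟦_⟧ → below R
    clique-below R∈ S∈ = MaxClique.coh clique R∈ S∈

    clique-route : ∀ {R} → R ∈ ⟦_⟧ → IsRoute R
    clique-route = MaxClique.route clique

    below-above : ∀ {a A B} → Chain a A → below A → above B → ¬ A ◁ B
    below-above ch b a = below-not-◁-above clique ch b a

  -- The concept order: the routes of `x` lie in `above y`. It agrees with `_≤_` by `≤⇒≼` and `≼⇒≤`.
  _≼_ : MC → MC → Set
  x ≼ y = ∀ {R R′} → R ∈ ⟦ x ⟧ → R′ ∈ ⟦ y ⟧ → ¬ R′ ◁ R

  ≈-refl : ∀ {x} → x ≈ x
  ≈-refl R = (λ r → r) , (λ r → r)

  ≈-sym : ∀ {x y} → x ≈ y → y ≈ x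
  ≈-sym eq R = proj₂ (eq R) , proj₁ (eq R)

  ≈-trans : ∀ {x y z} → x ≈ y → y ≈ z → x ≈ z
  ≈-trans e f R = proj₁ (f R) ∘ proj₁ (e R) , proj₂ (e R) ∘ proj₂ (f R)

  ≈⇒≼ : ∀ {x y} → x ≈ y → x ≼ y
  ≈⇒≼ {x} {y} eq R∈ R′∈ = MaxClique.coh (clique x) (proj₂ (eq _) R′∈) R∈

  -- `y` separates: a route of `z` lies in `below y`, a route of `x` in `above y`, and `below-above`
  -- excludes `◁` between such paths.
  ≼-trans : ∀ {x y z} → x ≼ y → y ≼ z → x ≼ z
  ≼-trans {x} {y} {z} xy yz R∈ R″∈ = below-above y (proj₁ (clique-route z R″∈)) (λ S∈ → yz S∈ R″∈) (λ S∈ → xy R∈ S∈)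

  ≼-antisym : ∀ {x y} → x ≼ y → y ≼ x → x ≈ y
  ≼-antisym {x} {y} xy yx R =
    (λ R∈ → ∈-clique y (clique-route x R∈) (λ S∈ → xy R∈ S∈) (λ S∈ → yx S∈ R∈)) ,
    (λ R∈ → ∈-clique x (clique-route y R∈) (λ S∈ → yx R∈ S∈) (λ S∈ → xy S∈ R∈))

  subset? : (xs ys : List Path) → Dec (∀ R → R ∈ xs → R ∈ ys)
  subset? xs ys = map′ (λ a R R∈ → lookup a R∈) (λ f → tabulate (f _)) (all? (_∈? ys) xs)

  _≈?_ : ∀ x y → Dec (x ≈ y)
  x ≈? y = map′ (λ { (f , g) R → f R , g R }) (λ e → (proj₁ ∘ e) , (proj₂ ∘ e))
             (subset? ⟦ x ⟧ ⟦ y ⟧ ×-dec subset? ⟦ y ⟧ ⟦ x ⟧)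

  -- Inclusion of one maximal clique in another already forces equality.
  missing : ∀ x y → ¬ x ≈ y → ∃ λ R → R ∈ ⟦ x ⟧ × R ∉ ⟦ y ⟧
  missing x y ne with any? (λ R → ¬? (R ∈? ⟦ y ⟧)) ⟦ x ⟧
  ... | yes a = find a
  ... | no ¬a = ⊥-elim (ne λ R → x⊆y , λ R∈ → ∈-clique x (clique-route y R∈)
                  (λ S∈ → clique-above y R∈ (x⊆y S∈)) (λ S∈ → clique-below y R∈ (x⊆y S∈)))
    where
    x⊆y : ∀ {R} → R ∈ ⟦ x ⟧ → R ∈ ⟦ y ⟧
    x⊆y {R} R∈ with R ∈? ⟦ y ⟧
    ... | yes h = h
    ... | no ¬h = ⊥-elim (¬a (lose R∈ ¬h))

  above-mono : ∀ {x y K} → x ≼ y → above x K → above y K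
  above-mono {x} {y} xy a Y∈ = below-above x (proj₁ (clique-route y Y∈)) (λ S∈ → xy S∈ Y∈) a

  below-anti : ∀ {x y a K} → Chain a K → x ≼ y → below y K → below x K
  below-anti {x} {y} ch xy b X∈ = below-above y ch b (λ S∈ → xy X∈ S∈)

  module _ {𝒟 : List Path} (𝒟-routes : ∀ {D} → D ∈ 𝒟 → IsRoute D) where
    open Concept 𝒟 𝒟-routes

    ≼-meet : ∀ {z} → (∀ {D Z} → D ∈ 𝒟 → Z ∈ ⟦ z ⟧ → ¬ D ◁ Z) → z ≼ meet
    ≼-meet {z} none R∈ M∈ = meet-below-𝒰 M∈ (∈𝒰 (clique-route z R∈) (λ D∈ → none D∈ R∈))

    meet-≼ : ∀ {y} → (∀ {Y U} → Y ∈ ⟦ y ⟧ → U ∈ 𝒰 → ¬ Y ◁ U) → meet ≼ y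
    meet-≼ none M∈ Y∈ = none Y∈ (meet⊆𝒰 M∈)

    meet-≼-⊆ : ∀ {y} → (∀ {Y} → Y ∈ ⟦ y ⟧ → Y ∈ 𝒟) → meet ≼ y
    meet-≼-⊆ {y} sub = meet-≼ {y} (λ Y∈ → separated (sub Y∈))

    above-meet⁺ : ∀ {a K} → Chain a K → (∀ {D} → D ∈ 𝒟 → ¬ D ◁ K) → above meet K
    above-meet⁺ {K = K} ch none R∈ h with Greedy.greedy 𝒟 [] (λ _ ()) K ch (none , λ ())
    ... | U , rU , inf , (noU , _) = meet-below-𝒰 R∈ (∈𝒰 rU noU) (◁-infixʳ inf h)

    above-meet⁻ : ∀ {E D} → IsRoute E → above meet E → D ∈ 𝒟 → ¬ D ◁ E
    above-meet⁻ r a D∈ = separated D∈ (above-meet⇒𝒰 r a)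

  -- Flips are covers of the concept order and generate it.

  -- The witness of `Flip` may sit at any incoherent vertex; here it is replaced by a last place,
  -- whose mixed routes belong to both cliques.
  record Flipped (x y : MC) (R₁ R₂ : Path) : Set where
    field
      swap : Swap ⟦ x ⟧ ⟦ y ⟧ R₁ R₂
      last : LastPlace R₁ R₂
      hybrid : Hybrids ⟦ x ⟧ ⟦ y ⟧ (LastPlace.pl last)

    open Swap swap public
    open Hybrids hybrid public

    module Single = SinglePlace (LastPlace.pl last)
      (λ h → clique-below x W∈C R₁∈ h) (λ h → clique-above x W∈C R₁∈ h)
      (λ h → clique-below y W∈C′ R₂∈ h) (λ h → clique-above y W∈C′ R₂∈ h)

    R₁◁R₂ : R₁ ◁ R₂
    R₁◁R₂ = place-◁ (LastPlace.pl last)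

    R₁∉ : R₁ ∉ ⟦ y ⟧
    R₁∉ R₁∈y = clique-below y R₁∈y R₂∈ R₁◁R₂

    R₂∉ : R₂ ∉ ⟦ x ⟧
    R₂∉ R₂∈x = clique-below x R₁∈ R₂∈x R₁◁R₂

    lower-≼-upper : x ≼ y
    lower-≼-upper R∈ R′∈ h with C⊆ R∈
    ... | inj₂ R∈y = clique-below y R′∈ R∈y h
    ... | inj₁ refl with C′⊆ R′∈
    ...   | inj₂ R′∈x = clique-below x R′∈x R∈ h
    ...   | inj₁ refl = Single.not-reversed (place-zip (clique-route y R′∈) (clique-route x R∈) h)

    upper-⋠-lower : ¬ y ≼ x
    upper-⋠-lower yx = yx R₂∈ R₁∈ R₁◁R₂

  flip-swap : ∀ {x y R₁ R₂} → Flip x y R₁ R₂ → Swap ⟦ x ⟧ ⟦ y ⟧ R₁ R₂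
  flip-swap {x} {y} {R₁} {R₂} (R₁∈ , iff , _) = record
    { C-max = clique x ; C′-max = clique y ; R₁∈ = R₁∈ ; R₂∈ = Equivalence.from (iff R₂) (inj₂ refl)
    ; C⊆ = C⊆ ; C′⊆ = λ {S} S∈ → [ inj₂ ∘ proj₁ , inj₁ ]′ (Equivalence.to (iff S) S∈) }
    where
    C⊆ : ∀ {S} → S ∈ ⟦ x ⟧ → S ≡ R₁ ⊎ S ∈ ⟦ y ⟧
    C⊆ {S} S∈ with S ≟ₚ R₁
    ... | yes eq = inj₁ eq
    ... | no ne = inj₂ (Equivalence.from (iff S) (inj₁ (S∈ , ne)))

  flip⇒flipped : ∀ {x y R₁ R₂} → Flip x y R₁ R₂ → Flipped x y R₁ R₂
  flip⇒flipped {x} {y} {R₁} {R₂} fl@(_ , _ , v , cw) with flip-swap {x} {y} fl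
  ... | σ with proj₁ (CW⇒Place (clique-route x (Swap.R₁∈ σ)) (clique-route y (Swap.R₂∈ σ)) cw)
  ... | π with find-last π
  ... | inj₁ la = record { swap = σ ; last = la ; hybrid = hybrids σ la }
  -- If the last place has the roles exchanged, all incoherences of the two routes point that way,
  -- against the given place `π`.
  ... | inj₂ la = ⊥-elim (SinglePlace.not-reversed (LastPlace.pl la)
          (λ h → clique-below y (H.W∈C) (Swap.R₂∈ σ) h) (λ h → clique-above y H.W∈C (Swap.R₂∈ σ) h)
          (λ h → clique-below x H.W∈C′ (Swap.R₁∈ σ) h) (λ h → clique-above x H.W∈C′ (Swap.R₁∈ σ) h) π)
    where module H = Hybrids (hybrids (swap-sym σ) la)

  ≤⇒≼ : ∀ {x y} → x ≤ y → x ≼ y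
  ≤⇒≼ {x} {y} (≤-≈ eq) = ≈⇒≼ {x} {y} eq
  ≤⇒≼ {x} {z} (≤-step {y = y} (_ , _ , fl) y≤z) =
    ≼-trans {x} {y} {z} (Flipped.lower-≼-upper (flip⇒flipped {x} {y} fl)) (≤⇒≼ y≤z)

  ≤-trans : ∀ {x y z} → x ≤ y → y ≤ z → x ≤ z
  ≤-trans {x} {y} {z} (≤-≈ eq) (≤-≈ eq′) = ≤-≈ (≈-trans {x} {y} {z} eq eq′)
  ≤-trans {x} {y} (≤-≈ eq) (≤-step {y = w} (R₁ , R₂ , R₁∈ , iff , cw) w≤z) =
    ≤-step (R₁ , R₂ , proj₂ (eq R₁) R₁∈ ,
      (λ Q → mk⇔ (λ Q∈ → [ (λ { (Q∈y , ne) → inj₁ (proj₂ (eq Q) Q∈y , ne) }) , inj₂ ]′ (Equivalence.to (iff Q) Q∈))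
                 (λ { (inj₁ (Q∈x , ne)) → Equivalence.from (iff Q) (inj₁ (proj₁ (eq Q) Q∈x , ne))
                    ; (inj₂ e) → Equivalence.from (iff Q) (inj₂ e) })) , cw) w≤z
  ≤-trans (≤-step st a) b = ≤-step st (≤-trans a b)

  -- The hypotheses gap and gap′ hold when nothing lies strictly between x and y.
  module CoverIsFlip {x y : MC} (x≼y : x ≼ y) (x≉y : ¬ x ≈ y)
      (gap : ∀ {S E} → S ∈ ⟦ x ⟧ → S ∉ ⟦ y ⟧ → IsRoute E → above y E → ¬ S ◁ E → above x E)
      (gap′ : ∀ {S E} → S ∈ ⟦ y ⟧ → S ∉ ⟦ x ⟧ → IsRoute E → below x E → ¬ E ◁ S → below y E) where

    -- If `R` were not below `R′`, `gap` would put `R′` into `above x`; being in `below x` already,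
    -- it would belong to `x`.
    all-◁ : ∀ {R R′} → R ∈ ⟦ x ⟧ → R ∉ ⟦ y ⟧ → R′ ∈ ⟦ y ⟧ → R′ ∉ ⟦ x ⟧ → R ◁ R′
    all-◁ {R} {R′} R∈ R∉ R′∈ R′∉ with R ◁? R′
    ... | yes h = h
    ... | no ¬h = ⊥-elim (R′∉ (∈-clique x (clique-route y R′∈)
                    (gap R∈ R∉ (clique-route y R′∈) (clique-above y R′∈) ¬h) (λ S∈ → x≼y S∈ R′∈)))

    -- At a last place `W` lies in `x`. If it also lies in `y`, the place is the one wanted; if not,
    -- `W` takes over from `R`, and since it shares its tail with `R′`, all their places are
    -- strictly further left.
    search : ∀ k {R R′} → R ∈ ⟦ x ⟧ → R ∉ ⟦ y ⟧ → R′ ∈ ⟦ y ⟧ → R′ ∉ ⟦ x ⟧ →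
      (∀ (π : Place R R′) → toℕ (Place.v π) ℕ.< k) →
      ∃ λ R₁ → R₁ ∈ ⟦ x ⟧ × R₁ ∉ ⟦ y ⟧ × ∃ λ (π : Place R₁ R′) → Hybrids ⟦ x ⟧ ⟦ y ⟧ π
    search k {R} {R′} R∈ R∉ R′∈ R′∉ bound
      with find-last (place-zip (clique-route x R∈) (clique-route y R′∈) (all-◁ R∈ R∉ R′∈ R′∉))
    ... | inj₂ la = ⊥-elim (x≼y R∈ R′∈ (place-◁ (LastPlace.pl la)))
    ... | inj₁ la with bound (LastPlace.pl la)
    search zero R∈ R∉ R′∈ R′∉ bound | inj₁ la | ()
    search (suc k) {R} {R′} R∈ R∉ R′∈ R′∉ bound | inj₁ la | lt = decide (W ∈? ⟦ y ⟧)
      where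
      open LastPlace la
      module X = Exchange inL outL
      eq₁ = Zipper.eq zip
      eq₂ = Zipper.eq zip′
      rW = zipper-route (zipper-mix zip zip′)
      rW′ = zipper-route (zipper-mix zip′ zip)
      above-y : ∀ {Y} → Y ∈ ⟦ y ⟧ → Y ◁ (p ʳ++ q) ⊎ Y ◁ (p′ ʳ++ q′) → ⊥
      above-y Y∈ (inj₁ h) = x≼y R∈ Y∈ (subst (_ ◁_) (sym eq₁) h)
      above-y Y∈ (inj₂ h) = clique-below y Y∈ R′∈ (subst (_ ◁_) (sym eq₂) h)
      below-x : ∀ {X} → X ∈ ⟦ x ⟧ → (p ʳ++ q) ◁ X ⊎ (p′ ʳ++ q′) ◁ X → ⊥
      below-x X∈ (inj₁ h) = clique-below x R∈ X∈ (subst (_◁ _) (sym eq₁) h)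
      below-x X∈ (inj₂ h) = x≼y X∈ R′∈ (subst (_◁ _) (sym eq₂) h)
      W∈x : W ∈ ⟦ x ⟧
      W∈x = ∈-clique x rW
        (gap R∈ R∉ rW (λ Y∈ h → above-y Y∈ (X.◁-left h)) (λ h → R-W (subst (_◁ W) eq₁ h)))
        (λ X∈ h → below-x X∈ (X.left-◁ h))
      W′-above-y : above y W′
      W′-above-y Y∈ h = above-y Y∈ (X.◁-right h)
      W′-below-x : below x W′
      W′-below-x X∈ h = below-x X∈ (X.right-◁ h)
      decide : Dec (W ∈ ⟦ y ⟧) → _
      decide (no W∉y) = search k W∈x W∉y R′∈ R′∉ λ π → ℕₚ.<-≤-trans (left-of π) (ℕₚ.≤-pred lt)
        where
        left-of : (π : Place W R′) → toℕ (Place.v π) ℕ.< toℕ v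
        left-of (place-at {p = a} zW zR l m)
          with share-right p p′ q′ (Zipper.bp zip) (Zipper.bp zip′) (Zipper.ch zip′)
                 (place a _ _ _ (Zipper.eq zW) (trans (sym eq₂) (Zipper.eq zR)) l m)
        ... | _ , _ , _ , _ , _ , _ , _ , ba , _ , _ , _ , w<v , refl =
              subst (λ w → toℕ w ℕ.< toℕ v) (back-end a ba (Zipper.bp zW)) w<v
      decide (yes W∈y) = R , R∈ , R∉ , pl , record
        { W∈C = W∈x ; W∈C′ = W∈y
        ; W′∈C = ∈-clique x rW′ (gap R∈ R∉ rW′ W′-above-y
            (λ h → clique-below y W∈y R′∈ (subst (W ◁_) (sym eq₂)
              (share-right-transfer p p′ q q′ (Zipper.bp zip) (Zipper.bp zip′) (Zipper.ch zip)
                (subst (_◁ W′) eq₁ h))))) W′-below-x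
        ; W′∈C′ = ∈-clique y rW′ W′-above-y (gap′ R′∈ R′∉ rW′ W′-below-x
            (λ h → R-W (share-left-transfer p′ p q q′ (Zipper.bp zip′) (Zipper.ch zip) (Zipper.ch zip′)
              (subst (W′ ◁_) eq₂ h)))) }

    dual-place : ∀ {R R′} → Place R R′ → Dual.Place R′ R
    dual-place (place-at z z′ l m) = Dual.place-at z′ z (lex-flip l) (lex-flip m)

    cover-flip : x ⋖ y
    cover-flip with missing x y x≉y | missing y x (x≉y ∘ ≈-sym {y} {x})
    ... | R , R∈ , R∉ | R₂ , R₂∈ , R₂∉ with search n R∈ R∉ R₂∈ R₂∉ (λ π → Finₚ.toℕ<n (Place.v π))
    ... | R₁ , R₁∈ , R₁∉ , π , hy = R₁ , R₂ , R₁∈ , iff , Place.v π , Place⇒CW π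
      where
      open Hybrids hy
      only₁ : ∀ {S} → S ∈ ⟦ x ⟧ → S ∉ ⟦ y ⟧ → S ≡ R₁
      only₁ S∈ S∉ = OnlyRoute.only (clique x) (clique y) x≼y
        (λ S∈ S∉ rE aE ¬SE R∈ → gap S∈ S∉ rE aE ¬SE R∈) R₁∈ R₂∈ π hy S∈ S∉ (all-◁ S∈ S∉ R₂∈ R₂∉)
      only₂ : ∀ {S} → S ∈ ⟦ y ⟧ → S ∉ ⟦ x ⟧ → S ≡ R₂
      only₂ S∈ S∉ = Dual.OnlyRoute.only (dual-clique (clique y)) (dual-clique (clique x))
        (λ R∈ R′∈ h → x≼y R′∈ R∈ (from-dual h))
        (λ S∈ S∉ rE bE ¬ES R∈ h → gap′ S∈ S∉ rE (λ X∈ k → bE X∈ (to-dual k)) (λ k → ¬ES (to-dual k)) R∈ (from-dual h))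
        R₂∈ R₁∈ (dual-place π)
        record { W∈C = W′∈C′ ; W∈C′ = W′∈C ; W′∈C = W∈C′ ; W′∈C′ = W∈C }
        S∈ S∉ (to-dual (all-◁ R₁∈ R₁∉ S∈ S∉))
      iff : ∀ Q → Q ∈ ⟦ y ⟧ ⇔ ((Q ∈ ⟦ x ⟧ × Q ≢ R₁) ⊎ Q ≡ R₂)
      iff Q = mk⇔ forth back
        where
        forth : Q ∈ ⟦ y ⟧ → (Q ∈ ⟦ x ⟧ × Q ≢ R₁) ⊎ Q ≡ R₂
        forth Q∈ with Q ∈? ⟦ x ⟧
        ... | yes Q∈x = inj₁ (Q∈x , λ { refl → R₁∉ Q∈ })
        ... | no Q∉x = inj₂ (only₂ Q∈ Q∉x)
        back : (Q ∈ ⟦ x ⟧ × Q ≢ R₁) ⊎ Q ≡ R₂ → Q ∈ ⟦ y ⟧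
        back (inj₂ refl) = R₂∈
        back (inj₁ (Q∈x , ne)) with Q ∈? ⟦ y ⟧
        ... | yes Q∈ = Q∈
        ... | no Q∉ = ⊥-elim (ne (only₁ Q∈x Q∉))

  count : {P : Path → Set} → (∀ K → Dec (P K)) → List Path → ℕ
  count P? xs = length (filter P? xs)

  count-≤ : {P Q : Path → Set} (P? : ∀ K → Dec (P K)) (Q? : ∀ K → Dec (Q K)) → ∀ xs →
    (∀ {K} → K ∈ xs → P K → Q K) → count P? xs ℕ.≤ count Q? xs
  count-≤ P? Q? [] sub = z≤n
  count-≤ P? Q? (x ∷ xs) sub with P? x | Q? x | count-≤ P? Q? xs (sub ∘ there)
  ... | yes p | yes q | ih = s≤s ih
  ... | yes p | no ¬q | ih = ⊥-elim (¬q (sub (here refl) p))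
  ... | no ¬p | yes q | ih = ℕₚ.m≤n⇒m≤1+n ih
  ... | no ¬p | no ¬q | ih = ih

  count-< : {P Q : Path → Set} (P? : ∀ K → Dec (P K)) (Q? : ∀ K → Dec (Q K)) → ∀ {xs K} →
    (∀ {K} → K ∈ xs → P K → Q K) → K ∈ xs → Q K → ¬ P K → count P? xs ℕ.< count Q? xs
  count-< P? Q? {x ∷ xs} sub (here refl) q ¬p with P? x | Q? x | count-≤ P? Q? xs (sub ∘ there)
  ... | yes p | _ | ih = ⊥-elim (¬p p)
  ... | no _ | yes _ | ih = s≤s ih
  ... | no _ | no ¬q | ih = ⊥-elim (¬q q)
  count-< P? Q? {x ∷ xs} sub (there K∈) q ¬p with P? x | Q? x | count-< P? Q? {xs} (sub ∘ there) K∈ q ¬p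
  ... | yes p | yes _ | ih = s≤s ih
  ... | yes p | no ¬q | ih = ⊥-elim (¬q (sub (here refl) p))
  ... | no _ | yes _ | ih = ℕₚ.m≤n⇒m≤1+n ih
  ... | no _ | no _ | ih = ih

  above? : ∀ x K → Dec (above x K)
  above? x K = map′ (λ ¬a R∈ h → ¬a (lose R∈ h)) (λ a any → case find any of λ { (_ , R∈ , h) → a R∈ h })
    (¬? (any? (_◁? K) ⟦ x ⟧))

  below? : ∀ x K → Dec (below x K)
  below? x K = map′ (λ ¬a R∈ h → ¬a (lose R∈ h)) (λ a any → case find any of λ { (_ , R∈ , h) → a R∈ h })
    (¬? (any? (K ◁?_) ⟦ x ⟧))

  -- Strictly increasing along `_≼_`; it bounds the refinement of intervals.
  size : MC → ℕ
  size x = count (above? x) routes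

  size-< : ∀ {x y} → x ≼ y → ¬ x ≈ y → size x ℕ.< size y
  size-< {x} {y} x≼y x≉y with missing y x (x≉y ∘ ≈-sym {y} {x})
  ... | R , R∈ , R∉ = count-< (above? x) (above? y) (λ _ → above-mono {x} {y} x≼y)
        (routes-complete (clique-route y R∈)) (clique-above y R∈)
        (λ a → R∉ (∈-clique x (clique-route y R∈) a (λ S∈ → x≼y S∈ R∈)))

  -- For `S` in `x`, `low` is the largest element under `y` having `S` in its `below`; for `S` in
  -- `y`, `high S` is the least element over `x` having `S` in its `above`. If none of them is
  -- strictly between `x` and `y`, the equations `low ≈ x` and `high S ≈ y` are the two gap
  -- hypotheses of `CoverIsFlip`.
  module Interval {x y : MC} (x≼y : x ≼ y) where

    𝒟₁ : Path → List Path
    𝒟₁ S = S ∷ ⟦ y ⟧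

    𝒟₁-routes : ∀ {S} → S ∈ ⟦ x ⟧ → ∀ {D} → D ∈ 𝒟₁ S → IsRoute D
    𝒟₁-routes S∈ (here refl) = clique-route x S∈
    𝒟₁-routes S∈ (there D∈) = clique-route y D∈

    low : ∀ {S} → S ∈ ⟦ x ⟧ → MC
    low S∈ = Concept.meet (𝒟₁ _) (𝒟₁-routes S∈)

    x≼low : ∀ {S} (S∈ : S ∈ ⟦ x ⟧) → x ≼ low S∈
    x≼low S∈ = ≼-meet (𝒟₁-routes S∈) {x} λ { (here refl) Z∈ → clique-below x S∈ Z∈ ; (there D∈) Z∈ → x≼y Z∈ D∈ }

    low≼y : ∀ {S} (S∈ : S ∈ ⟦ x ⟧) → low S∈ ≼ y
    low≼y S∈ = meet-≼-⊆ (𝒟₁-routes S∈) {y} there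

    low≉y : ∀ {S} (S∈ : S ∈ ⟦ x ⟧) → S ∉ ⟦ y ⟧ → ¬ low S∈ ≈ y
    low≉y {S} S∈ S∉ eq with below? y S
    ... | yes b = S∉ (∈-clique y (clique-route x S∈) (λ Y∈ → x≼y S∈ Y∈) b)
    ... | no ¬b = ¬b λ Y∈ → above-meet⁻ (𝒟₁-routes S∈) (clique-route y Y∈)
                    (clique-above (low S∈) (proj₂ (eq _) Y∈)) (here refl)

    low-gap : ∀ {S E} (S∈ : S ∈ ⟦ x ⟧) → low S∈ ≈ x → IsRoute E → above y E → ¬ S ◁ E → above x E
    low-gap S∈ eq rE aE ¬SE X∈ = above-meet⁺ (𝒟₁-routes S∈) (proj₁ rE)
      (λ { (here refl) → ¬SE ; (there D∈) → aE D∈ }) (proj₂ (eq _) X∈)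

    𝒟₂ : Path → List Path
    𝒟₂ S = filter (λ D → below? x D ×-dec ¬? (D ◁? S)) routes

    𝒟₂-routes : ∀ {S D} → D ∈ 𝒟₂ S → IsRoute D
    𝒟₂-routes {S} D∈ = routes-sound (proj₁ (∈-filter⁻ (λ D → below? x D ×-dec ¬? (D ◁? S)) {xs = routes} D∈))

    𝒟₂-props : ∀ {S D} → D ∈ 𝒟₂ S → below x D × ¬ D ◁ S
    𝒟₂-props {S} D∈ = proj₂ (∈-filter⁻ (λ D → below? x D ×-dec ¬? (D ◁? S)) {xs = routes} D∈)

    ∈𝒟₂ : ∀ {S D} → IsRoute D → below x D → ¬ D ◁ S → D ∈ 𝒟₂ S
    ∈𝒟₂ {S} rD b ¬h = ∈-filter⁺ (λ D → below? x D ×-dec ¬? (D ◁? S)) (routes-complete rD) ((λ {R} → b {R}) , ¬h)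

    high : Path → MC
    high S = Concept.meet (𝒟₂ S) 𝒟₂-routes

    x≼high : ∀ S → x ≼ high S
    x≼high S = ≼-meet (𝒟₂-routes {S}) {x} λ D∈ Z∈ → proj₁ (𝒟₂-props D∈) Z∈

    high≼y : ∀ {S} → S ∈ ⟦ y ⟧ → high S ≼ y
    high≼y S∈ = meet-≼-⊆ 𝒟₂-routes {y} λ Y∈ → ∈𝒟₂ (clique-route y Y∈) (λ X∈ → x≼y X∈ Y∈) (clique-below y Y∈ S∈)

    high≉x : ∀ {S} → S ∈ ⟦ y ⟧ → S ∉ ⟦ x ⟧ → ¬ high S ≈ x
    high≉x {S} S∈ S∉ eq = S∉ (∈-clique x (clique-route y S∈)
      (λ X∈ → above-meet⁺ (𝒟₂-routes {S}) (proj₁ (clique-route y S∈)) (λ D∈ → proj₂ (𝒟₂-props D∈)) (proj₂ (eq _) X∈))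
      (λ X∈ → x≼y X∈ S∈))

    high-gap : ∀ {S E} → high S ≈ y → IsRoute E → below x E → ¬ E ◁ S → below y E
    high-gap {S} eq rE bE ¬ES {R} R∈ h = Concept.separated (𝒟₂ S) 𝒟₂-routes (∈𝒟₂ rE bE ¬ES)
      (Concept.meet⊆𝒰 (𝒟₂ S) 𝒟₂-routes (proj₂ (eq R) R∈)) h

    -- `low` is built from a membership proof, so `Lows` returns the proof for which the equation
    -- holds.
    Lows Highs : Set
    Lows = ∀ {S} → S ∈ ⟦ x ⟧ → S ∉ ⟦ y ⟧ → Σ (S ∈ ⟦ x ⟧) λ S∈ → low S∈ ≈ x
    Highs = ∀ {S} → S ∈ ⟦ y ⟧ → S ∉ ⟦ x ⟧ → high S ≈ y

    Strictly-between : Set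
    Strictly-between = ∃ λ z → x ≼ z × ¬ x ≈ z × z ≼ y × ¬ z ≈ y

    find-low : ∀ xs → (∀ {S} → S ∈ xs → S ∈ ⟦ x ⟧) →
      Strictly-between ⊎ (∀ {S} → S ∈ xs → S ∉ ⟦ y ⟧ → Σ (S ∈ ⟦ x ⟧) λ S∈ → low S∈ ≈ x)
    find-low [] sub = inj₂ λ ()
    find-low (S ∷ xs) sub = step (S ∈? ⟦ y ⟧) (low S∈ ≈? x) (find-low xs (sub ∘ there))
      where
      S∈ : S ∈ ⟦ x ⟧
      S∈ = sub (here refl)
      step : Dec (S ∈ ⟦ y ⟧) → Dec (low S∈ ≈ x) →
        Strictly-between ⊎ (∀ {S} → S ∈ xs → S ∉ ⟦ y ⟧ → Σ (S ∈ ⟦ x ⟧) λ S∈ → low S∈ ≈ x) →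
        Strictly-between ⊎ (∀ {S′} → S′ ∈ S ∷ xs → S′ ∉ ⟦ y ⟧ → Σ (S′ ∈ ⟦ x ⟧) λ S∈ → low S∈ ≈ x)
      step _ _ (inj₁ r) = inj₁ r
      step (no S∉) (no ne) (inj₂ _) =
        inj₁ (low S∈ , x≼low S∈ , (λ e → ne (≈-sym {x} {low S∈} e)) , low≼y S∈ , low≉y S∈ S∉)
      step (yes S∈y) _ (inj₂ f) = inj₂ λ { (here refl) S∉ → ⊥-elim (S∉ S∈y) ; (there i) → f i }
      step (no _) (yes eq) (inj₂ f) = inj₂ λ { (here refl) _ → S∈ , eq ; (there i) → f i }

    find-high : Strictly-between ⊎ Highs
    find-high = step (any? (λ S → ¬? (S ∈? ⟦ x ⟧) ×-dec ¬? (high S ≈? y)) ⟦ y ⟧)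
      where
      step : Dec (Any (λ S → S ∉ ⟦ x ⟧ × ¬ high S ≈ y) ⟦ y ⟧) → Strictly-between ⊎ Highs
      step (yes a) = let (S , S∈ , S∉ , ne) = find a in
        inj₁ (high S , x≼high S , (λ e → high≉x {S} S∈ S∉ (≈-sym {x} {high S} e)) , high≼y S∈ , ne)
      step (no ¬a) = inj₂ λ {S} S∈ S∉ → decidable-stable (high S ≈? y) λ ne → ¬a (lose S∈ (S∉ , ne))

    between-or-flip : ¬ x ≈ y → Strictly-between ⊎ x ⋖ y
    between-or-flip x≉y = step (find-low ⟦ x ⟧ (λ h → h)) find-high
     where
     step : Strictly-between ⊎ Lows → Strictly-between ⊎ Highs → Strictly-between ⊎ x ⋖ y
     step (inj₁ r) _ = inj₁ r
     step (inj₂ _) (inj₁ r) = inj₁ r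
     step (inj₂ lows) (inj₂ highs) = inj₂ (CoverIsFlip.cover-flip {x} {y} x≼y x≉y
      (λ S∈ S∉ rE aE ¬SE → low-gap (proj₁ (lows S∈ S∉)) (proj₂ (lows S∈ S∉)) rE aE ¬SE)
      (λ {S} S∈ S∉ rE bE ¬ES → high-gap {S} (highs S∈ S∉) rE bE ¬ES))

  -- Bisection: an element strictly between leaves two intervals with a smaller difference of sizes;
  -- without one, the interval is a flip.
  ≼⇒≤′ : ∀ k x y → size y ℕ.≤ size x + k → x ≼ y → x ≤ y
  ≼⇒≤′ k x y le x≼y with x ≈? y
  ... | yes eq = ≤-≈ eq
  ≼⇒≤′ zero x y le x≼y | no x≉y =
    ⊥-elim (ℕₚ.<⇒≱ (size-< {x} {y} x≼y x≉y) (subst (size y ℕ.≤_) (ℕₚ.+-identityʳ _) le))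
  ≼⇒≤′ (suc k) x y le x≼y | no x≉y with Interval.between-or-flip {x} {y} x≼y x≉y
  ... | inj₂ st = ≤-step {x} {y} {y} st (≤-≈ (≈-refl {y}))
  ... | inj₁ (z , x≼z , x≉z , z≼y , z≉y) =
    ≤-trans (≼⇒≤′ k x z (ℕₚ.≤-pred (ℕₚ.≤-trans (size-< {z} {y} z≼y z≉y) le′)) x≼z)
            (≼⇒≤′ k z y (ℕₚ.≤-trans le′ (ℕₚ.+-monoˡ-≤ k (size-< {x} {z} x≼z x≉z))) z≼y)
    where
    le′ : size y ℕ.≤ suc (size x + k)
    le′ = subst (size y ℕ.≤_) (ℕₚ.+-suc (size x) k) le

  ≼⇒≤ : ∀ {x y} → x ≼ y → x ≤ y
  ≼⇒≤ {x} {y} = ≼⇒≤′ (size y) x y (ℕₚ.m≤n+m (size y) (size x))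

  -- Labels of flips

  zipper-edges : ∀ (c d : Path) x p₀ y q₀ → (c ++ x ∷ p₀) ʳ++ (d ++ y ∷ q₀) ≡ p₀ ʳ++ (x ∷ ((c ʳ++ d) ++ y ∷ q₀))
  zipper-edges c d x p₀ y q₀ =
    trans (zipper-form c x p₀ _) (cong (λ z → p₀ ʳ++ (x ∷ z)) (sym (ʳ++-assoc c d (y ∷ q₀))))

  fork-prefix : ∀ (d g : Path) {y f q q′ b b′} → d ++ y ∷ q ≡ g ++ b → d ++ f ∷ q′ ≡ g ++ b′ → y ≢ f →
    ∃ λ d₁ → d ≡ g ++ d₁
  fork-prefix d [] _ _ _ = d , refl
  fork-prefix [] (z ∷ g) e₁ e₂ ne = ⊥-elim (ne (trans (proj₁ (∷-injective e₁)) (sym (proj₁ (∷-injective e₂)))))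
  fork-prefix (h ∷ d) (z ∷ g) e₁ e₂ ne with ∷-injective e₁ | ∷-injective e₂
  ... | refl , e₁′ | _ , e₂′ with fork-prefix d g e₁′ e₂′ ne
  ...   | d₁ , refl = d₁ , refl

  ∈-ʳ++ʳ : ∀ (p : Path) {z X} → z ∈ X → z ∈ p ʳ++ X
  ∈-ʳ++ʳ [] i = i
  ∈-ʳ++ʳ (e ∷ p) i = ∈-ʳ++ʳ p (there i)

  ∈-ʳ++ˡ : ∀ (p : Path) {z X} → z ∈ p → z ∈ p ʳ++ X
  ∈-ʳ++ˡ (e ∷ p) (here refl) = ∈-ʳ++ʳ p (here refl)
  ∈-ʳ++ˡ (e ∷ p) (there i) = ∈-ʳ++ˡ p i

  verts-split : ∀ {u w} K → Chain u K → w ∈ verts u K → ∃₂ λ c d → K ≡ c ʳ++ d × BackPath u w c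
  verts-split K ch (here refl) = [] , K , refl , refl
  verts-split (e ∷ K) (eq , ch) (there w∈) with verts-split K ch w∈
  ... | c , d , refl , bp = c ++ e ∷ [] , d , sym (zipper-form c e [] d) , back-glue c bp (refl , eq)

  split-verts : ∀ {u w} c d → BackPath u w c → w ∈ verts u (c ʳ++ d)
  split-verts [] d refl = here refl
  split-verts (e ∷ c) d (refl , _) = there (∈-map⁺ tgt (∈-ʳ++ˡ (e ∷ c) (here refl)))

  chain-prefix : ∀ {u} K {f r} → Chain u (K ++ f ∷ r) → Chain u K × src f ≡ endV u K
  chain-prefix [] (eq , _) = tt , eq
  chain-prefix (e ∷ K) (eq , ch) with chain-prefix K ch
  ... | ch′ , en = (eq , ch′) , en

  chain-src-≥ : ∀ {v e} R → Chain v R → e ∈ R → toℕ v ℕ.≤ toℕ (src e)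
  chain-src-≥ (e ∷ R) (refl , ch) (here refl) = ℕₚ.≤-refl
  chain-src-≥ (e ∷ R) (refl , ch) (there i) = ℕₚ.≤-trans (ℕₚ.<⇒≤ (src<tgt e)) (chain-src-≥ R ch i)

  src-injective : ∀ {v e e′} R → Chain v R → e ∈ R → e′ ∈ R → src e ≡ src e′ → e ≡ e′
  src-injective (g ∷ R) ch (here refl) (here refl) eq = refl
  src-injective (g ∷ R) (_ , ch) (there i) (there j) eq = src-injective R ch i j eq
  src-injective (g ∷ R) (_ , ch) (here refl) (there j) eq =
    ⊥-elim (ℕₚ.<-irrefl (cong toℕ eq) (ℕₚ.<-≤-trans (src<tgt g) (chain-src-≥ R ch j)))
  src-injective (g ∷ R) (_ , ch) (there i) (here refl) eq =
    ⊥-elim (ℕₚ.<-irrefl (cong toℕ (sym eq)) (ℕₚ.<-≤-trans (src<tgt g) (chain-src-≥ R ch i)))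

  tgt-injective : ∀ {v e e′} R → Chain v R → e ∈ R → e′ ∈ R → tgt e ≡ tgt e′ → e ≡ e′
  tgt-injective (g ∷ R) ch (here refl) (here refl) eq = refl
  tgt-injective (g ∷ R) (_ , ch) (there i) (there j) eq = tgt-injective R ch i j eq
  tgt-injective {e′ = e′} (g ∷ R) (_ , ch) (here refl) (there j) eq =
    ⊥-elim (ℕₚ.<-irrefl (cong toℕ eq) (ℕₚ.≤-<-trans (chain-src-≥ R ch j) (src<tgt e′)))
  tgt-injective {e = e} (g ∷ R) (_ , ch) (there i) (here refl) eq =
    ⊥-elim (ℕₚ.<-irrefl (cong toℕ (sym eq)) (ℕₚ.≤-<-trans (chain-src-≥ R ch i) (src<tgt e)))

  verts-≥ : ∀ {u w} K → Chain u K → w ∈ verts u K → toℕ u ℕ.≤ toℕ w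
  verts-≥ K ch w∈ with verts-split K ch w∈
  ... | c , _ , _ , bp = back-≤ c bp

  -- A route has only one edge leaving each vertex, so the vertices of a piece of it determine the
  -- edges.
  same-verts : ∀ {v a R} P P′ → Chain v R → Chain a P → Chain a P′ → All (_∈ R) P → All (_∈ R) P′ →
    (∀ {w} → w ∈ verts a P → w ∈ verts a P′) → (∀ {w} → w ∈ verts a P′ → w ∈ verts a P) → P ≡ P′
  same-verts [] [] _ _ _ _ _ _ _ = refl
  same-verts [] (e ∷ P′) _ _ (refl , _) _ _ _ g with g (there (here refl))
  ... | here eq = ⊥-elim (ℕₚ.<-irrefl (cong toℕ (sym eq)) (src<tgt e))
  same-verts (e ∷ P) [] _ (refl , _) _ _ _ f _ with f (there (here refl))
  ... | here eq = ⊥-elim (ℕₚ.<-irrefl (cong toℕ (sym eq)) (src<tgt e))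
  same-verts {R = R} (e ∷ P) (e′ ∷ P′) chR (refl , ch) (eq , ch′) (e∈ ∷ P∈) (e′∈ ∷ P′∈) f g
    with src-injective R chR e∈ e′∈ (sym eq)
  ... | refl = cong (e ∷_) (same-verts P P′ chR ch ch′ P∈ P′∈ (strip ch f) (strip ch′ g))
    where
    strip : ∀ {Q Q′} → Chain (tgt e) Q → (∀ {w} → w ∈ verts (src e) (e ∷ Q) → w ∈ verts (src e) (e ∷ Q′)) →
      ∀ {w} → w ∈ verts (tgt e) Q → w ∈ verts (tgt e) Q′
    strip {Q} chQ h w∈ with h (there w∈)
    ... | there w∈′ = w∈′
    ... | here refl = ⊥-elim (ℕₚ.<⇒≱ (src<tgt e) (verts-≥ Q chQ w∈))

  label-unique : ∀ {R₁ R₂ L L′} → IsRoute R₂ → LabelOf R₁ R₂ L → LabelOf R₁ R₂ L′ → L ≡ L′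
  label-unique {R₂ = R₂} (chR , _)
    (a , P , e , f , ch , vs , _ , P∈ , e∈ , te , f∈ , sf , refl)
    (a′ , P′ , e′ , f′ , ch′ , vs′ , _ , P′∈ , e′∈ , te′ , f′∈ , sf′ , refl)
    with Finₚ.toℕ-injective (ℕₚ.≤-antisym (verts-≥ P ch (back (here refl))) (verts-≥ P′ ch′ (forth (here refl))))
    where
    forth : ∀ {w} → w ∈ verts a P → w ∈ verts a′ P′
    forth w∈ = Equivalence.from (vs′ _) (Equivalence.to (vs _) w∈)
    back : ∀ {w} → w ∈ verts a′ P′ → w ∈ verts a P
    back w∈ = Equivalence.from (vs _) (Equivalence.to (vs′ _) w∈)
  ... | refl with same-verts P P′ chR ch ch′ P∈ P′∈
                    (λ w∈ → Equivalence.from (vs′ _) (Equivalence.to (vs _) w∈))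
                    (λ w∈ → Equivalence.from (vs _) (Equivalence.to (vs′ _) w∈))
  ... | refl with tgt-injective R₂ chR e∈ e′∈ (trans te (sym te′))
               | src-injective R₂ chR f∈ f′∈ (trans sf (sym sf′))
  ... | refl | refl = refl

  corner-of : ∀ {R₁ R₂} (π : Place R₁ R₂) → Σ (Corner R₁ R₂) λ κ →
    Corner.p κ ≡ Place.p π × Corner.p′ κ ≡ Place.p′ π × Corner.q κ ≡ Place.q π × Corner.q′ κ ≡ Place.q′ π
  corner-of (place-at z z′ l m) with lex-view l | lex-view m
  ... | c , x , e , p₀ , p₀′ , refl , refl , x<e | d , f , y , q₀′ , q₀ , refl , refl , f<y =
    record
      { c = c ; d = d ; p₀ = p₀ ; p₀′ = p₀′ ; q₀ = q₀ ; q₀′ = q₀′ ; x = x ; e = e ; y = y ; f = f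
      ; x<e = x<e ; f<y = f<y ; eq₁ = Zipper.eq z ; eq₂ = Zipper.eq z′ } , refl , refl , refl , refl

  module FlipLabelOf {x y R₁ R₂} (fl : Flipped x y R₁ R₂) where
    open Flipped fl
    open LastPlace last using (pl)
    κ : Corner R₁ R₂
    κ = proj₁ (corner-of pl)
    open Corner κ renaming (x to x₀; y to y₀)
    p≡ : p ≡ Place.p pl
    p≡ = proj₁ (proj₂ (corner-of pl))
    p′≡ : p′ ≡ Place.p′ pl
    p′≡ = proj₁ (proj₂ (proj₂ (corner-of pl)))
    q≡ : q ≡ Place.q pl
    q≡ = proj₁ (proj₂ (proj₂ (proj₂ (corner-of pl))))
    q′≡ : q′ ≡ Place.q′ pl
    q′≡ = proj₂ (proj₂ (proj₂ (proj₂ (corner-of pl))))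

    route₁ : IsRoute R₁
    route₁ = clique-route x R₁∈
    route₂ : IsRoute R₂
    route₂ = clique-route y R₂∈

    -- `c` and `d` are the stretches along which the two routes agree, going backwards and forwards
    -- from the last place.
    mid : Path
    mid = c ʳ++ d

    label : Path
    label = e ∷ (mid ++ f ∷ [])

    upper≡label : upper ≡ label
    upper≡label = zipper-edges c d e [] f []

    form₁ : R₁ ≡ p₀ ʳ++ (x₀ ∷ (mid ++ y₀ ∷ q₀))
    form₁ = trans eq₁ (zipper-edges c d x₀ p₀ y₀ q₀)
    form₂ : R₂ ≡ p₀′ ʳ++ (e ∷ (mid ++ f ∷ q₀′))
    form₂ = trans eq₂ (zipper-edges c d e p₀′ f q₀′)

    chain₂ : Chain (tgt e) (mid ++ f ∷ q₀′)
    chain₂ = proj₂ (proj₁ (proj₂ (proj₂ (chain-split p₀′ (subst (Chain s) form₂ (proj₁ route₂))))))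

    mid-chain : Chain (tgt e) mid
    mid-chain = proj₁ (chain-prefix mid chain₂)

    x≢e : x₀ ≢ e
    x≢e eq = I-irr (subst (x₀ <I_) (sym eq) x<e)
    y≢f : y₀ ≢ f
    y≢f eq = O-irr (subst (_<O y₀) (sym eq) f<y)

    vertex : ∀ {w v a g} c₁ {r} → BackPath (tgt e) w c₁ → tgt g ≡ tgt e → BackPath a v (c₁ ++ g ∷ r) → v ≡ w
    vertex [] refl te (eq , _) = trans (sym eq) te
    vertex (h ∷ _) (eq , _) te (eq′ , _) = trans (sym eq′) eq

    verts⇒incoh : ∀ {w} → w ∈ verts (tgt e) mid → Incoh R₁ R₂ w
    verts⇒incoh {w} w∈ with verts-split mid mid-chain w∈
    ... | c₁ , d₁ , eq , bp
        with route-zipper (c₁ ++ x₀ ∷ p₀) {d₁ ++ y₀ ∷ q₀} route₁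
               (trans form₁ (trans (cong (λ z → p₀ ʳ++ (x₀ ∷ (z ++ y₀ ∷ q₀))) eq) (sym (zipper-edges c₁ d₁ x₀ p₀ y₀ q₀))))
           | route-zipper (c₁ ++ e ∷ p₀′) {d₁ ++ f ∷ q₀′} route₂
               (trans form₂ (trans (cong (λ z → p₀′ ʳ++ (e ∷ (z ++ f ∷ q₀′))) eq) (sym (zipper-edges c₁ d₁ e p₀′ f q₀′))))
    ... | v₁ , z₁ | v₂ , z₂ with vertex c₁ bp (tgt-I x<e) (Zipper.bp z₁) | vertex c₁ bp refl (Zipper.bp z₂)
    ... | refl | refl = inj₁ (Place⇒CW (place-at z₁ z₂ (lex-at c₁ x<e) (lex-at d₁ f<y)))

    incoh⇒verts : ∀ {w} → Incoh R₁ R₂ w → w ∈ verts (tgt e) mid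
    incoh⇒verts (inj₂ cw) = ⊥-elim (Single.not-reversed (proj₁ (CW⇒Place route₂ route₁ cw)))
    incoh⇒verts (inj₁ cw) with CW⇒Place route₁ route₂ cw
    -- Any place is the last one shifted along a stretch `g` common to both routes; they part at the
    -- far ends of `c` and `d`, so `g` cannot reach beyond these.
    ... | π , refl with Single.common π
    ... | inj₁ (g , pπ , p′π , qg , q′g)
          with fork-prefix d (reverse g) (trans q≡ (trans qg (ʳ++-defn g))) (trans q′≡ (trans q′g (ʳ++-defn g))) y≢f
    ...   | d₁ , d≡ = subst (λ z → _ ∈ verts (tgt e) z)
              (trans (++-ʳ++ g) (cong (c ʳ++_) (trans (ʳ++-defn g) (sym d≡))))
              (split-verts (g ++ c) d₁ (at (g ++ c) (subst (BackPath s _)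
                (trans p′π (trans (cong (g ++_) (sym p′≡)) (sym (++-assoc g c (e ∷ p₀′))))) (Zipper.bp (Place.zip′ π)))))
      where
      at : ∀ {v} c₁ → BackPath s v (c₁ ++ e ∷ p₀′) → BackPath (tgt e) v c₁
      at c₁ bp with back-split c₁ bp
      ... | _ , bc , refl , _ = bc
    incoh⇒verts (inj₁ cw) | π , refl | inj₂ (g , pπ , p′π , qg , q′g)
          with fork-prefix c g (trans p≡ pπ) (trans p′≡ p′π) x≢e
    ...   | c₂ , c≡ = subst (λ z → _ ∈ verts (tgt e) z)
              (trans (sym (++-ʳ++ g)) (cong (_ʳ++ d) (sym c≡)))
              (split-verts c₂ (g ʳ++ d) (at (Zipper.bp (Place.zip′ π))))
      where
      suffix : Place.p′ π ≡ c₂ ++ e ∷ p₀′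
      suffix = ++-cancelˡ g _ _ (trans (sym p′π) (trans (sym p′≡) (trans (cong (_++ e ∷ p₀′) c≡) (++-assoc g c₂ _))))
      at : ∀ {v} → BackPath s v (Place.p′ π) → BackPath (tgt e) v c₂
      at bp with back-split c₂ (subst (BackPath s _) suffix bp)
      ... | _ , bc , refl , _ = bc

    label-of : LabelOf R₁ R₂ label
    label-of = tgt e , mid , e , f , mid-chain , (λ w → mk⇔ verts⇒incoh incoh⇒verts) ,
      tabulate (λ i → subst (_ ∈_) (sym form₁) (∈-ʳ++ʳ p₀ (there (∈-++⁺ˡ i)))) ,
      tabulate (λ i → subst (_ ∈_) (sym form₂) (∈-ʳ++ʳ p₀′ (there (∈-++⁺ˡ i)))) ,
      subst (e ∈_) (sym form₂) (∈-ʳ++ʳ p₀′ (here refl)) , refl ,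
      subst (f ∈_) (sym form₂) (∈-ʳ++ʳ p₀′ (there (∈-++⁺ʳ mid (here refl)))) ,
      proj₂ (chain-prefix mid chain₂) , refl

  ≤-refl : ∀ {x} → x ≤ x
  ≤-refl {x} = ≤-≈ (≈-refl {x})

  ≤-antisym : ∀ {x y} → x ≤ y → y ≤ x → x ≈ y
  ≤-antisym {x} {y} a b = ≼-antisym {x} {y} (≤⇒≼ a) (≤⇒≼ b)

  flip-≈ : ∀ {x w y} → w ≈ y → x ⋖ w → x ⋖ y
  flip-≈ eq (R₁ , R₂ , R₁∈ , iff , cw) = R₁ , R₂ , R₁∈ ,
    (λ Q → mk⇔ (Equivalence.to (iff Q) ∘ proj₂ (eq Q)) (proj₁ (eq Q) ∘ Equivalence.from (iff Q))) , cw

  ⋖⇒⋡ : ∀ {x y} → x ⋖ y → ¬ y ≼ x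
  ⋖⇒⋡ {x} {y} (_ , _ , fl) = Flipped.upper-⋠-lower (flip⇒flipped {x} {y} fl)

  last-flip : ∀ {x y} → x ≤ y → ¬ x ≈ y → ∃ λ u → x ≤ u × u ⋖ y
  last-flip (≤-≈ eq) x≉y = ⊥-elim (x≉y eq)
  last-flip {x} {y} (≤-step {y = w} st w≤y) x≉y = decide (w ≈? y)
    where
    decide : Dec (w ≈ y) → ∃ λ u → x ≤ u × u ⋖ y
    decide (yes eq) = x , ≤-refl {x} , flip-≈ {x} {w} {y} eq st
    decide (no ne) = let (u , w≤u , st′) = last-flip w≤y ne in u , ≤-step st w≤u , st′

  cover⇒flip : ∀ {x y} → Cover x y → x ⋖ y
  cover⇒flip {x} {y} ((≤-≈ eq , y≰x) , _) = ⊥-elim (y≰x (≤-≈ (≈-sym {x} {y} eq)))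
  cover⇒flip {x} {y} ((≤-step {y = w} st w≤y , y≰x) , gap) = decide (w ≈? y)
    where
    decide : Dec (w ≈ y) → x ⋖ y
    decide (yes eq) = flip-≈ {x} {w} {y} eq st
    decide (no ne) = ⊥-elim (gap w
      ((≤-step {x} {w} {w} st (≤-refl {w}) , λ w≤x → ⋖⇒⋡ {x} {w} st (≤⇒≼ w≤x)) ,
       (w≤y , λ y≤w → ne (≤-antisym {w} {y} w≤y y≤w))))

  module LabelFacts {x y R₁ R₂} (fl : Flipped x y R₁ R₂) where
    open Flipped fl
    open FlipLabelOf fl using (κ; label; upper≡label; label-of; p≡; p′≡; q≡; q′≡; mid) public
    open Corner κ renaming (x to x₀; y to y₀) public

    lower : Path
    lower = (c ++ x₀ ∷ []) ʳ++ (d ++ y₀ ∷ [])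

    upper-infix : Infix upper R₂
    upper-infix = subst (Infix upper) (sym eq₂) (infix-zipper c e p₀′ d f q₀′)

    upper-chain : ∃ λ v → Chain v upper
    upper-chain = chain-infix upper-infix (proj₁ (clique-route y R₂∈))

    above-upper : above y upper
    above-upper S∈ h = clique-below y S∈ R₂∈ (◁-infixʳ upper-infix h)

    R₁◁upper : R₁ ◁ upper
    R₁◁upper = place p q (c ++ e ∷ []) (d ++ f ∷ []) eq₁ refl (lex-at c x<e) (lex-at d f<y)

    not-above-upper : ¬ above x upper
    not-above-upper a = a R₁∈ R₁◁upper

    lower◁upper : lower ◁ upper
    lower◁upper = place (c ++ x₀ ∷ []) (d ++ y₀ ∷ []) (c ++ e ∷ []) (d ++ f ∷ []) refl refl (lex-at c x<e) (lex-at d f<y)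

    module Up = FlipLabel (clique x) (MaxClique.coh (clique y)) C⊆ R₁∈ R₂∈ κ
      (subst (_∈ ⟦ y ⟧) (sym (cong₂ _ʳ++_ p≡ q′≡)) W∈C′) (subst (_∈ ⟦ y ⟧) (sym (cong₂ _ʳ++_ p′≡ q≡)) W′∈C′)

    forced : ∀ {a Z X} → Chain a Z → above y Z → X ∈ ⟦ x ⟧ → X ◁ Z → Infix upper Z
    forced {Z = Z} ch aZ X∈ h with C⊆ X∈
    ... | inj₁ refl = Up.label-forced ch (λ S∈ → aZ S∈) h
    ... | inj₂ X∈y = ⊥-elim (aZ X∈y h)

    κᵈ : Dual.Corner R₂ R₁
    κᵈ = record { c = c ; d = d ; p₀ = p₀′ ; p₀′ = p₀ ; q₀ = q₀′ ; q₀′ = q₀ ; x = e ; e = x₀ ; y = f ; f = y₀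
                ; x<e = x<e ; f<y = f<y ; eq₁ = eq₂ ; eq₂ = eq₁ }

    module Down = Dual.FlipLabel (dual-clique (clique y)) (λ D∈ U∈ h → MaxClique.coh (clique x) U∈ D∈ (from-dual h))
      C′⊆ R₂∈ R₁∈ κᵈ
      (subst (_∈ ⟦ x ⟧) (sym (cong₂ _ʳ++_ p′≡ q≡)) W′∈C) (subst (_∈ ⟦ x ⟧) (sym (cong₂ _ʳ++_ p≡ q′≡)) W∈C)

    forcedᵈ : ∀ {a Z Y} → Chain a Z → below x Z → Y ∈ ⟦ y ⟧ → Z ◁ Y → Z ◁ upper
    forcedᵈ {Z = Z} ch bZ Y∈ h with C′⊆ Y∈
    ... | inj₂ Y∈x = ⊥-elim (bZ Y∈x h)
    ... | inj₁ refl = ◁-infixˡ (Down.label-forced ch (λ S∈ k → bZ S∈ (from-dual k)) (to-dual h)) lower◁upper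

    -- A route of `z` with a route of `x` below it must contain `upper`, by `forced`; coherence of
    -- `z` then gives `above z upper`.
    below-lower : ∀ {z} → z ≼ y → ¬ above z upper → z ≼ x
    below-lower {z} z≼y ¬a R∈ R′∈ h = ¬a λ S∈ k → clique-below z S∈ R∈
      (◁-infixʳ (forced (proj₁ (clique-route z R∈)) (λ S∈′ → z≼y R∈ S∈′) R′∈ h) k)

    -- A route of `z` below a route of `y` must contain `lower`, by the dual argument;
    -- `lower ◁ upper` then contradicts `above z upper`.
    above-lower : ∀ {z} → x ≼ z → above z upper → y ≼ z
    above-lower {z} x≼z a R∈ R′∈ h =
      a R′∈ (forcedᵈ (proj₁ (clique-route z R′∈)) (λ S∈ → x≼z S∈ R′∈) R∈ h)

    -- Deciding `above z upper` places each `z` of the interval over `y` or under `x`.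
    flip-cover : Cover x y
    flip-cover = (≼⇒≤ {x} {y} lower-≼-upper , λ y≤x → upper-⋠-lower (≤⇒≼ y≤x)) , gap
      where
      gap : ∀ z → ¬ ((x ≤ z × ¬ (z ≤ x)) × (z ≤ y × ¬ (y ≤ z)))
      gap z ((x≤z , z≰x) , (z≤y , y≰z)) = decide (above? z upper)
        where
        decide : Dec (above z upper) → ⊥
        decide (yes a) = y≰z (≼⇒≤ {y} {z} (above-lower {z} (≤⇒≼ x≤z) a))
        decide (no ¬a) = z≰x (≼⇒≤ {z} {x} (below-lower {z} (≤⇒≼ z≤y) ¬a))

  -- Meets, joins, and the join-irreducible of a label.

  module _ (a b : MC) where
    ∈-either : ∀ {D} → D ∈ ⟦ a ⟧ ++ ⟦ b ⟧ → IsRoute D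
    ∈-either D∈ = [ clique-route a , clique-route b ]′ (∈-++⁻ ⟦ a ⟧ D∈)

    inf : MC
    inf = Concept.meet (⟦ a ⟧ ++ ⟦ b ⟧) ∈-either

    inf-≼ˡ : inf ≼ a
    inf-≼ˡ = meet-≼-⊆ ∈-either {a} ∈-++⁺ˡ

    inf-≼ʳ : inf ≼ b
    inf-≼ʳ = meet-≼-⊆ ∈-either {b} (∈-++⁺ʳ ⟦ a ⟧)

    ≼-inf : ∀ {z} → z ≼ a → z ≼ b → z ≼ inf
    ≼-inf {z} za zb = ≼-meet ∈-either {z} λ D∈ Z∈ →
      [ (λ D∈a → za Z∈ D∈a) , (λ D∈b → zb Z∈ D∈b) ]′ (∈-++⁻ ⟦ a ⟧ D∈)

    above-inf : ∀ {v K} → Chain v K → above a K → above b K → above inf K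
    above-inf ch aK bK = above-meet⁺ ∈-either ch λ D∈ → [ (λ i → aK i) , (λ i → bK i) ]′ (∈-++⁻ ⟦ a ⟧ D∈)

    below-both : List Path
    below-both = filter (λ D → below? a D ×-dec below? b D) routes

    below-both-routes : ∀ {D} → D ∈ below-both → IsRoute D
    below-both-routes D∈ = routes-sound (proj₁ (∈-filter⁻ (λ D → below? a D ×-dec below? b D) {xs = routes} D∈))

    ∈-below-both : ∀ {D} → IsRoute D → below a D → below b D → D ∈ below-both
    ∈-below-both r aD bD = ∈-filter⁺ (λ D → below? a D ×-dec below? b D) (routes-complete r) ((λ {R} → aD {R}) , (λ {R} → bD {R}))

    below-both-props : ∀ {D} → D ∈ below-both → below a D × below b D
    below-both-props D∈ = proj₂ (∈-filter⁻ (λ D → below? a D ×-dec below? b D) {xs = routes} D∈)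

    -- The join as a meet: the generating routes include those of every common upper bound.
    sup : MC
    sup = Concept.meet below-both below-both-routes

    ≼-supˡ : a ≼ sup
    ≼-supˡ = ≼-meet below-both-routes {a} λ D∈ → proj₁ (below-both-props D∈)

    ≼-supʳ : b ≼ sup
    ≼-supʳ = ≼-meet below-both-routes {b} λ D∈ → proj₂ (below-both-props D∈)

    below-sup : ∀ {v K} → Chain v K → below a K → below b K → below sup K
    below-sup {K = K} ch aK bK R∈ h
      with Greedy.greedy [] (⟦ a ⟧ ++ ⟦ b ⟧) (λ ()) K ch
             ((λ ()) , λ U∈ → [ (λ i → aK i) , (λ i → bK i) ]′ (∈-++⁻ ⟦ a ⟧ U∈))
    ... | D , rD , inf′ , (_ , noU) = Concept.separated below-both below-both-routes
            (∈-below-both rD (λ i → noU (∈-++⁺ˡ i)) (λ i → noU (∈-++⁺ʳ ⟦ a ⟧ i)))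
            (Concept.meet⊆𝒰 below-both below-both-routes R∈) (◁-infixˡ inf′ h)

  -- The smallest element with no route below L.
  module Smallest (L : Path) where
    𝒟 : List Path
    𝒟 = filter (λ D → ¬? (D ◁? L)) routes

    𝒟-routes : ∀ {D} → D ∈ 𝒟 → IsRoute D
    𝒟-routes D∈ = routes-sound (proj₁ (∈-filter⁻ (λ D → ¬? (D ◁? L)) {xs = routes} D∈))

    J : MC
    J = Concept.meet 𝒟 𝒟-routes

    above-J : ∀ {v} → Chain v L → above J L
    above-J ch = above-meet⁺ 𝒟-routes ch λ D∈ → proj₂ (∈-filter⁻ (λ D → ¬? (D ◁? L)) {xs = routes} D∈)

    J-≼ : ∀ {z} → above z L → J ≼ z
    J-≼ {z} a = meet-≼-⊆ 𝒟-routes {z} λ Z∈ → ∈-filter⁺ (λ D → ¬? (D ◁? L)) (routes-complete (clique-route z Z∈)) (a Z∈)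

  SameCg-sym : ∀ {u v a b} → SameCg u v a b → SameCg a b u v
  SameCg-sym h θ c = mk⇔ (Equivalence.from (h θ c)) (Equivalence.to (h θ c))

  SameCg-trans : ∀ {u v a b a′ b′} → SameCg u v a b → SameCg a b a′ b′ → SameCg u v a′ b′
  SameCg-trans h k θ c = mk⇔ (Equivalence.to (k θ c) ∘ Equivalence.to (h θ c)) (Equivalence.from (h θ c) ∘ Equivalence.from (k θ c))

  SameCg-≈ : ∀ {a a′ b} → a ≈ a′ → SameCg a b a′ b
  SameCg-≈ {a} {a′} {b} eq θ c = mk⇔ (λ h → transθ a′ a b (reflθ a′ a (≈-sym {a} {a′} eq)) h) (λ h → transθ a a′ b (reflθ a a′ eq) h)
    where open IsCongruence c

  JoinIrr-unique : ∀ {j j₁ j₂} → JoinIrr j j₁ → JoinIrr j j₂ → j₁ ≈ j₂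
  JoinIrr-unique (cov , _) (_ , uniq) = uniq _ cov

  module FlipJoinIrr {x y R₁ R₂} (fl : Flipped x y R₁ R₂) where
    open LabelFacts fl using (upper; upper-chain; above-upper; not-above-upper; below-lower; above-lower)
    open Smallest upper
    open Flipped fl using (lower-≼-upper)

    J* : MC
    J* = inf J x

    aJ : above J upper
    aJ = above-J (proj₂ upper-chain)

    J≼y : J ≼ y
    J≼y = J-≼ {y} above-upper

    -- Minimality of `J` makes `above z upper` fail, so `below-lower` applies, and `z` lies under
    -- both `J` and `x`.
    strictly-below : ∀ {z} → z ≼ J → ¬ J ≼ z → z ≼ J*
    strictly-below {z} z≼J J⋠z = ≼-inf J x {z} z≼J
      (below-lower {z} (≼-trans {z} {J} {y} z≼J J≼y) λ a → J⋠z (J-≼ {z} a))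

    J⋠J* : ¬ J ≼ J*
    J⋠J* h = not-above-upper (above-mono {J*} {x} (inf-≼ʳ J x) (above-mono {J} {J*} h aJ))

    J-cover : Cover J* J
    J-cover = (≼⇒≤ {J*} {J} (inf-≼ˡ J x) , λ h → J⋠J* (≤⇒≼ h)) , λ { z ((_ , z≰J*) , (z≤J , J≰z)) →
      z≰J* (≼⇒≤ {z} {J*} (strictly-below {z} (≤⇒≼ z≤J) (λ h → J≰z (≼⇒≤ {J} {z} h)))) }

    J-joinIrr : JoinIrr J J*
    J-joinIrr = J-cover , unique
      where
      unique : ∀ w → Cover w J → w ≈ J*
      unique w ((w≤J , J≰w) , gap) = decide (w ≈? J*)
        where
        w≼J* : w ≼ J*
        w≼J* = strictly-below {w} (≤⇒≼ w≤J) (λ h → J≰w (≼⇒≤ {J} {w} h))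
        decide : Dec (w ≈ J*) → w ≈ J*
        decide (yes eq) = eq
        decide (no ne) = ⊥-elim (gap J*
          ((≼⇒≤ {w} {J*} w≼J* , λ h → ne (≼-antisym {w} {J*} w≼J* (≤⇒≼ h))) , proj₁ J-cover))

    -- Perspectivity: meeting with `J` carries the pair `x`, `y` to `J*`, `J`, and joining with `x`
    -- carries it back.
    J-sameCg : SameCg x y J* J
    J-sameCg θ c = mk⇔ (λ h → meetθ x y J J* J h glb glb′) (λ h → joinθ J* J x x y h lub lub′)
      where
      open IsCongruence c
      ≈-≤ : ∀ {a b z} → a ≤ b → z ≈ b → a ≤ z
      ≈-≤ {a} {b} {z} l eq = ≤-trans l (≤-≈ (≈-sym {z} {b} eq))
      ≤-≈ˡ : ∀ {a b z} → a ≤ b → z ≈ a → z ≤ b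
      ≤-≈ˡ l eq = ≤-trans (≤-≈ eq) l
      glb : IsGLB (Pair x J) J*
      glb = (λ { z (inj₁ eq) → ≈-≤ {J*} {x} {z} (≼⇒≤ {J*} {x} (inf-≼ʳ J x)) eq
               ; z (inj₂ eq) → ≈-≤ {J*} {J} {z} (≼⇒≤ {J*} {J} (inf-≼ˡ J x)) eq }) ,
            λ z lb → ≼⇒≤ {z} {J*} (≼-inf J x {z} (≤⇒≼ (lb J (inj₂ (≈-refl {J})))) (≤⇒≼ (lb x (inj₁ (≈-refl {x})))))
      glb′ : IsGLB (Pair y J) J
      glb′ = (λ { z (inj₁ eq) → ≈-≤ {J} {y} {z} (≼⇒≤ {J} {y} J≼y) eq
                ; z (inj₂ eq) → ≈-≤ {J} {J} {z} (≤-refl {J}) eq }) , λ z lb → lb J (inj₂ (≈-refl {J}))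
      lub : IsLUB (Pair J* x) x
      lub = (λ { z (inj₁ eq) → ≤-≈ˡ {J*} {x} {z} (≼⇒≤ {J*} {x} (inf-≼ʳ J x)) eq
               ; z (inj₂ eq) → ≤-≈ˡ {x} {x} {z} (≤-refl {x}) eq }) , λ z ub → ub x (inj₂ (≈-refl {x}))
      lub′ : IsLUB (Pair J x) y
      lub′ = (λ { z (inj₁ eq) → ≤-≈ˡ {J} {y} {z} (≼⇒≤ {J} {y} J≼y) eq
                ; z (inj₂ eq) → ≤-≈ˡ {x} {y} {z} (≼⇒≤ {x} {y} lower-≼-upper) eq }) ,
             λ z ub → ≼⇒≤ {y} {z} (above-lower {z} (≤⇒≼ (ub x (inj₂ (≈-refl {x}))))
               (above-mono {J} {z} (≤⇒≼ (ub J (inj₁ (≈-refl {J})))) aJ))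

  -- Congruences

  ∷-split : ∀ (pre : Path) {g x X Y} → g ∷ X ≡ pre ʳ++ (x ∷ Y) →
    (pre ≡ [] × x ≡ g × X ≡ Y) ⊎ (∃ λ pre₁ → pre ≡ pre₁ ++ g ∷ [] × X ≡ pre₁ ʳ++ (x ∷ Y))
  ∷-split [] eq with ∷-injective eq
  ... | refl , refl = inj₁ (refl , refl , refl)
  ∷-split pre@(_ ∷ _) {g} {x} {X} {Y} eq with ʳ++-split-first pre (x ∷ Y) X g refl eq
  ... | pre₁ , e₁ , e₂ = inj₂ (pre₁ , e₁ , e₂)

  ∷ʳ-split : ∀ (B U : Path) {g y post} → B ++ g ∷ [] ≡ U ++ y ∷ post →
    (post ≡ [] × y ≡ g × B ≡ U) ⊎ (∃ λ post₁ → post ≡ post₁ ++ g ∷ [] × B ≡ U ++ y ∷ post₁)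
  ∷ʳ-split B U {g} {y} {post} eq with ∷ʳ-view post
  ... | inj₁ refl with ∷ʳ-injective B U eq
  ...   | refl , refl = inj₁ (refl , refl , refl)
  ∷ʳ-split B U {g} {y} {.(post₁ ++ z ∷ [])} eq | inj₂ (post₁ , z , refl)
        with ∷ʳ-injective B (U ++ y ∷ post₁) (trans eq (sym (++-assoc U (y ∷ post₁) (z ∷ []))))
  ...   | refl , refl = inj₂ (post₁ , refl , refl)

  -- An occurrence of x · mid · y in a · B · b, carried over to a′ · B · b′ inside a longer path.
  record Carried (mid B : Path) (a b a′ b′ : E) (pre : Path) (x y : E) (post : Path) : Set where
    field
      x′ y′ : E
      pre′ post′ : Path
      embed : ∀ p₀ q₀ → p₀ ʳ++ (a′ ∷ (B ++ b′ ∷ q₀)) ≡ (pre′ ++ p₀) ʳ++ (x′ ∷ (mid ++ y′ ∷ (post′ ++ q₀)))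
      left  : (pre ≡ [] × x ≡ a × x′ ≡ a′) ⊎ ((∃₂ λ g r → pre′ ≡ g ∷ r) × x′ ≡ x)
      right : (post ≡ [] × y ≡ b × y′ ≡ b′) ⊎ ((∃₂ λ g r → post′ ≡ g ∷ r) × y′ ≡ y)

  snoc-nonempty : ∀ (l : Path) {g} → ∃₂ λ h r → l ++ g ∷ [] ≡ h ∷ r
  snoc-nonempty [] = _ , _ , refl
  snoc-nonempty (h ∷ l) = _ , _ , refl

  carry : ∀ {mid B a b} a′ b′ pre {x y} post → a ∷ (B ++ b ∷ []) ≡ pre ʳ++ (x ∷ (mid ++ y ∷ post)) →
    Carried mid B a b a′ b′ pre x y post
  carry {mid} {B} {a} {b} a′ b′ pre {x} {y} post eq with ∷-split pre eq
  ... | inj₁ (refl , refl , eq₁) with ∷ʳ-split B mid eq₁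
  ...   | inj₁ (refl , refl , refl) = record
          { x′ = a′ ; y′ = b′ ; pre′ = [] ; post′ = [] ; embed = λ p₀ q₀ → refl
          ; left = inj₁ (refl , refl , refl) ; right = inj₁ (refl , refl , refl) }
  ...   | inj₂ (post₁ , refl , refl) = record
          { x′ = a′ ; y′ = y ; pre′ = [] ; post′ = post₁ ++ b′ ∷ []
          ; embed = λ p₀ q₀ → cong (λ z → p₀ ʳ++ (a′ ∷ z)) (trans (++-assoc mid (y ∷ post₁) (b′ ∷ q₀))
              (cong (λ z → mid ++ y ∷ z) (sym (++-assoc post₁ (b′ ∷ []) q₀))))
          ; left = inj₁ (refl , refl , refl) ; right = inj₂ (snoc-nonempty post₁ , refl) }
  carry {mid} {B} {a} {b} a′ b′ pre {x} {y} post eq | inj₂ (pre₁ , refl , eq₁)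
    with ∷ʳ-split B (pre₁ ʳ++ (x ∷ mid)) (trans eq₁ (sym (ʳ++-assoc pre₁ (x ∷ mid) (y ∷ post))))
  ...   | inj₁ (refl , refl , refl) = record
          { x′ = x ; y′ = b′ ; pre′ = pre₁ ++ a′ ∷ [] ; post′ = []
          ; embed = λ p₀ q₀ → trans (cong (λ z → p₀ ʳ++ (a′ ∷ z)) (ʳ++-assoc pre₁ (x ∷ mid) (b′ ∷ q₀)))
              (trans (sym (++-ʳ++ pre₁)) (cong (_ʳ++ (x ∷ (mid ++ b′ ∷ q₀))) (sym (++-assoc pre₁ (a′ ∷ []) p₀))))
          ; left = inj₂ (snoc-nonempty pre₁ , refl) ; right = inj₁ (refl , refl , refl) }
  ...   | inj₂ (post₁ , refl , refl) = record
          { x′ = x ; y′ = y ; pre′ = pre₁ ++ a′ ∷ [] ; post′ = post₁ ++ b′ ∷ []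
          ; embed = λ p₀ q₀ → trans (cong (λ z → p₀ ʳ++ (a′ ∷ z))
                (trans (++-assoc (pre₁ ʳ++ (x ∷ mid)) (y ∷ post₁) (b′ ∷ q₀))
                  (trans (ʳ++-assoc pre₁ (x ∷ mid) _)
                    (cong (λ z → pre₁ ʳ++ (x ∷ (mid ++ y ∷ z))) (sym (++-assoc post₁ (b′ ∷ []) q₀))))))
              (trans (sym (++-ʳ++ pre₁)) (cong (_ʳ++ (x ∷ (mid ++ y ∷ ((post₁ ++ b′ ∷ []) ++ q₀)))) (sym (++-assoc pre₁ (a′ ∷ []) p₀))))
          ; left = inj₂ (snoc-nonempty pre₁ , refl) ; right = inj₂ (snoc-nonempty post₁ , refl) }

  -- If `e` lies strictly between, it is taken itself and is not strictly below `e`; in all other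
  -- cases `a` serves. This transports the strict end condition of `Crossesᵈ` to the weak one of
  -- `Crosses`.
  between-I : ∀ {a a′} e → a <I a′ → ∃ λ a″ → (a ≡ a″ ⊎ a <I a″) × a″ <I a′ × (a″ <I e → a′ ≡ e ⊎ a′ <I e)
  between-I {a} {a′} e l with a <I? e | e <I? a′
  ... | yes m | yes m′ = e , inj₂ m , m′ , λ k → ⊥-elim (I-irr k)
  ... | no ¬m | _ = a , inj₁ refl , l , λ k → ⊥-elim (¬m k)
  ... | yes m | no ¬m′ = a , inj₁ refl , l , λ k → case I-tri (trans (sym (tgt-I l)) (tgt-I m)) of λ
          { (inj₁ h) → inj₂ h ; (inj₂ (inj₁ h)) → inj₁ h ; (inj₂ (inj₂ h)) → ⊥-elim (¬m′ h) }

  between-O : ∀ {b b′} f → b′ <O b → ∃ λ b″ → (b″ ≡ b ⊎ b″ <O b) × b′ <O b″ × (f <O b″ → f ≡ b′ ⊎ f <O b′)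
  between-O {b} {b′} f l with f <O? b | b′ <O? f
  ... | yes m | yes m′ = f , inj₂ m , m′ , λ k → ⊥-elim (O-irr k)
  ... | no ¬m | _ = b , inj₁ refl , l , λ k → ⊥-elim (¬m k)
  ... | yes m | no ¬m′ = b , inj₁ refl , l , λ k → case O-tri (trans (src-O m) (sym (src-O l))) of λ
          { (inj₁ h) → inj₂ h ; (inj₂ (inj₁ h)) → inj₁ h ; (inj₂ (inj₂ h)) → ⊥-elim (¬m′ h) }

  -- The congruence of a label e · mid · f: it forgets every path that runs along mid, entering it
  -- no higher than e and leaving it no lower than f.  For the dual description, in terms of the
  -- paths with nothing of the clique above them, an end of the path on mid counts strictly.
  module LabelCongruence (e : E) (mid : Path) (f : E) where

    Crosses Crossesᵈ : Path → Set
    Crosses K = ∃₂ λ pre x → ∃₂ λ y post →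
      K ≡ pre ʳ++ (x ∷ (mid ++ y ∷ post)) × (x ≡ e ⊎ x <I e) × (f ≡ y ⊎ f <O y)
    Crossesᵈ K = ∃₂ λ pre x → ∃₂ λ y post →
      K ≡ pre ʳ++ (x ∷ (mid ++ y ∷ post)) × (x ≡ e ⊎ x <I e) × (f ≡ y ⊎ f <O y) ×
      (pre ≡ [] → x <I e) × (post ≡ [] → f <O y)

    SameAbove : MC → MC → Set
    SameAbove a b = ∀ {v K} → Chain v K → ¬ Crosses K → above a K → above b K

    SameBelow : MC → MC → Set
    SameBelow a b = ∀ {v K} → Chain v K → ¬ Crossesᵈ K → below a K → below b K

    -- If `K` is below a route `A` of `a`, the stretch `M` of `A` between the deciding edges is in
    -- `above a`. An end of `M` on `mid` is strictly dominated by that of `K`, so a weak crossing by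
    -- `M` makes `K` cross strictly at that end. Hence `M` does not cross and passes to `above b`,
    -- where `K ◁ M` is impossible.
    above⇒below : ∀ {a b} → SameAbove a b → SameBelow b a
    above⇒below {a} {b} same {v} {K} ch nc bK {A} A∈ (place p q p′ q′ eqK eqA l m)
      with lex-view l | lex-view m
    ... | c , x , g , p₀ , p₀′ , refl , refl , x<g | d , h , y , q₀′ , q₀ , refl , refl , h<y =
      below-above b ch (λ S∈ → bK S∈) (same (proj₂ M-chain) no-cross M-above)
        (place p q (c ++ g ∷ []) (d ++ h ∷ []) eqK refl (lex-at c x<g) (lex-at d h<y))
      where
      M = (c ++ g ∷ []) ʳ++ (d ++ h ∷ [])
      inf′ : Infix M A
      inf′ = subst (Infix M) (sym eqA) (infix-zipper c g p₀′ d h q₀′)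
      M-chain = chain-infix inf′ (proj₁ (clique-route a A∈))
      M-above : above a M
      M-above S∈ k = clique-below a S∈ A∈ (◁-infixʳ inf′ k)
      no-cross : ¬ Crosses M
      no-cross (pre , x₁ , y₁ , post , eqM , lx , ly)
        with carry {mid} {c ʳ++ d} x y pre post (trans (sym (zipper-edges c d g [] h [])) eqM)
      ... | record { x′ = x′ ; y′ = y′ ; pre′ = pre′ ; post′ = post′ ; embed = embed ; left = left ; right = right } =
        nc (pre′ ++ p₀ , x′ , y′ , post′ ++ q₀ ,
            trans eqK (trans (zipper-edges c d x p₀ y q₀) (embed p₀ q₀)) , proj₁ L , proj₁ R , proj₂ L , proj₂ R)
        where
        L′ : ∀ {A : Set} → (A × x₁ ≡ g × x′ ≡ x) ⊎ ((∃₂ λ g r → pre′ ≡ g ∷ r) × x′ ≡ x₁) → x₁ ≡ e ⊎ x₁ <I e →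
          (x′ ≡ e ⊎ x′ <I e) × (pre′ ++ p₀ ≡ [] → x′ <I e)
        L′ (inj₁ (_ , refl , refl)) (inj₁ refl) = inj₂ x<g , λ _ → x<g
        L′ (inj₁ (_ , refl , refl)) (inj₂ k) = inj₂ (I-trans x<g k) , λ _ → I-trans x<g k
        L′ (inj₂ ((_ , _ , refl) , refl)) k = k , λ ()
        L = L′ left lx
        R′ : ∀ {A : Set} → (A × y₁ ≡ h × y′ ≡ y) ⊎ ((∃₂ λ g r → post′ ≡ g ∷ r) × y′ ≡ y₁) → f ≡ y₁ ⊎ f <O y₁ →
          (f ≡ y′ ⊎ f <O y′) × (post′ ++ q₀ ≡ [] → f <O y′)
        R′ (inj₁ (_ , refl , refl)) (inj₁ refl) = inj₂ h<y , λ _ → h<y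
        R′ (inj₁ (_ , refl , refl)) (inj₂ k) = inj₂ (O-trans k h<y) , λ _ → O-trans k h<y
        R′ (inj₂ ((_ , _ , refl) , refl)) k = k , λ ()
        R = R′ right ly

    -- The converse uses the stretch of `B`, but that may cross where `M` does not, when `e` or `f`
    -- separates their end edges. Moving the ends as in `between-I` removes such crossings and keeps
    -- the stretch below `M`.
    below⇒above : ∀ {a b} → SameBelow b a → SameAbove a b
    below⇒above {a} {b} same {v} {M} ch nc aM {B} B∈ (place p q p′ q′ eqB eqM l m)
      with lex-view l | lex-view m
    ... | c , x , g , p₀ , p₀′ , refl , refl , x<g | d , h , y , q₀′ , q₀ , refl , refl , h<y
      with between-I e x<g | between-O f h<y
    ... | x″ , x≤x″ , x″<g , x-prop | y″ , y″≤y , h<y″ , y-prop =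
      below-above a K-chain (same K-chain no-cross K-below) (λ S∈ → aM S∈)
        (place (c ++ x″ ∷ []) (d ++ y″ ∷ []) _ _ refl eqM (lex-at c x″<g) (lex-at d h<y″))
      where
      K = (c ++ x″ ∷ []) ʳ++ (d ++ y″ ∷ [])
      K≡ : K ≡ x″ ∷ ((c ʳ++ d) ++ y″ ∷ [])
      K≡ = zipper-edges c d x″ [] y″ []
      B-chain : Chain (tgt x) ((c ʳ++ d) ++ y ∷ q₀)
      B-chain = proj₂ (proj₁ (proj₂ (proj₂ (chain-split p₀
        (subst (Chain s) (trans eqB (zipper-edges c d x p₀ y q₀)) (proj₁ (clique-route b B∈)))))))
      K-chain : Chain (src x″) K
      K-chain = subst (Chain (src x″)) (sym K≡) (refl ,
        proj₁ (chain-snoc (c ʳ++ d) (subst (λ w → Chain w (c ʳ++ d)) tx (proj₁ (chain-prefix (c ʳ++ d) B-chain)))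
          (trans sy (trans (proj₂ (chain-prefix (c ʳ++ d) B-chain)) (cong (λ w → endV w (c ʳ++ d)) tx)))))
        where
        tx : tgt x ≡ tgt x″
        tx = [ cong tgt , tgt-I ]′ x≤x″
        sy : src y″ ≡ src y
        sy = [ cong src , src-O ]′ y″≤y
      K-below : below b K
      K-below S∈ k = clique-below b B∈ S∈ (subst (_◁ _) (sym eqB) (mono-left c x″ d y″ x≤x″ y″≤y k))
      no-cross : ¬ Crossesᵈ K
      no-cross (pre , x₁ , y₁ , post , eqK , lx , ly , sx , sy)
        with carry {mid} {c ʳ++ d} g h pre post (trans (sym K≡) eqK)
      ... | record { x′ = x′ ; y′ = y′ ; pre′ = pre′ ; post′ = post′ ; embed = embed ; left = left ; right = right } =
        nc (pre′ ++ p₀′ , x′ , y′ , post′ ++ q₀′ ,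
            trans eqM (trans (zipper-edges c d g p₀′ h q₀′) (embed p₀′ q₀′)) , L left , R right)
        where
        L : (pre ≡ [] × x₁ ≡ x″ × x′ ≡ g) ⊎ ((∃₂ λ g r → pre′ ≡ g ∷ r) × x′ ≡ x₁) → x′ ≡ e ⊎ x′ <I e
        L (inj₁ (none , refl , refl)) = x-prop (sx none)
        L (inj₂ (_ , refl)) = lx
        R : (post ≡ [] × y₁ ≡ y″ × y′ ≡ h) ⊎ ((∃₂ λ g r → post′ ≡ g ∷ r) × y′ ≡ y₁) → f ≡ y′ ⊎ f <O y′
        R (inj₁ (none , refl , refl)) = y-prop (sy none)
        R (inj₂ (_ , refl)) = ly

    θ : MC → MC → Set
    θ a b = SameAbove a b × SameAbove b a

    meet-half : ∀ {a b c m₁ m₂} → SameAbove a b → IsGLB (Pair a c) m₁ → IsGLB (Pair b c) m₂ → SameAbove m₁ m₂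
    meet-half {a} {b} {c} {m₁} {m₂} same (lb₁ , _) (_ , gr₂) {K = K} ch nc h =
      above-mono {inf b c} {m₂} inf≼m₂
        (above-inf b c ch (same ch nc (above-mono {m₁} {a} (≤⇒≼ (lb₁ a (inj₁ (≈-refl {a})))) h))
                          (above-mono {m₁} {c} (≤⇒≼ (lb₁ c (inj₂ (≈-refl {c})))) h))
      where
      inf≼m₂ : inf b c ≼ m₂
      inf≼m₂ = ≤⇒≼ (gr₂ (inf b c) λ
        { y (inj₁ eq) → ≤-trans (≼⇒≤ {inf b c} {b} (inf-≼ˡ b c)) (≤-≈ (≈-sym {y} {b} eq))
        ; y (inj₂ eq) → ≤-trans (≼⇒≤ {inf b c} {c} (inf-≼ʳ b c)) (≤-≈ (≈-sym {y} {c} eq)) })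

    -- Meets are controlled by `above` and joins by `below`; hence the passage to the dual
    -- description and back.
    join-half : ∀ {a b c j₁ j₂} → SameAbove a b → IsLUB (Pair a c) j₁ → IsLUB (Pair b c) j₂ → SameAbove j₁ j₂
    join-half {a} {b} {c} {j₁} {j₂} same (_ , le₁) (ub₂ , _) = below⇒above {j₁} {j₂} λ ch nc h →
      below-anti {j₁} {sup a c} ch j₁≼sup (below-sup a c ch
        (above⇒below {a} {b} same ch nc (below-anti {b} {j₂} ch (≤⇒≼ (ub₂ b (inj₁ (≈-refl {b})))) h))
        (below-anti {c} {j₂} ch (≤⇒≼ (ub₂ c (inj₂ (≈-refl {c})))) h))
      where
      j₁≼sup : j₁ ≼ sup a c
      j₁≼sup = ≤⇒≼ (le₁ (sup a c) λ
        { y (inj₁ eq) → ≤-trans (≤-≈ eq) (≼⇒≤ {a} {sup a c} (≼-supˡ a c))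
        ; y (inj₂ eq) → ≤-trans (≤-≈ eq) (≼⇒≤ {c} {sup a c} (≼-supʳ a c)) })

    θ-congruence : IsCongruence θ
    θ-congruence = record
      { reflθ = λ x y eq → (λ _ _ → above-mono {x} {y} (≈⇒≼ {x} {y} eq)) , (λ _ _ → above-mono {y} {x} (≈⇒≼ {y} {x} (≈-sym {x} {y} eq)))
      ; symθ = λ { x y (h , k) → k , h }
      ; transθ = λ { x y z (h , k) (h′ , k′) → (λ ch nc a → h′ ch nc (h ch nc a)) , (λ ch nc a → k ch nc (k′ ch nc a)) }
      ; meetθ = λ { a b c m₁ m₂ (h , k) g₁ g₂ → meet-half {a} {b} {c} {m₁} {m₂} h g₁ g₂ , meet-half {b} {a} {c} {m₂} {m₁} k g₂ g₁ }
      ; joinθ = λ { a b c j₁ j₂ (h , k) l₁ l₂ → join-half {a} {b} {c} {j₁} {j₂} h l₁ l₂ , join-half {b} {a} {c} {j₂} {j₁} k l₂ l₁ } }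

  module _ {x y R₁ R₂} (fl : Flipped x y R₁ R₂) where
    open LabelFacts fl
    open LabelCongruence e mid f

    -- By `forced`, a path in `above y` that is not in `above x` contains the label, and so crosses
    -- it.
    collapses-own : θ x y
    collapses-own = (λ {_} {K} _ _ → above-mono {x} {y} {K} (Flipped.lower-≼-upper fl)) , down
      where
      down : SameAbove y x
      down {K = K} ch nc aK X∈ h with forced ch (λ S∈ → aK S∈) X∈ h
      ... | pre , post , eq = nc (pre , e , f , post ,
            trans eq (trans (cong (λ z → pre ʳ++ (z ++ post)) upper≡label)
              (cong (λ z → pre ʳ++ (e ∷ z)) (++-assoc mid (f ∷ []) post))) ,
            inj₁ refl , inj₁ refl)

  -- `upper` itself distinguishes `x` from `y`, so it must be among the forgotten paths. The double
  -- negation is harmless, as it is used to prove a decidable equality of labels.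
  crossed-if-collapsed : ∀ {x y R₁ R₂ e mid f} (fl : Flipped x y R₁ R₂) →
    LabelCongruence.θ e mid f x y → ¬ ¬ LabelCongruence.Crosses e mid f (LabelFacts.upper fl)
  crossed-if-collapsed fl (_ , down) nc = not-above-upper (down (proj₂ upper-chain) nc above-upper)
    where open LabelFacts fl

  crosses-length : ∀ {e mid f e′ mid′ f′} → LabelCongruence.Crosses e mid f (e′ ∷ (mid′ ++ f′ ∷ [])) →
    length mid ℕ.≤ length mid′
  crosses-length {mid = mid} {mid′ = mid′} (pre , x , y , post , eq , _) = ℕₚ.+-cancelʳ-≤ 2 _ _ (begin
    length mid + 2                                    ≤⟨ ℕₚ.≤-trans (ℕₚ.m≤m+n _ (length post)) (ℕₚ.≤-reflexive (ℕₚ.+-assoc (length mid) 2 (length post))) ⟩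
    length mid + suc (suc (length post))              ≡⟨ ℕₚ.+-suc (length mid) (suc (length post)) ⟩
    suc (length mid + suc (length post))              ≡⟨ cong suc (length-++ mid) ⟨
    length (x ∷ (mid ++ y ∷ post))                    ≤⟨ ℕₚ.m≤n+m _ (length pre) ⟩
    length pre + length (x ∷ (mid ++ y ∷ post))       ≡⟨ length-ʳ++ pre ⟨
    length (pre ʳ++ (x ∷ (mid ++ y ∷ post)))          ≡⟨ cong length eq ⟨
    suc (length (mid′ ++ _ ∷ []))                     ≡⟨ cong suc (length-++ mid′) ⟩
    suc (length mid′ + 1)                             ≡⟨ ℕₚ.+-suc (length mid′) 1 ⟨
    length mid′ + 2                                   ∎)
    where open ℕₚ.≤-Reasoning

  crosses-tight : ∀ {e mid f e′ mid′ f′} → LabelCongruence.Crosses e mid f (e′ ∷ (mid′ ++ f′ ∷ [])) →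
    length mid′ ℕ.≤ length mid → mid′ ≡ mid × (e′ ≡ e ⊎ e′ <I e) × (f ≡ f′ ⊎ f <O f′)
  crosses-tight {e} {mid} {f} {e′} {mid′} {f′} (pre , x , y , post , eq , lx , ly) le with ∷-split pre eq
  ... | inj₁ (refl , refl , eq₁) with ∷ʳ-split mid′ mid eq₁
  ...   | inj₁ (refl , refl , refl) = refl , lx , ly
  ...   | inj₂ (post₁ , refl , refl) = ⊥-elim (ℕₚ.<⇒≱ (ℕₚ.≤-trans (ℕₚ.m<m+n (length mid) (s≤s z≤n)) (ℕₚ.≤-reflexive (sym (length-++ mid)))) le)
  crosses-tight {e} {mid} {f} {e′} {mid′} {f′} (pre , x , y , post , eq , lx , ly) le | inj₂ (pre₁ , refl , eq₁)
    with ∷ʳ-split mid′ (pre₁ ʳ++ (x ∷ mid)) (trans eq₁ (sym (ʳ++-assoc pre₁ (x ∷ mid) (y ∷ post))))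
  ... | inj₁ (refl , refl , refl) = ⊥-elim (ℕₚ.<⇒≱ (longer pre₁) le)
    where
    longer : ∀ pre₁ → length mid ℕ.< length (pre₁ ʳ++ (x ∷ mid))
    longer pre₁ = subst (length mid ℕ.<_) (sym (length-ʳ++ pre₁)) (ℕₚ.m≤n+m (suc (length mid)) (length pre₁))
  ... | inj₂ (post₁ , refl , refl) = ⊥-elim (ℕₚ.<⇒≱ (longer pre₁) (ℕₚ.≤-trans
          (subst (length (pre₁ ʳ++ (x ∷ mid)) ℕ.≤_) (sym (length-++ (pre₁ ʳ++ (x ∷ mid)))) (ℕₚ.m≤m+n _ _)) le))
    where
    longer : ∀ pre₁ → length mid ℕ.< length (pre₁ ʳ++ (x ∷ mid))
    longer pre₁ = subst (length mid ℕ.<_) (sym (length-ʳ++ pre₁)) (ℕₚ.m≤n+m (suc (length mid)) (length pre₁))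

  -- Each middle occurs inside the other, so they coincide; then the end edges are weakly comparable
  -- both ways.
  crosses-antisym : ∀ {e mid f e′ mid′ f′} → LabelCongruence.Crosses e mid f (e′ ∷ (mid′ ++ f′ ∷ [])) →
    LabelCongruence.Crosses e′ mid′ f′ (e ∷ (mid ++ f ∷ [])) → _≡_ {A = Path} (e′ ∷ (mid′ ++ f′ ∷ [])) (e ∷ (mid ++ f ∷ []))
  crosses-antisym h k with crosses-tight h (crosses-length k) | crosses-tight k (crosses-length h)
  ... | refl , inj₁ refl , inj₁ refl | _ = refl
  ... | refl , inj₂ l , _ | _ , inj₁ refl , _ = ⊥-elim (I-irr l)
  ... | refl , inj₂ l , _ | _ , inj₂ l′ , _ = ⊥-elim (I-irr (I-trans l l′))
  ... | refl , inj₁ refl , inj₂ m | _ , _ , inj₁ refl = ⊥-elim (O-irr m)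
  ... | refl , inj₁ refl , inj₂ m | _ , _ , inj₂ m′ = ⊥-elim (O-irr (O-trans m m′))

  sameCg⇒same-label : ∀ {x y R₁ R₂ x′ y′ R₁′ R₂′} (fl : Flipped x y R₁ R₂) (fl′ : Flipped x′ y′ R₁′ R₂′) →
    SameCg x y x′ y′ → LabelFacts.label fl ≡ LabelFacts.label fl′
  sameCg⇒same-label fl fl′ same = decidable-stable (L.label ≟ₚ L′.label) λ ne →
    crossed-if-collapsed fl (Equivalence.from (same _ C′.θ-congruence) (collapses-own fl′)) λ h →
    crossed-if-collapsed fl′ (Equivalence.to (same _ C.θ-congruence) (collapses-own fl)) λ k →
    ne (crosses-antisym (subst C′.Crosses L.upper≡label h) (subst C.Crosses L′.upper≡label k))
    where
    module L = LabelFacts fl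
    module L′ = LabelFacts fl′
    module C = LabelCongruence L.e L.mid L.f
    module C′ = LabelCongruence L′.e L′.mid L′.f

  -- Core label sets

  -- Up to `≈` every element covered by `x` is one of these lists, with `R₁` from the finite list of
  -- routes; this makes the lower covers searchable.
  replaced : MC → Path → Path → List Path
  replaced x R₁ R₂ = R₁ ∷ filter (λ Q → ¬? (Q ≟ₚ R₂)) ⟦ x ⟧

  maxClique? : ∀ C → Dec (MaxClique C)
  maxClique? C = map′
    (λ { (r , c , m) → record
      { route = lookup r ; coh = λ D∈ U∈ → lookup (lookup c D∈) U∈
      ; max = λ rt (a , b) → lookup m (routes-complete rt)
          (tabulate (λ P∈ → a P∈)) (tabulate (λ P∈ → b P∈)) } })
    (λ mc → tabulate (MaxClique.route mc) , tabulate (λ D∈ → tabulate (λ U∈ → MaxClique.coh mc D∈ U∈)) ,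
      tabulate (λ R∈ a b → MaxClique.max mc (routes-sound R∈) ((λ P∈ → lookup a P∈) , (λ P∈ → lookup b P∈))))
    (all? route? C ×-dec all? (λ D → all? (λ U → ¬? (D ◁? U)) C) C ×-dec
     all? (λ R → all? (λ P → ¬? (P ◁? R)) C →-dec (all? (λ P → ¬? (R ◁? P)) C →-dec (R ∈? C))) routes)

  maxClique-resp : ∀ {C C′} → (∀ {R} → R ∈ C → R ∈ C′) → (∀ {R} → R ∈ C′ → R ∈ C) → MaxClique C → MaxClique C′
  maxClique-resp f g mc = record
    { route = λ R∈ → route (g R∈) ; coh = λ D∈ U∈ → coh (g D∈) (g U∈)
    ; max = λ r (a , b) → f (max r ((λ P∈ → a (f P∈)) , (λ P∈ → b (f P∈)))) }
    where open MaxClique mc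

  module _ {x y R₁ R₂} (fl : Flipped x y R₁ R₂) where
    open Flipped fl

    replaced⊆ : ∀ {R} → R ∈ replaced y R₁ R₂ → R ∈ ⟦ x ⟧
    replaced⊆ (here refl) = R₁∈
    replaced⊆ (there R∈) with ∈-filter⁻ (λ Q → ¬? (Q ≟ₚ R₂)) {xs = ⟦ y ⟧} R∈
    ... | R∈y , ne = [ (λ eq → ⊥-elim (ne eq)) , (λ R∈x → R∈x) ]′ (C′⊆ R∈y)

    ⊆replaced : ∀ {R} → R ∈ ⟦ x ⟧ → R ∈ replaced y R₁ R₂
    ⊆replaced R∈ with C⊆ R∈
    ... | inj₁ refl = here refl
    ... | inj₂ R∈y = there (∈-filter⁺ (λ Q → ¬? (Q ≟ₚ R₂)) R∈y λ { refl → R₂∉ R∈ })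

  replaced-flip : ∀ {x R₁ R₂} (mc : MaxClique (replaced x R₁ R₂)) → R₂ ∈ ⟦ x ⟧ → R₁ ◁ R₂ → Flip (toMC mc) x R₁ R₂
  replaced-flip {x} {R₁} {R₂} mc R₂∈ h = here refl , (λ Q → mk⇔ forth back) , Place.v π , Place⇒CW π
    where
    π = place-zip (MaxClique.route mc (here refl)) (clique-route x R₂∈) h
    forth : ∀ {Q} → Q ∈ ⟦ x ⟧ → (Q ∈ replaced x R₁ R₂ × Q ≢ R₁) ⊎ Q ≡ R₂
    forth {Q} Q∈ with Q ≟ₚ R₂
    ... | yes eq = inj₂ eq
    ... | no ne = inj₁ (there (∈-filter⁺ (λ Q → ¬? (Q ≟ₚ R₂)) Q∈ ne) , λ { refl → clique-below x Q∈ R₂∈ h })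
    back : ∀ {Q} → (Q ∈ replaced x R₁ R₂ × Q ≢ R₁) ⊎ Q ≡ R₂ → Q ∈ ⟦ x ⟧
    back (inj₂ refl) = R₂∈
    back (inj₁ (here eq , ne)) = ⊥-elim (ne eq)
    back (inj₁ (there Q∈ , _)) = proj₁ (∈-filter⁻ (λ Q → ¬? (Q ≟ₚ R₂)) {xs = ⟦ x ⟧} Q∈)

  -- The routes of the elements covered by x generate x↓.
  module Descent (x : MC) where
    InLower : Path → Path → Path → Set
    InLower D R₁ R₂ = D ∈ replaced x R₁ R₂ × MaxClique (replaced x R₁ R₂) × R₁ ◁ R₂

    inLower? : ∀ D → Dec (Any (λ R₂ → Any (λ R₁ → InLower D R₁ R₂) routes) ⟦ x ⟧)
    inLower? D = any? (λ R₂ → any? (λ R₁ →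
      (D ∈? replaced x R₁ R₂) ×-dec maxClique? (replaced x R₁ R₂) ×-dec (R₁ ◁? R₂)) routes) ⟦ x ⟧

    𝒟 : List Path
    𝒟 = filter inLower? routes

    𝒟-routes : ∀ {D} → D ∈ 𝒟 → IsRoute D
    𝒟-routes D∈ = routes-sound (proj₁ (∈-filter⁻ inLower? {xs = routes} D∈))

    x↓ : MC
    x↓ = Concept.meet 𝒟 𝒟-routes

    x↓-≼ : ∀ y → Cover y x → x↓ ≼ y
    x↓-≼ y cov with cover⇒flip {y} {x} cov
    ... | R₁ , R₂ , fl = meet-≼-⊆ 𝒟-routes {y} λ {D} D∈ → ∈-filter⁺ inLower? (routes-complete (clique-route y D∈))
            (lose (Flipped.R₂∈ fl′) (lose (routes-complete (clique-route y (Flipped.R₁∈ fl′)))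
              (⊆replaced fl′ D∈ , maxClique-resp (⊆replaced fl′) (replaced⊆ fl′) (clique y) , Flipped.R₁◁R₂ fl′)))
      where
      fl′ : Flipped y x R₁ R₂
      fl′ = flip⇒flipped {y} {x} fl

    ≼-x↓ : ∀ z → (∀ y → Cover y x → z ≤ y) → z ≼ x↓
    ≼-x↓ z lb = ≼-meet 𝒟-routes {z} below-all
      where
      below-all : ∀ {D Z} → D ∈ 𝒟 → Z ∈ ⟦ z ⟧ → ¬ D ◁ Z
      below-all D∈ Z∈ with find (proj₂ (∈-filter⁻ inLower? {xs = routes} D∈))
      ... | R₂ , R₂∈ , any with find any
      ... | R₁ , _ , (D∈y , mc , h) =
        ≤⇒≼ {z} {toMC mc} (lb (toMC mc) (LabelFacts.flip-cover (flip⇒flipped {toMC mc} {x} (replaced-flip {x} mc R₂∈ h)))) Z∈ D∈y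

    x↓-glb : IsGLB (λ y → Cover y x) x↓
    x↓-glb = (λ y cov → ≼⇒≤ {x↓} {y} (x↓-≼ y cov)) , (λ z lb → ≼⇒≤ {z} {x↓} (≼-x↓ z lb))

    cover-down : ∀ {u} → Cover u x → DownBelow x u
    cover-down {u} cov = x↓ , x↓-glb , ≼⇒≤ {x↓} {u} (x↓-≼ u cov)

  record Labelled (x y : MC) (L : Path) : Set where
    field
      {R₁ R₂}  : Path
      isFlip   : Flip x y R₁ R₂
      flipped  : Flipped x y R₁ R₂
      label≡   : LabelFacts.label flipped ≡ L

  labelled : ∀ {x y L} → CcwLabel x y L → Labelled x y L
  labelled {x} {y} (R₁ , R₂ , fl , lab) = record { isFlip = fl ; flipped = fl′ ; label≡ =
    label-unique (clique-route y (Flipped.R₂∈ fl′)) (LabelFacts.label-of fl′) lab }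
    where
    fl′ : Flipped x y R₁ R₂
    fl′ = flip⇒flipped {x} {y} fl

  labelled⇒ccw : ∀ {x y L} → Labelled x y L → CcwLabel x y L
  labelled⇒ccw l = R₁ , R₂ , isFlip , subst (LabelOf R₁ R₂) label≡ (LabelFacts.label-of flipped)
    where open Labelled l

  abstract
    ⋖-labelled : ∀ {x y} → x ⋖ y → ∃ λ L → Labelled x y L
    ⋖-labelled {x} {y} (R₁ , R₂ , fl) =
      LabelFacts.label fl′ , record { isFlip = fl ; flipped = fl′ ; label≡ = refl }
      where
      fl′ : Flipped x y R₁ R₂
      fl′ = flip⇒flipped {x} {y} fl

  cover-labelled : ∀ {x y} → Cover x y → ∃ λ L → Labelled x y L
  cover-labelled {x} {y} cov = ⋖-labelled {x} {y} (cover⇒flip {x} {y} cov)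

  label-upper : ∀ {x y L} (l : Labelled x y L) → LabelFacts.upper (Labelled.flipped l) ≡ L
  label-upper l = trans (LabelFacts.upper≡label (Labelled.flipped l)) (Labelled.label≡ l)

  -- `Smallest.J L` is built from `L` alone. The flip enters only through the lower cover, which is
  -- unique up to `≈`; so equally labelled flips share a congruence.
  joinIrr-of-label : ∀ {x y L} → Labelled x y L → ∃ λ j* → JoinIrr (Smallest.J L) j* × SameCg x y j* (Smallest.J L)
  joinIrr-of-label {x} {y} l = J* , subst (λ U → JoinIrr (Smallest.J U) J* × SameCg x y J* (Smallest.J U))
    (label-upper l) (J-joinIrr , J-sameCg)
    where open FlipJoinIrr (Labelled.flipped l)

  same-label⇒sameCg : ∀ {x y x′ y′ L} → Labelled x y L → Labelled x′ y′ L → SameCg x y x′ y′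
  same-label⇒sameCg {x} {y} {x′} {y′} {L} l l′ = compose (joinIrr-of-label l) (joinIrr-of-label l′)
    where
    open Smallest L using (J)
    compose : (∃ λ j* → JoinIrr J j* × SameCg x y j* J) → (∃ λ j* → JoinIrr J j* × SameCg x′ y′ j* J) → SameCg x y x′ y′
    compose (j₁ , ji₁ , cg₁) (j₂ , ji₂ , cg₂) = SameCg-trans {x} {y} {j₂} {J} {x′} {y′}
      (SameCg-trans {x} {y} {j₁} {J} {j₂} {J} cg₁ (SameCg-≈ {j₁} {j₂} {J} (JoinIrr-unique {J} {j₁} {j₂} ji₁ ji₂)))
      (SameCg-sym {x′} {y′} {j₂} {J} cg₂)

  sameCg⇒label : ∀ {x y x′ y′ L L′} → Labelled x y L → Labelled x′ y′ L′ → SameCg x y x′ y′ → L ≡ L′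
  sameCg⇒label l l′ cg = trans (sym (Labelled.label≡ l))
    (trans (sameCg⇒same-label (Labelled.flipped l) (Labelled.flipped l′) cg) (Labelled.label≡ l′))

  flip⇒cover : ∀ {x y L} → Labelled x y L → Cover x y
  flip⇒cover l = LabelFacts.flip-cover (Labelled.flipped l)

  -- Comparison of the two kinds of core label sets.

  -- The label is traded for its join-irreducible; the core label set of `y` returns some cover with
  -- the same congruence, and that congruence gives back the label.
  ψ-mono : ∀ {x y} → x ⊑ y → PsiCCW x ⊆ₚ PsiCCW y
  ψ-mono {x} {y} x⊑y L (u , v , down , lab , v≤x) = transfer (joinIrr-of-label l)
    where
    open Smallest L using (J)
    l : Labelled u v L
    l = labelled {u} {v} lab
    transfer : (∃ λ j* → JoinIrr J j* × SameCg u v j* J) → PsiCCW y L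
    transfer (j* , ji , cg) = return (x⊑y J (j* , ji , u , v , down , flip⇒cover l , v≤x , cg))
      where
      return : CoreLabel y J → PsiCCW y L
      return (j*′ , ji′ , u′ , v′ , down′ , cov′ , v′≤y , cg′) =
        u′ , v′ , down′ , subst (CcwLabel u′ v′) (sym same) (labelled⇒ccw l′) , v′≤y
        where
        L′ : Path
        L′ = proj₁ (cover-labelled {u′} {v′} cov′)
        l′ : Labelled u′ v′ L′
        l′ = proj₂ (cover-labelled {u′} {v′} cov′)
        same : L ≡ L′
        same = sameCg⇒label l l′ (SameCg-trans {u} {v} {j*} {J} {u′} {v′} cg
          (SameCg-trans {j*} {J} {j*′} {J} {u′} {v′} (SameCg-≈ {j*} {j*′} {J} (JoinIrr-unique {J} {j*} {j*′} ji ji′))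
            (SameCg-sym {u′} {v′} {j*′} {J} cg′)))

  ψ-reflect : ∀ {x y} → PsiCCW x ⊆ₚ PsiCCW y → x ⊑ y
  ψ-reflect {x} {y} sub j (j* , ji , u , v , down , cov , v≤x , cg) =
    transfer (sub L (u , v , down , labelled⇒ccw l , v≤x))
    where
    L : Path
    L = proj₁ (cover-labelled {u} {v} cov)
    l : Labelled u v L
    l = proj₂ (cover-labelled {u} {v} cov)
    transfer : PsiCCW y L → CoreLabel y j
    transfer (u′ , v′ , down′ , lab′ , v′≤y) =
      j* , ji , u′ , v′ , down′ , flip⇒cover l′ , v′≤y ,
      SameCg-trans {u′} {v′} {u} {v} {j*} {j} (same-label⇒sameCg l′ l) cg
      where
      l′ : Labelled u′ v′ L
      l′ = labelled {u′} {v′} lab′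

  inf-≉ : ∀ {x y} → ¬ x ≼ y → ¬ inf x y ≈ x
  inf-≉ {x} {y} x⋠y eq = x⋠y λ {R} {R′} R∈ R′∈ h → inf-≼ʳ x y (proj₂ (eq R) R∈) R′∈ h

  separating-flip : ∀ {x y} → ¬ inf x y ≈ x → ∃ λ u → inf x y ≤ u × u ⋖ x
  separating-flip {x} {y} ne = last-flip {inf x y} {x} (≼⇒≤ {inf x y} {x} (inf-≼ˡ x y)) ne

  labelled-above : ∀ {u v L} → Labelled u v L → above v L
  labelled-above {u} {v} l = subst (λ K → above v K) (label-upper l) (LabelFacts.above-upper {u} {v} (Labelled.flipped l))

  labelled-not-above : ∀ {u v L} → Labelled u v L → ¬ above u L
  labelled-not-above {u} {v} l a = LabelFacts.not-above-upper {u} {v} (Labelled.flipped l)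
    (subst (λ K → above u K) (sym (label-upper l)) a)

  labelled-chain : ∀ {u v L} → Labelled u v L → ∃ λ w → Chain w L
  labelled-chain {u} {v} l = subst (λ K → ∃ λ w → Chain w K) (label-upper l) (LabelFacts.upper-chain {u} {v} (Labelled.flipped l))

  ψ-above : ∀ {y L} → PsiCCW y L → above y L
  ψ-above {y} {L} (u , v , _ , lab , v≤y) = above-mono {v} {y} {L} (≤⇒≼ {v} {y} v≤y)
    (labelled-above {u} {v} {L} (labelled {u} {v} {L} lab))

  -- Both `x` and `y` would have `L` in `above`, hence so would their meet and the element `u` over
  -- it, contrary to `L` labelling the flip from `u`.
  separating-label : ∀ {x y u L} → inf x y ≤ u → Labelled u x L → ¬ PsiCCW y L
  separating-label {x} {y} {u} {L} inf≤u l ψ = labelled-not-above {u} {x} {L} l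
    (above-mono {inf x y} {u} {L} (≤⇒≼ {inf x y} {u} inf≤u)
      (above-inf x y {K = L} (proj₂ (labelled-chain {u} {x} {L} l)) (labelled-above {u} {x} {L} l) (ψ-above {y} {L} ψ)))

  ψ-⊆⇒≼ : ∀ {x y} → PsiCCW x ⊆ₚ PsiCCW y → x ≼ y
  ψ-⊆⇒≼ {x} {y} sub R∈ R′∈ h =
    let (u , inf≤u , st) = separating-flip {x} {y} (inf-≉ {x} {y} (λ x≼y → x≼y R∈ R′∈ h))
        (L , l) = ⋖-labelled {u} {x} st
    in separating-label {x} {y} {u} {L} inf≤u l
         (sub L (u , x , Descent.cover-down x {u} (flip⇒cover {u} {x} l) , labelled⇒ccw {u} {x} l , ≤-refl {x}))

  cover-≈ : ∀ {x y w} → x ≈ y → Cover w x → Cover w y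
  cover-≈ {x} {y} {w} eq ((w≤x , x≰w) , gap) =
    (≤-trans w≤x (≤-≈ eq) , λ y≤w → x≰w (≤-trans (≤-≈ eq) y≤w)) ,
    λ { z ((w≤z , z≰w) , (z≤y , y≰z)) → gap z ((w≤z , z≰w) ,
        (≤-trans z≤y (≤-≈ (≈-sym {x} {y} eq)) , λ x≤z → y≰z (≤-trans (≤-≈ (≈-sym {x} {y} eq)) x≤z))) }

  ψ-≈ : ∀ {x y} → x ≈ y → PsiCCW x ⊆ₚ PsiCCW y
  ψ-≈ {x} {y} eq L (u , v , (m , (lb , gr) , m≤u) , lab , v≤x) =
    u , v , (m , ((λ w cov → lb w (cover-≈ {y} {x} {w} eq′ cov)) ,
      (λ z lbz → gr z λ w cov → lbz w (cover-≈ {x} {y} {w} eq cov))) , m≤u) , lab , ≤-trans v≤x (≤-≈ eq)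
    where
    eq′ : y ≈ x
    eq′ = ≈-sym {x} {y} eq

theoremB : (G : FlowGraph) (F : Framing G) →
    let open Framed G F in
    Σ (MC → CCWSet) λ f →
    (∀ x y → x ≈ y → proj₁ (f x) ≐ proj₁ (f y)) ×
    (∀ x y → proj₁ (f x) ≐ proj₁ (f y) → x ≈ y) ×
    (∀ (S : CCWSet) → ∃ λ x → proj₁ (f x) ≐ proj₁ S) ×
    (∀ x y → (x ⊑ y → proj₁ (f x) ⊆ₚ proj₁ (f y)) × (proj₁ (f x) ⊆ₚ proj₁ (f y) → x ⊑ y))
theoremB G F =
  (λ x → PsiCCW x , x , λ L → (λ h → h) , (λ h → h)) ,
  (λ x y eq L → ψ-≈ {x} {y} eq L , ψ-≈ {y} {x} (≈-sym {x} {y} eq) L) ,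
  (λ x y same → ≼-antisym {x} {y} (ψ-⊆⇒≼ {x} {y} (λ L → proj₁ (same L))) (ψ-⊆⇒≼ {y} {x} (λ L → proj₂ (same L)))) ,
  (λ { (S , x , eq) → x , λ L → proj₂ (eq L) , proj₁ (eq L) }) ,
  λ x y → ψ-mono {x} {y} , ψ-reflect {x} {y}
  where
  open Framed G F using (PsiCCW)
  open FramingLattice G F
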